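{- Let $q$ be an odd prime power. (a) If $q\equiv 3\pmod 4$, then $\Omega(n,q)=\emptyset$ for all $n\equiv 2\pmod 4$ and $\tilde\Omega(n+1,q)=\emptyset$ for all $n\equiv 1\pmod 4$. (b) If $q\equiv 3\pmod 4$ and $n=n(q)$ satisfies $n\to\infty$ and $n/q^{1/4}\to 0$ as $q\to\infty$, then $|\Omega(n,q)|=(1+o(1))2^{2-n}\binom{q}{n}$ when $n\equiv 0\pmod 4$, and $|\tilde\Omega(n+1,q)|=(1+o(1))2^{1-n}\binom{q}{n}$ when $n\equiv 3\pmod 4$. (c) If $q\equiv 1\pmod 4$ and $n=n(q)$ satisfies $n\to\infty$ and $n/q^{1/4}\to 0$ as $q\to\infty$, then $|\Omega(n,q)|=(1+o(1))2^{2-n}\binom{q}{n}$ when $n$ is even, and $|\tilde\Omega(n+1,q)|=(1+o(1))2^{1-n}\binom{q}{n}$ when $n$ is odd. Here $o(1)\to0$ as $q\to\infty$.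
   Context: Let $\eta$ be the quadratic character of $\mathbb{F}_q$ ($1$ on nonzero squares, $-1$ on nonsquares). For $\mathcal{S}=\{\alpha_1,\dots,\alpha_n\}\subseteq\mathbb{F}_q$, $\Delta_{\mathcal{S}}(\alpha_i)=\prod_{j\neq i}(\alpha_i-\alpha_j)$. For even $n$, $\Omega(n,q)$ is the set of all $n$-element subsets $\mathcal{S}\subseteq\mathbb{F}_q$ such that the values $\eta(\Delta_{\mathcal{S}}(\alpha_i))$, $1\le i\le n$, are all equal (equivalently, some generalized Reed–Solomon code $GRS_{n/2}(\boldsymbol\alpha,\boldsymbol v)$, $\boldsymbol v\in(\mathbb{F}_q^*)^n$, is self-dual). For odd $n$, $\tilde\Omega(n+1,q)$ is the set of all $n$-element subsets $\mathcal{S}\subseteq\mathbb{F}_q$ with $\eta(-\Delta_{\mathcal{S}}(\alpha_i))=1$ for all $i$ (equivalently, some extended GRS code $GRS_{(n+1)/2}(\boldsymbol\alpha,\boldsymbol v,\infty)$ is self-dual). -}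

module Defs where

open import Level using (0ℓ)
open import Data.Nat as ℕ using (ℕ; zero; suc; _≤_; _^_; _%_; ∣_-_∣)
open import Data.Nat.Primality using (Prime)
open import Data.Integer as ℤ using (ℤ; +_; -[1+_])
open import Data.Bool using (Bool; true; false; if_then_else_; _∧_; _∨_)
open import Data.List using (List; []; _∷_; length; filter; foldr)
open import Data.List.Membership.Propositional using (_∈_)
open import Data.List.Relation.Unary.Unique.Propositional using (Unique)
open import Data.Product using (Σ; ∃; _×_; _,_)
open import Relation.Nullary using (¬_; Dec; yes; no)
open import Relation.Nullary.Decidable using (⌊_⌋)
open import Relation.Binary.PropositionalEquality using (_≡_)
import Algebra.Structures as AS

allB : {A : Set} → (A → Bool) → List A → Bool
allB p []       = true
allB p (x ∷ xs) = p x ∧ allB p xs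

anyB : {A : Set} → (A → Bool) → List A → Bool
anyB p []       = false
anyB p (x ∷ xs) = p x ∨ anyB p xs

IsPrimePower : ℕ → Set
IsPrimePower q = Σ ℕ λ p → Σ ℕ λ k → Prime p × (1 ≤ k) × (q ≡ p ^ k)

IsOddPrimePower : ℕ → Set
IsOddPrimePower q = IsPrimePower q × (q % 2 ≡ 1)

record FiniteField (q : ℕ) : Set₁ where
  infixl 7 _*_
  infixl 6 _+_ _-_
  infix 4 _≟_
  field
    Carrier : Set
    _+_ _*_ : Carrier → Carrier → Carrier
    -_      : Carrier → Carrier
    0# 1#   : Carrier
    isCommutativeRing : AS.IsCommutativeRing {A = Carrier} _≡_ _+_ _*_ -_ 0# 1#
    0≢1     : ¬ (0# ≡ 1#)
    inverse : ∀ x → ¬ (x ≡ 0#) → Σ Carrier λ y → x * y ≡ 1#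
    _≟_     : (x y : Carrier) → Dec (x ≡ y)
    elements : List Carrier
    complete : ∀ x → x ∈ elements
    unique   : Unique elements
    size     : length elements ≡ q

  _-_ : Carrier → Carrier → Carrier
  x - y = x + (- y)

module _ {q : ℕ} (F : FiniteField q) where
  open FiniteField F

  η : Carrier → ℤ
  η x with x ≟ 0#
  ... | yes _ = + 0
  ... | no  _ = if anyB (λ y → ⌊ y * y ≟ x ⌋) elements then + 1 else -[1+ 0 ]

  prod : List Carrier → Carrier
  prod = foldr _*_ 1#

  -- Δ_S(a) = ∏_{b ∈ S, b ≠ a} (a - b)   (S given as a duplicate-free list)
  Δ : List Carrier → Carrier → Carrier
  Δ S a = prod (Data.List.map (λ b → a - b) (filter (λ b → ¬? (a ≟ b)) S))
    where open import Relation.Nullary using (¬?)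

  -- all sublists of a list (as subsets, when the list has no duplicates)
  sublists : List Carrier → List (List Carrier)
  sublists []       = [] ∷ []
  sublists (x ∷ xs) = sublists xs Data.List.++ Data.List.map (x ∷_) (sublists xs)

  -- the n-element subsets of F_q, each occurring exactly once
  nSubsets : ℕ → List (List Carrier)
  nSubsets n = filter (λ S → length S ℕ.≟ n) (sublists elements)

  _==ℤ_ : ℤ → ℤ → Bool
  a ==ℤ b = ⌊ a ℤ.≟ b ⌋

  allEqualη : List Carrier → Bool
  allEqualη S = allB (λ a → allB (λ b → η (Δ S a) ==ℤ η (Δ S b)) S) S

  allMinusSquare : List Carrier → Bool
  allMinusSquare S = allB (λ a → η (- Δ S a) ==ℤ (+ 1)) S

  -- Ω(n,q) (meaningful for even n) as a list of n-subsets
  Ω : ℕ → List (List Carrier)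
  Ω n = filter (λ S → allEqualη S Data.Bool.≟ true) (nSubsets n)

  -- Ω̃(n+1,q) (meaningful for odd n), the n-subsets S with η(-Δ_S(α))=1
  Ω̃ : ℕ → List (List Carrier)
  Ω̃ n = filter (λ S → allMinusSquare S Data.Bool.≟ true) (nSubsets n)

TendsToInfinity : (ℕ → Set) → (ℕ → ℕ) → Set
TendsToInfinity P n = ∀ M → Σ ℕ λ Q → ∀ q → Q ≤ q → P q → M ≤ n q

-- n(q) / q^{1/4} → 0, i.e. ∀ k ≥ 1, eventually k·n(q) < q^{1/4}, i.e. (k·n(q))^4 < q
QuarticSmall : (ℕ → Set) → (ℕ → ℕ) → Set
QuarticSmall P n = ∀ k → 1 ≤ k → Σ ℕ λ Q → ∀ q → Q ≤ q → P q → ((k ℕ.* n q) ^ 4) ℕ.< q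

-- For every finite field F of order q (q satisfying P), A F / B q → 1 as q → ∞:
-- ∀ k ≥ 1, eventually k · |A F - B q| ≤ B q.
RatioTendsToOne : (P : ℕ → Set) → (A : ∀ {q} → FiniteField q → ℕ) → (B : ℕ → ℕ) → Set₁
RatioTendsToOne P A B =
  ∀ k → 1 ≤ k → Σ ℕ λ Q → ∀ q → Q ≤ q → P q → (F : FiniteField q) →
    k ℕ.* ∣ A F - B q ∣ ≤ B q

{-# OPTIONS --safe #-}
module Submission where

-- For a sign ε, the indicator of "η(Δ_S(a)) = ε for all a ∈ S" is 2⁻ⁿ ∏ (1 + ε η(Δ_S(a))). Expanding the product,
-- the term of T ⊆ S is, up to a sign depending only on |T|, X(T, S ∖ T), where X(T, U) = ∏ η(a - b) over a ∈ T, b ∈ U.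
-- The sets T = ∅ and T = S give the main term; that ∏ η(Δ_S(a)) over a ∈ S is η(-1)^(n(n-1)/2) gives part (a).
--
-- As X(T, U) = 0 when T and U meet, the sum over S of the remaining terms with |T| = t runs over independent T and U,
-- and by symmetry t ≤ n/2. For fixed T it is the elementary symmetric function of degree n - t of the values of
-- w ↦ ∏ η(a - w), a ∈ T. Since n - t ≥ n/2, square-root cancellation is not needed: it is enough that each of the values
-- ±1 is taken at most 17q/32 times. Then (1 + z)^P (1 - z)^M = (1 ± z)^|P-M| (1 - z²)^min(P,M) bounds the symmetric
-- function by C(q/8, n - t), which beats the 2ⁿ choices of T.
--
-- The bound on the level sets is Stepanov's method: with f = ∏ (x - a) and c = (q-1)/2, linear algebra yields a nonzero
-- polynomial Σⱼ (rⱼ + sⱼ f^c) x^(qj) vanishing to high order wherever f^c takes a given value. It is nonzero because its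
-- expansion at a root of f, where f^c is divisible by the c-th power of the local parameter, separates the rⱼ and sⱼ.

open import Defs
open import Level using (0ℓ)
open import Function using (_∘_)
open import Function.Bundles using (mk⇔)
open import Algebra.Bundles using (CommutativeRing)
import Algebra.Properties.AbelianGroup
import Algebra.Properties.Ring
import Algebra.Solver.Ring.NaturalCoefficients.Default
import Data.Nat as ℕ
open import Data.Nat using (ℕ; zero; suc; _≤_; _<_; z≤n; s≤s; _∸_; _!; NonZero; _⊔_; ∣_-_∣)
import Data.Nat.Properties as ℕₚ
import Data.Nat.DivMod as DivMod
import Data.Nat.Combinatorics as Comb
open import Data.Nat.Combinatorics using (_C_; nCk+nC[k+1]≡[n+1]C[k+1])
open import Data.Nat.Tactic.RingSolver using () renaming (solve-∀ to solveℕ)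
import Data.Integer as ℤ
open import Data.Integer using (ℤ)
import Data.Integer.Properties as ℤₚ
open import Data.Integer.Tactic.RingSolver using () renaming (solve-∀ to solveℤ)
open import Data.Bool using (Bool; true; false; _∧_)
open import Data.Fin as Fin using (Fin; zero; suc; toℕ)
import Data.Fin.Properties as Finₚ
open import Data.List using (List; []; _∷_; _++_; length; filter; foldr; map)
open import Data.List.Properties using (length-++; length-map; filter-none; filter-all)
open import Data.List.Membership.Propositional using (_∈_)
open import Data.List.Membership.Propositional.Properties using (∈-map⁺; ∈-map⁻; ∈-filter⁺; ∈-filter⁻; ∈-++⁻; ∈-++⁺ˡ; ∈-++⁺ʳ; ∈-∃++)
open import Data.List.Membership.Propositional.Properties.WithK using (unique∧set⇒bag)
open import Data.List.Relation.Unary.All as All using (All; []; _∷_)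
import Data.List.Relation.Unary.All.Properties as Allₚ
open import Data.List.Relation.Unary.Any using (here; there)
open import Data.List.Relation.Unary.AllPairs using ([]; _∷_)
open import Data.List.Relation.Unary.Unique.Propositional using (Unique)
import Data.List.Relation.Unary.Unique.Propositional.Properties as Unique
open import Data.List.Relation.Binary.Permutation.Propositional using (_↭_)
import Data.List.Relation.Binary.Permutation.Propositional as Perm
open import Data.List.Relation.Binary.BagAndSetEquality using (∼bag⇒↭)
open import Data.List.Relation.Binary.Sublist.Propositional using (_⊆_; []; _∷_; _∷ʳ_; minimum)
open import Data.List.Relation.Binary.Sublist.Propositional.Properties using (All-resp-⊆)
open import Data.Product using (Σ; _×_; _,_; proj₁; proj₂)
open import Data.Sum using (_⊎_; inj₁; inj₂)
open import Data.Empty using (⊥)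
open import Relation.Nullary using (¬_; Dec; yes; no; ¬?; contradiction)
open import Relation.Nullary.Decidable using (⌊_⌋)
open import Relation.Binary.PropositionalEquality using (_≡_; _≢_; refl; sym; trans; cong; cong₂; subst; module ≡-Reasoning)

-- The constant 1/8 is dictated by the number of terms. With `u = n - t ≥ n/2`, replacing `C(q, u)`
-- by `C(q/8, u)` gains `8^u ≥ 2^(3n/2)`. Since most pairs of a `t`-set and a `u`-set are disjoint,
-- the `t`-th term is then at most about `C(n, t) C(q, n) / 2^(3n/2)`, and summing `C(n, t)` over
-- `t` costs `2^n`. A relative error of order `2^(-n/2)` remains. Two obstacles shape the algebra.
-- The characteristic may be small compared with the orders of vanishing, so derivatives do not
-- detect multiplicities; every polynomial is therefore carried together with its Taylor expansions
-- at all points of the field, and multiplying by `x - a` becomes multiplying by `(w - a) + z` at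
-- each `w`. Moreover, a `FiniteField` records its size but not its characteristic, so the identity
-- `(w + z)^q = w + z^q` cannot be read off from `p`; it is recovered by counting roots.

iter : ∀ {A : Set} → ℕ → (A → A) → A → A
iter zero    f x = x
iter (suc n) f x = f (iter n f x)

-- Binomial coefficients: identities and comparison inequalities.

module Binomials where

  open Data.Nat using (_+_; _*_; _^_)

  -- Pascal's recursion is the definition because the sums over subsets of a list recurse in the
  -- same way; `choose≡C` translates to the binomials of the statement.
  choose : ℕ → ℕ → ℕ
  choose n       zero    = 1
  choose zero    (suc k) = 0
  choose (suc n) (suc k) = choose n k + choose n (suc k)

  choose≡C : ∀ n k → choose n k ≡ n C k
  choose≡C n       zero    = sym (nC0≡1 n)
    where
    nC0≡1 : ∀ n → n C 0 ≡ 1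
    nC0≡1 n = trans (Comb.nCk≡nC[n∸k] {0} {n} z≤n) (Comb.nCn≡1 n)
  choose≡C zero    (suc k) = refl
  choose≡C (suc n) (suc k) =
    trans (cong₂ _+_ (choose≡C n k) (choose≡C n (suc k))) (nCk+nC[k+1]≡[n+1]C[k+1] n k)

  choose-mono : ∀ k {m n} → m ≤ n → choose m k ≤ choose n k
  choose-mono zero    _         = ℕₚ.≤-refl
  choose-mono (suc k) z≤n       = z≤n
  choose-mono (suc k) (s≤s m≤n) = ℕₚ.+-mono-≤ (choose-mono k m≤n) (choose-mono (suc k) m≤n)

  n<k⇒choose≡0 : ∀ {n k} → n < k → choose n k ≡ 0
  n<k⇒choose≡0 {zero}  (s≤s _)   = refl
  n<k⇒choose≡0 {suc n} (s≤s n<k) = cong₂ _+_ (n<k⇒choose≡0 n<k) (n<k⇒choose≡0 (ℕₚ.m≤n⇒m≤1+n n<k))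

  choose-n-n : ∀ n → choose n n ≡ 1
  choose-n-n zero    = refl
  choose-n-n (suc n) = cong₂ _+_ (choose-n-n n) (n<k⇒choose≡0 (ℕₚ.n<1+n n))

  choose-absorb : ∀ n k → suc k * choose (suc n) (suc k) ≡ suc n * choose n k
  choose-absorb zero    zero    = refl
  choose-absorb zero    (suc k) = ℕₚ.*-zeroʳ (suc (suc k))
  choose-absorb (suc n) zero    = trans (cong (λ x → 1 * (1 + x)) (trans (sym (ℕₚ.*-identityˡ _)) (choose-absorb n 0))) (lem n)
    where
    lem : ∀ n → 1 * (1 + (1 + n) * 1) ≡ suc (suc n) * 1
    lem = solveℕ
  choose-absorb (suc n) (suc k) = begin
    suc (suc k) * (a + choose (suc n) (suc (suc k))) ≡⟨ lem₁ k a _ ⟩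
    a + suc k * a + suc (suc k) * choose (suc n) (suc (suc k))
      ≡⟨ cong₂ (λ x y → a + x + y) (choose-absorb n k) (choose-absorb n (suc k)) ⟩
    a + suc n * choose n k + suc n * choose n (suc k) ≡⟨ lem₂ n (choose n k) (choose n (suc k)) ⟩
    suc (suc n) * a ∎
    where
    open ≡-Reasoning
    a : ℕ
    a = choose (suc n) (suc k)
    lem₁ : ∀ k a b → (2 + k) * (a + b) ≡ a + (1 + k) * a + (2 + k) * b
    lem₁ = solveℕ
    lem₂ : ∀ n x y → (x + y) + (1 + n) * x + (1 + n) * y ≡ (2 + n) * (x + y)
    lem₂ = solveℕ

  choose-step : ∀ n k → suc k * choose n (suc k) + k * choose n k ≡ n * choose n k
  choose-step n k = ℕₚ.+-cancelˡ-≡ (choose n k) _ _ (begin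
    choose n k + (suc k * choose n (suc k) + k * choose n k) ≡⟨ lem k (choose n k) (choose n (suc k)) ⟩
    suc k * (choose n k + choose n (suc k)) ≡⟨ choose-absorb n k ⟩
    choose n k + n * choose n k ∎)
    where
    open ≡-Reasoning
    lem : ∀ k x y → x + ((1 + k) * y + k * x) ≡ (1 + k) * (x + y)
    lem = solveℕ

  choose-step-∸ : ∀ n k → suc k * choose n (suc k) ≡ (n ∸ k) * choose n k
  choose-step-∸ n k with ℕₚ.≤-total k n
  ... | inj₁ k≤n = ℕₚ.+-cancelʳ-≡ (k * choose n k) _ _ (trans (choose-step n k)
          (trans (cong (_* choose n k) (sym (ℕₚ.m∸n+n≡m k≤n))) (ℕₚ.*-distribʳ-+ (choose n k) (n ∸ k) k)))
  ... | inj₂ n≤k = trans (cong (suc k *_) (n<k⇒choose≡0 (s≤s n≤k)))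
          (trans (ℕₚ.*-zeroʳ (suc k)) (sym (cong (_* choose n k) (ℕₚ.m≤n⇒m∸n≡0 n≤k))))

  choose-! : ∀ k l → choose (k + l) k * (k ! * l !) ≡ (k + l) !
  choose-! zero    l    = trans (ℕₚ.*-identityˡ _) (ℕₚ.*-identityˡ _)
  choose-! (suc k) zero = begin
    choose (suc k + 0) (suc k) * (suc k ! * 1) ≡⟨ cong (λ x → choose x (suc k) * (suc k ! * 1)) (ℕₚ.+-identityʳ (suc k)) ⟩
    choose (suc k) (suc k) * (suc k ! * 1) ≡⟨ cong₂ _*_ (choose-n-n (suc k)) (ℕₚ.*-identityʳ _) ⟩
    1 * suc k ! ≡⟨ ℕₚ.*-identityˡ _ ⟩
    suc k ! ≡⟨ cong _! (sym (ℕₚ.+-identityʳ (suc k))) ⟩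
    (suc k + 0) ! ∎
    where open ≡-Reasoning
  choose-! (suc k) (suc l) = begin
    (choose (k + suc l) k + choose (k + suc l) (suc k)) * (suc k * k ! * (suc l * l !))
      ≡⟨ lem₁ (choose (k + suc l) k) (choose (k + suc l) (suc k)) k (k !) l (l !) ⟩
    suc k * (choose (k + suc l) k * (k ! * suc l !)) + suc l * (choose (k + suc l) (suc k) * (suc k ! * l !))
      ≡⟨ cong₂ (λ x y → suc k * x + suc l * y) (choose-! k (suc l)) step ⟩
    suc k * (k + suc l) ! + suc l * (k + suc l) !
      ≡⟨ lem₂ k l _ ⟩
    (suc k + suc l) * (k + suc l) ! ∎
    where
    open ≡-Reasoning
    step : choose (k + suc l) (suc k) * (suc k ! * l !) ≡ (k + suc l) !
    step = subst (λ x → choose x (suc k) * (suc k ! * l !) ≡ x !) (sym (ℕₚ.+-suc k l)) (choose-! (suc k) l)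
    lem₁ : ∀ a b k x l y → (a + b) * ((1 + k) * x * ((1 + l) * y)) ≡
                           (1 + k) * (a * (x * ((1 + l) * y))) + (1 + l) * (b * ((1 + k) * x * y))
    lem₁ = solveℕ
    lem₂ : ∀ k l x → (1 + k) * x + (1 + l) * x ≡ (1 + k + (1 + l)) * x
    lem₂ = solveℕ

  choose-trinomial : ∀ t u s → choose (t + (u + s)) t * choose (u + s) u ≡ choose (t + u) t * choose (t + (u + s)) (t + u)
  choose-trinomial t u s = ℕₚ.*-cancelʳ-≡ _ _ (t ! * (u ! * s !)) (trans lhs (sym rhs))
    where
    open ≡-Reasoning
    instance
      _ = t ℕₚ.!≢0
      _ = u ℕₚ.!≢0
      _ = s ℕₚ.!≢0
      _ = ℕₚ.m*n≢0 (u !) (s !)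
      _ = ℕₚ.m*n≢0 (t !) (u ! * s !)
    swap₁ : ∀ a b x y → a * b * (x * y) ≡ a * (x * (b * y))
    swap₁ = solveℕ
    swap₂ : ∀ a b x y z → a * b * (x * (y * z)) ≡ b * (a * (x * y) * z)
    swap₂ = solveℕ
    lhs : choose (t + (u + s)) t * choose (u + s) u * (t ! * (u ! * s !)) ≡ (t + (u + s)) !
    lhs = begin
      _ ≡⟨ swap₁ (choose (t + (u + s)) t) (choose (u + s) u) (t !) (u ! * s !) ⟩
      choose (t + (u + s)) t * (t ! * (choose (u + s) u * (u ! * s !)))
        ≡⟨ cong (λ x → choose (t + (u + s)) t * (t ! * x)) (choose-! u s) ⟩
      choose (t + (u + s)) t * (t ! * (u + s) !) ≡⟨ choose-! t (u + s) ⟩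
      (t + (u + s)) ! ∎
    rhs : choose (t + u) t * choose (t + (u + s)) (t + u) * (t ! * (u ! * s !)) ≡ (t + (u + s)) !
    rhs = begin
      _ ≡⟨ swap₂ (choose (t + u) t) (choose (t + (u + s)) (t + u)) (t !) (u !) (s !) ⟩
      choose (t + (u + s)) (t + u) * (choose (t + u) t * (t ! * u !) * s !)
        ≡⟨ cong (λ x → choose (t + (u + s)) (t + u) * (x * s !)) (choose-! t u) ⟩
      choose (t + (u + s)) (t + u) * ((t + u) ! * s !)
        ≡⟨ subst (λ x → choose x (t + u) * ((t + u) ! * s !) ≡ x !) (ℕₚ.+-assoc t u s) (choose-! (t + u) s) ⟩
      (t + (u + s)) ! ∎

  -- By Pascal's rule, each of the `t` points added to a set of size `r` contributes the subsets
  -- that contain it. The set present before the addition has at most `p` points, so these number at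
  -- most `choose p u`.
  choose-+-≤ : ∀ t r p u → t + r ≤ suc p → choose (t + r) (suc u) ≤ choose r (suc u) + t * choose p u
  choose-+-≤ zero    r p u _         = ℕₚ.≤-reflexive (sym (ℕₚ.+-identityʳ _))
  choose-+-≤ (suc t) r p u (s≤s t+r≤p) = begin
    choose (t + r) u + choose (t + r) (suc u)
      ≤⟨ ℕₚ.+-mono-≤ (choose-mono u t+r≤p) (choose-+-≤ t r p u (ℕₚ.m≤n⇒m≤1+n t+r≤p)) ⟩
    choose p u + (choose r (suc u) + t * choose p u)
      ≡⟨ lem (choose p u) (choose r (suc u)) t ⟩
    choose r (suc u) + suc t * choose p u ∎
    where
    open ℕₚ.≤-Reasoning
    lem : ∀ x y t → x + (y + t * x) ≡ y + (1 + t) * x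
    lem = solveℕ

  -- Union bound: a random `u`-subset of `t + r` points meets `t` given ones with probability at
  -- most `t u / (t + r)`, which is at most 1/2. The subsets that avoid them are those of the other
  -- `r` points.
  choose-≤-double : ∀ t r u → 2 * (t * u) ≤ t + r → choose (t + r) u ≤ 2 * choose r u
  choose-≤-double t r zero    _ = s≤s z≤n
  choose-≤-double t r (suc u) small with t + r in eq
  ... | zero  = z≤n
  -- Multiplying by `suc p = t + r` lets absorption replace `(t + r) C(p, u)` by `(u + 1) x` without
  -- division; one copy of `suc p * x` is added so that it can be cancelled at the end.
  ... | suc p = ℕₚ.*-cancelˡ-≤ (suc p) (ℕₚ.+-cancelʳ-≤ (suc p * x) _ _ (begin
    suc p * x + suc p * x ≡⟨ lem₀ (suc p) x ⟩
    2 * (suc p * x) ≤⟨ ℕₚ.*-monoʳ-≤ 2 (ℕₚ.*-monoʳ-≤ (suc p) bound) ⟩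
    2 * (suc p * (choose r (suc u) + t * choose p u)) ≡⟨ lem₁ (suc p) (choose r (suc u)) t (choose p u) ⟩
    suc p * (2 * choose r (suc u)) + 2 * t * (suc p * choose p u)
      ≡⟨ cong (λ z → suc p * (2 * choose r (suc u)) + 2 * t * z) (sym (choose-absorb p u)) ⟩
    suc p * (2 * choose r (suc u)) + 2 * t * (suc u * x)
      ≡⟨ lem₂ (suc p * (2 * choose r (suc u))) t u x ⟩
    suc p * (2 * choose r (suc u)) + 2 * (t * suc u) * x
      ≤⟨ ℕₚ.+-monoʳ-≤ (suc p * (2 * choose r (suc u))) (ℕₚ.*-monoˡ-≤ x small) ⟩
    suc p * (2 * choose r (suc u)) + suc p * x ∎))
    where
    open ℕₚ.≤-Reasoning
    x : ℕ
    x = choose (suc p) (suc u)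
    bound : x ≤ choose r (suc u) + t * choose p u
    bound = subst (λ z → choose z (suc u) ≤ choose r (suc u) + t * choose p u) eq
              (choose-+-≤ t r p u (ℕₚ.≤-reflexive eq))
    lem₀ : ∀ p x → p * x + p * x ≡ 2 * (p * x)
    lem₀ = solveℕ
    lem₁ : ∀ p a t b → 2 * (p * (a + t * b)) ≡ p * (2 * a) + 2 * t * (p * b)
    lem₁ = solveℕ
    lem₂ : ∀ a t u x → a + 2 * t * ((1 + u) * x) ≡ a + 2 * (t * (1 + u)) * x
    lem₂ = solveℕ

  -- At least half of all pairs of a `t`-subset and a `u`-subset are disjoint, and a disjoint pair
  -- is the same as a `(t + u)`-subset with a chosen `t`-subset of it.
  choose-product-≤ : ∀ q t u → t + u ≤ q → 2 * (t * u) ≤ q →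
                     choose q t * choose q u ≤ 2 * (choose (t + u) t * choose q (t + u))
  choose-product-≤ q t u t+u≤q small = subst P eq goal
    where
    open ℕₚ.≤-Reasoning
    s : ℕ
    s = q ∸ (t + u)
    eq : t + (u + s) ≡ q
    eq = trans (sym (ℕₚ.+-assoc t u s)) (ℕₚ.m+[n∸m]≡n t+u≤q)
    P : ℕ → Set
    P q = choose q t * choose q u ≤ 2 * (choose (t + u) t * choose q (t + u))
    lem : ∀ x y → x * (2 * y) ≡ 2 * (x * y)
    lem = solveℕ
    goal : P (t + (u + s))
    goal = begin
      choose (t + (u + s)) t * choose (t + (u + s)) u
        ≤⟨ ℕₚ.*-monoʳ-≤ (choose (t + (u + s)) t)
             (choose-≤-double t (u + s) u (subst (2 * (t * u) ≤_) (sym eq) small)) ⟩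
      choose (t + (u + s)) t * (2 * choose (u + s) u) ≡⟨ lem (choose (t + (u + s)) t) _ ⟩
      2 * (choose (t + (u + s)) t * choose (u + s) u) ≡⟨ cong (2 *_) (choose-trinomial t u s) ⟩
      2 * (choose (t + u) t * choose (t + (u + s)) (t + u)) ∎

  -- Choosing `u` of `D` blocks of size `r + 1`, and one point in each, yields distinct `u`-subsets
  -- of the union. The proof compares the ratios of consecutive binomials.
  choose-dilate : ∀ r D u → suc r ^ u * choose D u ≤ choose (suc r * D) u
  choose-dilate r D zero    = ℕₚ.≤-refl
  choose-dilate r D (suc u) = ℕₚ.*-cancelˡ-≤ (suc u) (begin
    suc u * (suc r * suc r ^ u * choose D (suc u)) ≡⟨ lem₁ (suc u) (suc r) (suc r ^ u) _ ⟩
    suc r * suc r ^ u * (suc u * choose D (suc u)) ≡⟨ cong (suc r * suc r ^ u *_) (choose-step-∸ D u) ⟩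
    suc r * suc r ^ u * ((D ∸ u) * choose D u) ≡⟨ lem₂ (suc r) (suc r ^ u) (D ∸ u) _ ⟩
    suc r * (D ∸ u) * (suc r ^ u * choose D u) ≤⟨ ℕₚ.*-mono-≤ le (choose-dilate r D u) ⟩
    (suc r * D ∸ u) * choose (suc r * D) u ≡⟨ sym (choose-step-∸ (suc r * D) u) ⟩
    suc u * choose (suc r * D) (suc u) ∎)
    where
    open ℕₚ.≤-Reasoning
    lem₁ : ∀ a b c d → a * (b * c * d) ≡ b * c * (a * d)
    lem₁ = solveℕ
    lem₂ : ∀ a b c d → a * b * (c * d) ≡ a * c * (b * d)
    lem₂ = solveℕ
    le : suc r * (D ∸ u) ≤ suc r * D ∸ u
    le = subst (_≤ suc r * D ∸ u) (sym (ℕₚ.*-distribˡ-∸ (suc r) D u))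
           (ℕₚ.∸-monoʳ-≤ (suc r * D) (ℕₚ.m≤n*m u (suc r)))

  -- Going from `k` to `k + 1` multiplies the left side by `(M - k)/(k + 1)` and the right side by
  -- `(D - 2k)(D - 2k - 1)/((2k + 1)(2k + 2))`. The hypothesis compares these two ratios, with
  -- `M - k` enlarged to `M`.
  choose-halve : ∀ M D k → (∀ i → suc (2 * i) < 2 * k → M * (2 * suc (2 * i)) ≤ (D ∸ 2 * i) * (D ∸ suc (2 * i))) →
                 choose M k ≤ choose D (2 * k)
  choose-halve M D zero    _    = ℕₚ.≤-refl
  choose-halve M D (suc k) cond = subst (λ z → choose M (suc k) ≤ choose D z) (sym 2k+2)
    (ℕₚ.*-cancelˡ-≤ (suc (suc (2 * k)) * suc (2 * k)) (begin
    suc (suc (2 * k)) * suc (2 * k) * choose M (suc k) ≡⟨ lem₁ k _ ⟩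
    2 * suc (2 * k) * (suc k * choose M (suc k)) ≡⟨ cong (2 * suc (2 * k) *_) (choose-step-∸ M k) ⟩
    2 * suc (2 * k) * ((M ∸ k) * choose M k) ≤⟨ ℕₚ.*-monoʳ-≤ (2 * suc (2 * k)) (ℕₚ.*-monoˡ-≤ (choose M k) (ℕₚ.m∸n≤m M k)) ⟩
    2 * suc (2 * k) * (M * choose M k) ≡⟨ lem₂ (2 * suc (2 * k)) M _ ⟩
    M * (2 * suc (2 * k)) * choose M k ≤⟨ ℕₚ.*-mono-≤ (cond k small) (choose-halve M D k (λ i lt → cond i (ℕₚ.<-≤-trans lt (ℕₚ.*-monoʳ-≤ 2 (ℕₚ.n≤1+n k))))) ⟩
    (D ∸ 2 * k) * (D ∸ suc (2 * k)) * choose D (2 * k) ≡⟨ lem₃ (D ∸ 2 * k) (D ∸ suc (2 * k)) _ ⟩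
    (D ∸ suc (2 * k)) * ((D ∸ 2 * k) * choose D (2 * k)) ≡⟨ cong ((D ∸ suc (2 * k)) *_) (sym (choose-step-∸ D (2 * k))) ⟩
    (D ∸ suc (2 * k)) * (suc (2 * k) * choose D (suc (2 * k))) ≡⟨ lem₄ (D ∸ suc (2 * k)) (suc (2 * k)) _ ⟩
    suc (2 * k) * ((D ∸ suc (2 * k)) * choose D (suc (2 * k))) ≡⟨ cong (suc (2 * k) *_) (sym (choose-step-∸ D (suc (2 * k)))) ⟩
    suc (2 * k) * (suc (suc (2 * k)) * choose D (suc (suc (2 * k)))) ≡⟨ lem₅ (suc (2 * k)) (suc (suc (2 * k))) _ ⟩
    suc (suc (2 * k)) * suc (2 * k) * choose D (suc (suc (2 * k))) ∎))
    where
    open ℕₚ.≤-Reasoning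
    2k+2 : 2 * suc k ≡ suc (suc (2 * k))
    2k+2 = ℕₚ.*-suc 2 k
    small : suc (2 * k) < 2 * suc k
    small = ℕₚ.≤-reflexive (sym 2k+2)
    lem₁ : ∀ k x → (2 + 2 * k) * (1 + 2 * k) * x ≡ 2 * (1 + 2 * k) * ((1 + k) * x)
    lem₁ = solveℕ
    lem₂ : ∀ a m x → a * (m * x) ≡ m * a * x
    lem₂ = solveℕ
    lem₃ : ∀ a b x → a * b * x ≡ b * (a * x)
    lem₃ = solveℕ
    lem₄ : ∀ a b x → a * (b * x) ≡ b * (a * x)
    lem₄ = solveℕ
    lem₅ : ∀ a b x → a * (b * x) ≡ b * a * x
    lem₅ = solveℕ

-- Power series, polynomials given by their expansions at all points, and roots with multiplicity.

-- A sequence a stands for the power series Σ a k zᵏ over F.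
module Series {q : ℕ} (F : FiniteField q) where

  open FiniteField F
  open Binomials

  R : CommutativeRing 0ℓ 0ℓ
  R = record { isCommutativeRing = isCommutativeRing }

  open CommutativeRing R public using
    ( +-assoc; +-comm; +-identityˡ; +-identityʳ; -‿inverseˡ; -‿inverseʳ
    ; *-assoc; *-comm; *-identityˡ; *-identityʳ; zeroˡ; zeroʳ; distribˡ; distribʳ )
  open Algebra.Properties.AbelianGroup (CommutativeRing.+-abelianGroup R) public using (⁻¹-anti-homo‿-)
  open Algebra.Properties.Ring (CommutativeRing.ring R) public using
    ( -‿distribˡ-*; -‿distribʳ-*; -‿involutive; -0#≈0#; -1*x≈-x; x∙y⁻¹≈ε⇒x≈y )
  module S = Algebra.Solver.Ring.NaturalCoefficients.Default (CommutativeRing.commutativeSemiring R)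
  open S using (_:+_; _:*_; _:=_)

  *-≢0 : ∀ {x y} → x ≢ 0# → y ≢ 0# → x * y ≢ 0#
  *-≢0 {x} {y} x≢0 y≢0 xy≡0 = y≢0 (begin
    y ≡⟨ sym (*-identityˡ y) ⟩
    1# * y ≡⟨ cong (_* y) (sym (proj₂ (inverse x x≢0))) ⟩
    x * x⁻¹ * y ≡⟨ S.solve 3 (λ x z y → x :* z :* y := z :* (x :* y)) refl x x⁻¹ y ⟩
    x⁻¹ * (x * y) ≡⟨ cong (x⁻¹ *_) xy≡0 ⟩
    x⁻¹ * 0# ≡⟨ zeroʳ x⁻¹ ⟩
    0# ∎)
    where
    open ≡-Reasoning
    x⁻¹ = proj₁ (inverse x x≢0)

  *-cancel-0 : ∀ {x y} → x ≢ 0# → x * y ≡ 0# → y ≡ 0#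
  *-cancel-0 {x} {y} x≢0 xy≡0 with y ≟ 0#
  ... | yes y≡0 = y≡0
  ... | no  y≢0 = contradiction xy≡0 (*-≢0 x≢0 y≢0)

  x-y≡0⇒x≡y : ∀ {x y} → x - y ≡ 0# → x ≡ y
  x-y≡0⇒x≡y {x} {y} = x∙y⁻¹≈ε⇒x≈y x y

  x-y+y≡x : ∀ x y → x - y + y ≡ x
  x-y+y≡x x y = trans (+-assoc x (- y) y) (trans (cong (x +_) (-‿inverseˡ y)) (+-identityʳ x))

  x+y-y≡x : ∀ x y → x + y - y ≡ x
  x+y-y≡x x y = trans (+-assoc x y (- y)) (trans (cong (x +_) (-‿inverseʳ y)) (+-identityʳ x))

  infixr 8 _^_
  _^_ : Carrier → ℕ → Carrier
  x ^ zero  = 1#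
  x ^ suc n = x * x ^ n

  ^-+ : ∀ x m n → x ^ (m ℕ.+ n) ≡ x ^ m * x ^ n
  ^-+ x zero    n = sym (*-identityˡ _)
  ^-+ x (suc m) n = trans (cong (x *_) (^-+ x m n)) (sym (*-assoc x _ _))

  ^-* : ∀ x y n → (x * y) ^ n ≡ x ^ n * y ^ n
  ^-* x y zero    = sym (*-identityˡ 1#)
  ^-* x y (suc n) = trans (cong (x * y *_) (^-* x y n))
    (S.solve 4 (λ x y a b → x :* y :* (a :* b) := x :* a :* (y :* b)) refl x y (x ^ n) (y ^ n))

  1^ : ∀ n → 1# ^ n ≡ 1#
  1^ zero    = refl
  1^ (suc n) = trans (*-identityˡ _) (1^ n)

  0^ : ∀ {n} → 1 ≤ n → 0# ^ n ≡ 0#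
  0^ (s≤s _) = zeroˡ _

  ^-≢0 : ∀ {x} n → x ≢ 0# → x ^ n ≢ 0#
  ^-≢0 zero    x≢0 = 0≢1 ∘ sym
  ^-≢0 (suc n) x≢0 = *-≢0 x≢0 (^-≢0 n x≢0)

  ⟦_⟧ : ℕ → Carrier
  ⟦ zero  ⟧ = 0#
  ⟦ suc n ⟧ = 1# + ⟦ n ⟧

  ⟦⟧-+ : ∀ m n → ⟦ m ℕ.+ n ⟧ ≡ ⟦ m ⟧ + ⟦ n ⟧
  ⟦⟧-+ zero    n = sym (+-identityˡ _)
  ⟦⟧-+ (suc m) n = trans (cong (1# +_) (⟦⟧-+ m n)) (sym (+-assoc 1# _ _))

  ⟦1⟧ : ⟦ 1 ⟧ ≡ 1#
  ⟦1⟧ = +-identityʳ 1#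

  Seq : Set
  Seq = ℕ → Carrier

  infix 4 _≋_
  _≋_ : Seq → Seq → Set
  a ≋ b = ∀ k → a k ≡ b k

  const : Carrier → Seq
  const c zero    = c
  const c (suc k) = 0#

  0ₛ : Seq
  0ₛ k = 0#

  infixl 6 _⊞_
  _⊞_ : Seq → Seq → Seq
  (a ⊞ b) k = a k + b k

  infixl 7 _·_
  _·_ : Carrier → Seq → Seq
  (c · a) k = c * a k

  -- Op v a = (v + z) a.
  Op : Carrier → Seq → Seq
  Op v a zero    = v * a zero
  Op v a (suc k) = v * a (suc k) + a k

  Op-cong : ∀ {u v a b} → u ≡ v → a ≋ b → Op u a ≋ Op v b
  Op-cong refl eq zero    = cong (_ *_) (eq 0)
  Op-cong refl eq (suc k) = cong₂ (λ x y → _ * x + y) (eq (suc k)) (eq k)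

  Op-⊞ : ∀ v a b → Op v (a ⊞ b) ≋ Op v a ⊞ Op v b
  Op-⊞ v a b zero    = distribˡ v _ _
  Op-⊞ v a b (suc k) = S.solve 5 (λ v a b c d → v :* (a :+ b) :+ (c :+ d) := v :* a :+ c :+ (v :* b :+ d))
                         refl v (a (suc k)) (b (suc k)) (a k) (b k)

  Op-· : ∀ v c a → Op v (c · a) ≋ c · Op v a
  Op-· v c a zero    = S.solve 3 (λ v c x → v :* (c :* x) := c :* (v :* x)) refl v c (a 0)
  Op-· v c a (suc k) = S.solve 4 (λ v c x y → v :* (c :* x) :+ c :* y := c :* (v :* x :+ y)) refl v c (a (suc k)) (a k)

  Op-0 : ∀ v {a} → a ≋ 0ₛ → Op v a ≋ 0ₛ
  Op-0 v eq zero    = trans (cong (v *_) (eq 0)) (zeroʳ v)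
  Op-0 v eq (suc k) = trans (cong₂ (λ x y → v * x + y) (eq (suc k)) (eq k)) (trans (+-identityʳ _) (zeroʳ v))

  Op-comm : ∀ u v a → Op u (Op v a) ≋ Op v (Op u a)
  Op-comm u v a zero          = S.solve 3 (λ u v x → u :* (v :* x) := v :* (u :* x)) refl u v (a 0)
  Op-comm u v a (suc zero)    = S.solve 4 (λ u v x y → u :* (v :* x :+ y) :+ v :* y := v :* (u :* x :+ y) :+ u :* y)
                                  refl u v (a 1) (a 0)
  Op-comm u v a (suc (suc k)) = S.solve 5 (λ u v x y z → u :* (v :* x :+ y) :+ (v :* y :+ z) := v :* (u :* x :+ y) :+ (u :* y :+ z))
                                  refl u v (a (suc (suc k))) (a (suc k)) (a k)

  Op-+ : ∀ u v a → Op (u + v) a ≋ Op u a ⊞ v · a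
  Op-+ u v a zero    = distribʳ (a 0) u v
  Op-+ u v a (suc k) = S.solve 4 (λ u v x y → (u :+ v) :* x :+ y := u :* x :+ y :+ v :* x) refl u v (a (suc k)) (a k)

  Op-shift : ∀ {v} → v ≡ 0# → ∀ a k → Op v a (suc k) ≡ a k
  Op-shift refl a k = trans (cong (_+ a k) (zeroˡ _)) (+-identityˡ _)

  -- For `v ≠ 0` the series `v + z` is a unit, so multiplying by it does not change the order of
  -- vanishing.
  Op-cancel : ∀ {v a m} → v ≢ 0# → (∀ k → k < m → Op v a k ≡ 0#) → ∀ k → k < m → a k ≡ 0#
  Op-cancel v≢0 h zero    k<m = *-cancel-0 v≢0 (h 0 k<m)
  Op-cancel {v} {a} v≢0 h (suc k) k<m = *-cancel-0 v≢0 (begin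
    v * a (suc k) ≡⟨ sym (+-identityʳ _) ⟩
    v * a (suc k) + 0# ≡⟨ cong (v * a (suc k) +_) (sym (Op-cancel v≢0 h k (ℕₚ.<-trans (ℕₚ.n<1+n k) k<m))) ⟩
    v * a (suc k) + a k ≡⟨ h (suc k) k<m ⟩
    0# ∎)
    where open ≡-Reasoning

  iter-Op-0 : ∀ n v {a} → a ≋ 0ₛ → iter n (Op v) a ≋ 0ₛ
  iter-Op-0 zero    v eq = eq
  iter-Op-0 (suc n) v eq = Op-0 v (iter-Op-0 n v eq)

  iter-Op-cancel : ∀ n {v a m} → v ≢ 0# → (∀ k → k < m → iter n (Op v) a k ≡ 0#) → ∀ k → k < m → a k ≡ 0#
  iter-Op-cancel zero    v≢0 h = h
  iter-Op-cancel (suc n) v≢0 h = iter-Op-cancel n v≢0 (Op-cancel v≢0 h)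

  iter-Op-shift-< : ∀ n {v} → v ≡ 0# → ∀ a k → k < n → iter n (Op v) a k ≡ 0#
  iter-Op-shift-< (suc n) refl a zero    _         = zeroˡ _
  iter-Op-shift-< (suc n) refl a (suc k) (s≤s k<n) = trans (Op-shift refl (iter n (Op _) a) k) (iter-Op-shift-< n refl a k k<n)

  iter-Op-shift-+ : ∀ n {v} → v ≡ 0# → ∀ a k → iter n (Op v) a (n ℕ.+ k) ≡ a k
  iter-Op-shift-+ zero    refl a k = refl
  iter-Op-shift-+ (suc n) refl a k = trans (Op-shift refl (iter n (Op _) a) (n ℕ.+ k)) (iter-Op-shift-+ n refl a k)

  conv : Seq → Seq → Seq
  conv s a zero    = s 0 * a 0
  conv s a (suc k) = s 0 * a (suc k) + conv (s ∘ suc) a k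

  conv-congˡ : ∀ {s t} a k → (∀ i → i ≤ k → s i ≡ t i) → conv s a k ≡ conv t a k
  conv-congˡ a zero    eq = cong (_* a 0) (eq 0 z≤n)
  conv-congˡ a (suc k) eq = cong₂ (λ x y → x * a (suc k) + y) (eq 0 z≤n) (conv-congˡ a k (λ i i≤k → eq (suc i) (s≤s i≤k)))

  conv-congʳ : ∀ s {a b} k → (∀ i → i ≤ k → a i ≡ b i) → conv s a k ≡ conv s b k
  conv-congʳ s zero    eq = cong (s 0 *_) (eq 0 z≤n)
  conv-congʳ s (suc k) eq = cong₂ (λ x y → s 0 * x + y) (eq (suc k) ℕₚ.≤-refl) (conv-congʳ (s ∘ suc) k (λ i i≤k → eq i (ℕₚ.m≤n⇒m≤1+n i≤k)))

  conv-⊞ˡ : ∀ s t a → conv (s ⊞ t) a ≋ conv s a ⊞ conv t a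
  conv-⊞ˡ s t a zero    = distribʳ (a 0) (s 0) (t 0)
  conv-⊞ˡ s t a (suc k) = trans (cong ((s 0 + t 0) * a (suc k) +_) (conv-⊞ˡ (s ∘ suc) (t ∘ suc) a k))
    (S.solve 5 (λ s t x y z → (s :+ t) :* x :+ (y :+ z) := s :* x :+ y :+ (t :* x :+ z)) refl
      (s 0) (t 0) (a (suc k)) (conv (s ∘ suc) a k) (conv (t ∘ suc) a k))

  conv-·ˡ : ∀ c s a → conv (c · s) a ≋ c · conv s a
  conv-·ˡ c s a zero    = *-assoc c _ _
  conv-·ˡ c s a (suc k) = trans (cong (c * s 0 * a (suc k) +_) (conv-·ˡ c (s ∘ suc) a k))
    (S.solve 4 (λ c s x y → c :* s :* x :+ c :* y := c :* (s :* x :+ y)) refl c (s 0) (a (suc k)) (conv (s ∘ suc) a k))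

  conv-·ʳ : ∀ c s a → conv s (c · a) ≋ c · conv s a
  conv-·ʳ c s a zero    = S.solve 3 (λ c s x → s :* (c :* x) := c :* (s :* x)) refl c (s 0) (a 0)
  conv-·ʳ c s a (suc k) = trans (cong (s 0 * (c * a (suc k)) +_) (conv-·ʳ c (s ∘ suc) a k))
    (S.solve 4 (λ c s x y → s :* (c :* x) :+ c :* y := c :* (s :* x :+ y)) refl c (s 0) (a (suc k)) (conv (s ∘ suc) a k))

  conv-const : ∀ s a k → (∀ i → i < k → s (suc i) ≡ 0#) → conv s a k ≡ s 0 * a k
  conv-const s a zero    h = refl
  conv-const s a (suc k) h = trans (cong (s 0 * a (suc k) +_)
    (trans (conv-const (s ∘ suc) a k (λ i i<k → h (suc i) (s≤s i<k)))
      (trans (cong (_* a k) (h 0 (s≤s z≤n))) (zeroˡ _)))) (+-identityʳ _)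

  Op-conv : ∀ v s a → Op v (conv s a) ≋ conv (Op v s) a
  Op-conv v s a zero    = sym (*-assoc v _ _)
  Op-conv v s a (suc k) = begin
    v * (s 0 * a (suc k) + conv (s ∘ suc) a k) + conv s a k
      ≡⟨ S.solve 5 (λ v s x y z → v :* (s :* x :+ y) :+ z := v :* s :* x :+ (v :* y :+ z)) refl v (s 0) (a (suc k)) _ _ ⟩
    v * s 0 * a (suc k) + (v * conv (s ∘ suc) a k + conv s a k)
      ≡⟨ cong (v * s 0 * a (suc k) +_) (sym (trans (conv-⊞ˡ (v · (s ∘ suc)) s a k) (cong (_+ conv s a k) (conv-·ˡ v (s ∘ suc) a k)))) ⟩
    v * s 0 * a (suc k) + conv (v · (s ∘ suc) ⊞ s) a k ∎
    where open ≡-Reasoning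

  -- The coefficients of `(v + z)^n`. Beyond `i = n` the truncated exponent does no harm, as the
  -- binomial is 0.
  row : ℕ → Carrier → Seq
  row n v i = ⟦ choose n i ⟧ * v ^ (n ∸ i)

  row-step : ∀ n v → Op v (row n v) ≋ row (suc n) v
  row-step n v zero    = S.solve 3 (λ v c x → v :* (c :* x) := c :* (v :* x)) refl v ⟦ 1 ⟧ (v ^ n)
  row-step n v (suc i) with ℕₚ.<-≤-connex i n
  ... | inj₁ i<n = begin
    v * (⟦ choose n (suc i) ⟧ * v ^ (n ∸ suc i)) + ⟦ choose n i ⟧ * v ^ (n ∸ i)
      ≡⟨ cong (λ x → v * (⟦ choose n (suc i) ⟧ * v ^ (n ∸ suc i)) + ⟦ choose n i ⟧ * v ^ x) (ℕₚ.+-∸-assoc 1 i<n) ⟩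
    v * (⟦ choose n (suc i) ⟧ * v ^ (n ∸ suc i)) + ⟦ choose n i ⟧ * (v * v ^ (n ∸ suc i))
      ≡⟨ S.solve 4 (λ v a b x → v :* (a :* x) :+ b :* (v :* x) := (b :+ a) :* (v :* x)) refl v _ _ _ ⟩
    (⟦ choose n i ⟧ + ⟦ choose n (suc i) ⟧) * (v * v ^ (n ∸ suc i))
      ≡⟨ cong₂ _*_ (sym (⟦⟧-+ (choose n i) _)) (cong (v ^_) (sym (ℕₚ.+-∸-assoc 1 i<n))) ⟩
    ⟦ choose (suc n) (suc i) ⟧ * v ^ (n ∸ i) ∎
    where open ≡-Reasoning
  ... | inj₂ n≤i = begin
    v * (⟦ choose n (suc i) ⟧ * v ^ (n ∸ suc i)) + ⟦ choose n i ⟧ * v ^ (n ∸ i)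
      ≡⟨ cong (λ x → v * (⟦ x ⟧ * v ^ (n ∸ suc i)) + ⟦ choose n i ⟧ * v ^ (n ∸ i)) c≡0 ⟩
    v * (0# * v ^ (n ∸ suc i)) + ⟦ choose n i ⟧ * v ^ (n ∸ i)
      ≡⟨ cong (_+ ⟦ choose n i ⟧ * v ^ (n ∸ i)) (trans (cong (v *_) (zeroˡ _)) (zeroʳ v)) ⟩
    0# + ⟦ choose n i ⟧ * v ^ (n ∸ i)
      ≡⟨ +-identityˡ _ ⟩
    ⟦ choose n i ⟧ * v ^ (n ∸ i)
      ≡⟨ cong (λ x → ⟦ x ⟧ * v ^ (n ∸ i)) (sym (trans (cong (choose n i ℕ.+_) c≡0) (ℕₚ.+-identityʳ _))) ⟩
    ⟦ choose (suc n) (suc i) ⟧ * v ^ (n ∸ i) ∎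
    where
    open ≡-Reasoning
    c≡0 : choose n (suc i) ≡ 0
    c≡0 = n<k⇒choose≡0 (s≤s n≤i)

  iter-Op : ∀ n v a → iter n (Op v) a ≋ conv (row n v) a
  iter-Op zero    v a k = sym (trans (conv-const (row 0 v) a k (λ i _ → zeroˡ _))
    (trans (cong (λ x → x * 1# * a k) ⟦1⟧) (S.solve 1 (λ x → S.con 1 :* S.con 1 :* x := x) refl (a k))))
  iter-Op (suc n) v a k = trans (Op-cong refl (iter-Op n v a) k)
    (trans (Op-conv v (row n v) a k) (conv-congˡ a k (λ i _ → row-step n v i)))

  -- Poly H G: some polynomial of degree < H has expansion G w in powers of x - w at every w.
  data Poly : ℕ → (Carrier → Seq) → Set where
    []  : ∀ {G} → (∀ w → G w ≋ 0ₛ) → Poly 0 G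
    cons : ∀ {H G G′} c → Poly H G′ → (∀ w → G w ≋ const c ⊞ Op w (G′ w)) → Poly (suc H) G

  const-+ : ∀ c d → const (c + d) ≋ const c ⊞ const d
  const-+ c d zero    = refl
  const-+ c d (suc k) = sym (+-identityˡ 0#)

  const-0 : const 0# ≋ 0ₛ
  const-0 zero    = refl
  const-0 (suc k) = refl

  Poly-cong : ∀ {H G G′} → (∀ w → G′ w ≋ G w) → Poly H G → Poly H G′
  Poly-cong eq ([] h)       = [] (λ w k → trans (eq w k) (h w k))
  Poly-cong eq (cons c d h) = cons c d (λ w k → trans (eq w k) (h w k))

  Poly-0 : ∀ H → Poly H (λ _ → 0ₛ)
  Poly-0 zero    = [] (λ _ _ → refl)
  Poly-0 (suc H) = cons 0# (Poly-0 H) (λ w k → sym (trans (cong₂ _+_ (const-0 k) (Op-0 w (λ _ → refl) k)) (+-identityˡ 0#)))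

  Poly-⊞ : ∀ {H G G′} → Poly H G → Poly H G′ → Poly H (λ w → G w ⊞ G′ w)
  Poly-⊞ ([] h) ([] h′) = [] (λ w k → trans (cong₂ _+_ (h w k) (h′ w k)) (+-identityˡ 0#))
  Poly-⊞ (cons {G′ = A} c d h) (cons {G′ = B} c′ d′ h′) = cons (c + c′) (Poly-⊞ d d′) (λ w k → trans (cong₂ _+_ (h w k) (h′ w k))
    (trans (S.solve 4 (λ a b c d → (a :+ b) :+ (c :+ d) := (a :+ c) :+ (b :+ d)) refl (const c k) (Op w (A w) k) (const c′ k) (Op w (B w) k))
      (sym (cong₂ _+_ (const-+ c c′ k) (Op-⊞ w (A w) (B w) k)))))

  Poly-· : ∀ {H G} c → Poly H G → Poly H (λ w → c · G w)
  Poly-· c ([] h) = [] (λ w k → trans (cong (c *_) (h w k)) (zeroʳ c))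
  Poly-· c (cons {G′ = A} d p h) = cons (c * d) (Poly-· c p) (λ w k → trans (cong (c *_) (h w k))
    (trans (distribˡ c _ _) (cong₂ _+_ (const-· k) (sym (Op-· w c (A w) k)))))
    where
    const-· : c · const d ≋ const (c * d)
    const-· zero    = refl
    const-· (suc k) = zeroʳ c

  Poly-suc : ∀ {H G} → Poly H G → Poly (suc H) G
  Poly-suc ([] h)       = Poly-cong h (Poly-0 1)
  Poly-suc (cons c d h) = cons c (Poly-suc d) h

  Poly-≤ : ∀ {H H′ G} → H ≤ H′ → Poly H G → Poly H′ G
  Poly-≤ {H′ = zero}   z≤n       ([] h)       = [] h
  Poly-≤ {H′ = suc H′} z≤n       ([] h)       = Poly-suc (Poly-≤ z≤n ([] h))
  Poly-≤               (s≤s H≤H′) (cons c d h) = cons c (Poly-≤ H≤H′ d) h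

  Poly-const : ∀ c → Poly 1 (λ _ → const c)
  Poly-const c = cons c (Poly-0 0) (λ w k → sym (trans (cong (const c k +_) (Op-0 w (λ _ → refl) k)) (+-identityʳ _)))

  Poly-Op₀ : ∀ {H G} → Poly H G → Poly (suc H) (λ w → Op w (G w))
  Poly-Op₀ p = cons 0# p (λ w k → sym (trans (cong₂ _+_ (const-0 k) refl) (+-identityˡ _)))

  Poly-Op : ∀ {H G} a → Poly H G → Poly (suc H) (λ w → Op (w + a) (G w))
  Poly-Op {G = G} a p = Poly-cong (λ w → Op-+ w a (G w)) (Poly-⊞ (Poly-Op₀ p) (Poly-suc (Poly-· a p)))

  Poly-iter : ∀ {H G} n a → Poly H G → Poly (n ℕ.+ H) (λ w → iter n (Op (w + a)) (G w))
  Poly-iter zero    a p = p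
  Poly-iter (suc n) a p = Poly-Op a (Poly-iter n a p)

  -- Division by `x - w`, whose remainder is the value at `w`. A single quotient has to serve the
  -- expansions at all points `u`, and `Op (u - w)` is what multiplication by `x - w` looks like
  -- from `u`.
  Poly-divide : ∀ {H G} → Poly H G → ∀ w → Σ (Carrier → Seq) λ Q → Poly (ℕ.pred H) Q ×
                (∀ u → G u ≋ const (G w 0) ⊞ Op (u - w) (Q u))
  Poly-divide {G = G} ([] h) w = (λ _ → 0ₛ) , Poly-0 0 , λ u k → trans (h u k)
    (sym (trans (cong₂ _+_ (trans (const-cong (h w 0) k) (const-0 k)) (Op-0 (u - w) (λ _ → refl) k)) (+-identityˡ 0#)))
    where
    const-cong : ∀ {c d} → c ≡ d → const c ≋ const d
    const-cong refl k = refl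
  -- Constants are treated apart: their quotient must have degree bound 0, whereas the general
  -- clause returns a `cons`.
  Poly-divide {G = G} (cons {G′ = G′} c ([] h′) h) w = (λ _ → 0ₛ) , Poly-0 0 , eq
    where
    eq : ∀ u → G u ≋ const (G w 0) ⊞ Op (u - w) 0ₛ
    eq u zero    = trans (value u) (trans (sym (value w)) (sym (trans (cong (G w 0 +_) (zeroʳ _)) (+-identityʳ _))))
      where
      value : ∀ u → G u 0 ≡ c
      value u = trans (h u 0) (trans (cong (c +_) (Op-0 u (h′ u) 0)) (+-identityʳ c))
    eq u (suc k) = trans (h u (suc k)) (cong (0# +_) (trans (Op-0 u (h′ u) (suc k)) (sym (Op-0 (u - w) (λ _ → refl) (suc k)))))
  Poly-divide {G = G} (cons {G′ = G′} c d@(cons _ _ _) h) w with Poly-divide d w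
  ... | Q′ , p , eq′ = (λ u → const (G′ w 0) ⊞ Op u (Q′ u)) , cons (G′ w 0) p (λ _ _ → refl) , eq
    where
    open ≡-Reasoning
    g′ : Carrier
    g′ = G′ w 0
    swap : ∀ u → Op u (G′ u) ≋ Op u (const g′) ⊞ Op (u - w) (Op u (Q′ u))
    swap u k = trans (Op-cong refl (eq′ u) k) (trans (Op-⊞ u (const g′) (Op (u - w) (Q′ u)) k)
      (cong (Op u (const g′) k +_) (Op-comm u (u - w) (Q′ u) k)))
    constant : ∀ u → const c ⊞ Op u (const g′) ≋ const (G w 0) ⊞ Op (u - w) (const g′)
    constant u zero = begin
      c + u * g′ ≡⟨ cong (λ x → c + x * g′) (sym (x-y+y≡x u w)) ⟩
      c + (u - w + w) * g′ ≡⟨ S.solve 4 (λ c a w g → c :+ (a :+ w) :* g := c :+ w :* g :+ a :* g) refl c (u - w) w g′ ⟩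
      c + w * g′ + (u - w) * g′ ≡⟨ cong (_+ (u - w) * g′) (sym (h w 0)) ⟩
      G w 0 + (u - w) * g′ ∎
    constant u (suc zero)    = cong (0# +_) (cong (_+ g′) (trans (zeroʳ u) (sym (zeroʳ (u - w)))))
    constant u (suc (suc k)) = cong (0# +_) (cong (_+ 0#) (trans (zeroʳ u) (sym (zeroʳ (u - w)))))
    eq : ∀ u → G u ≋ const (G w 0) ⊞ Op (u - w) (const g′ ⊞ Op u (Q′ u))
    eq u k = begin
      G u k ≡⟨ h u k ⟩
      const c k + Op u (G′ u) k ≡⟨ cong (const c k +_) (swap u k) ⟩
      const c k + (Op u (const g′) k + Op (u - w) (Op u (Q′ u)) k) ≡⟨ sym (+-assoc _ _ _) ⟩
      const c k + Op u (const g′) k + Op (u - w) (Op u (Q′ u)) k ≡⟨ cong₂ _+_ (constant u k) refl ⟩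
      const (G w 0) k + Op (u - w) (const g′) k + Op (u - w) (Op u (Q′ u)) k ≡⟨ +-assoc _ _ _ ⟩
      const (G w 0) k + (Op (u - w) (const g′) k + Op (u - w) (Op u (Q′ u)) k)
        ≡⟨ cong (const (G w 0) k +_) (sym (Op-⊞ (u - w) (const g′) (Op u (Q′ u)) k)) ⟩
      const (G w 0) k + Op (u - w) (const g′ ⊞ Op u (Q′ u)) k ∎

  Poly-peel : ∀ m {H G} → Poly H G → ∀ w → (∀ k → k < m → G w k ≡ 0#) →
              Σ (Carrier → Seq) λ Q → Poly (H ∸ m) Q × (∀ u → G u ≋ iter m (Op (u - w)) (Q u))
  Poly-peel zero    {G = G} p w h = G , p , λ _ _ → refl
  Poly-peel (suc m) {H} {G} p w h with Poly-divide p w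
  ... | Q , pQ , eq with Poly-peel m pQ w vanish
    where
    vanish : ∀ k → k < m → Q w k ≡ 0#
    vanish k k<m = trans (sym (trans (eq w (suc k)) (trans (+-identityˡ _) (Op-shift (-‿inverseʳ w) (Q w) k)))) (h (suc k) (s≤s k<m))
  ... | Q′ , pQ′ , eq′ = Q′ , subst (λ x → Poly x Q′) (pred-∸ H m) pQ′ , λ u k →
        trans (eq u k) (trans (cong (_+ Op (u - w) (Q u) k) (const≡0 k)) (trans (+-identityˡ _) (Op-cong refl (eq′ u) k)))
    where
    pred-∸ : ∀ H m → ℕ.pred H ∸ m ≡ H ∸ suc m
    pred-∸ zero    m = ℕₚ.0∸n≡0 m
    pred-∸ (suc H) m = refl
    const≡0 : const (G w 0) ≋ 0ₛ
    const≡0 zero    = h 0 (s≤s z≤n)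
    const≡0 (suc k) = refl

  -- Once `(x - w)^m` is divided out at one root, the removed factor is a unit at every other root.
  -- The quotient thus keeps vanishing to order `m` there, while its degree bound has dropped by
  -- `m`.
  Poly-vanishing : ∀ m {H G} ws → Unique ws → Poly H G → H ≤ length ws ℕ.* m →
                   (∀ w → w ∈ ws → ∀ k → k < m → G w k ≡ 0#) → ∀ u → G u ≋ 0ₛ
  Poly-vanishing m []       _         ([] h) z≤n _ = h
  Poly-vanishing m {H} {G} (w ∷ ws) (w∉ws ∷ un) p H≤ h with Poly-peel m p w (h w (here refl))
  ... | Q , pQ , eq = λ u k → trans (eq u k) (iter-Op-0 m (u - w) (Q≡0 u) k)
    where
    Q≡0 : ∀ u → Q u ≋ 0ₛ
    Q≡0 = Poly-vanishing m ws un pQ (ℕₚ.m≤n+o⇒m∸n≤o H m H≤) λ u u∈ws →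
      iter-Op-cancel m (λ u-w≡0 → All.lookup w∉ws u∈ws (sym (x-y≡0⇒x≡y u-w≡0)))
        (λ k k<m → trans (sym (eq u k)) (h u (there u∈ws) k k<m))

-- Fermat's little theorem and the Frobenius identity.

module Fermat {q : ℕ} (F : FiniteField q) where

  open FiniteField F
  open Binomials
  open Series F
  open S using (_:+_; _:*_; _:=_)

  nonzero? : ∀ x → Dec (x ≢ 0#)
  nonzero? x = ¬? (x ≟ 0#)

  units : List Carrier
  units = filter nonzero? elements

  units-unique : Unique units
  units-unique = Unique.filter⁺ nonzero? unique

  ∈-units : ∀ {x} → x ≢ 0# → x ∈ units
  ∈-units x≢0 = ∈-filter⁺ nonzero? (complete _) x≢0

  units-≢0 : ∀ {x} → x ∈ units → x ≢ 0#
  units-≢0 = proj₂ ∘ ∈-filter⁻ nonzero? {xs = elements}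

  length-remove-0 : ∀ {xs} → Unique xs → 0# ∈ xs → suc (length (filter nonzero? xs)) ≡ length xs
  length-remove-0 {x ∷ xs} (x∉xs ∷ un) 0∈ with x ≟ 0#
  ... | yes refl = cong (suc ∘ length) (filter-all nonzero? (All.map (λ 0≢y y≡0 → 0≢y (sym y≡0)) x∉xs))
  length-remove-0 {x ∷ xs} (x∉xs ∷ un) (here 0≡x)  | no x≢0 = contradiction (sym 0≡x) x≢0
  length-remove-0 {x ∷ xs} (x∉xs ∷ un) (there 0∈) | no x≢0 = cong suc (length-remove-0 un 0∈)

  length-units : suc (length units) ≡ q
  length-units = trans (length-remove-0 unique (complete 0#)) size

  prod-↭ : ∀ {xs ys} → xs ↭ ys → prod F xs ≡ prod F ys
  prod-↭ Perm.refl                = refl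
  prod-↭ (Perm.prep x p)          = cong (x *_) (prod-↭ p)
  prod-↭ (Perm.swap {xs} x y p)   = trans (S.solve 3 (λ x y z → x :* (y :* z) := y :* (x :* z)) refl x y (prod F xs))
                                          (cong (λ z → y * (x * z)) (prod-↭ p))
  prod-↭ (Perm.trans p p′)        = trans (prod-↭ p) (prod-↭ p′)

  prod-map-* : ∀ x ys → prod F (map (x *_) ys) ≡ x ^ length ys * prod F ys
  prod-map-* x []       = sym (*-identityˡ 1#)
  prod-map-* x (y ∷ ys) = trans (cong (x * y *_) (prod-map-* x ys))
    (S.solve 4 (λ x y a b → x :* y :* (a :* b) := x :* a :* (y :* b)) refl x y (x ^ length ys) (prod F ys))

  prod-≢0 : ∀ {ys} → (∀ {y} → y ∈ ys → y ≢ 0#) → prod F ys ≢ 0#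
  prod-≢0 {[]}     h = 0≢1 ∘ sym
  prod-≢0 {y ∷ ys} h = *-≢0 (h (here refl)) (prod-≢0 (h ∘ there))

  *-cancelˡ : ∀ {x y z} → x ≢ 0# → x * y ≡ x * z → y ≡ z
  *-cancelˡ {x} {y} {z} x≢0 eq = x-y≡0⇒x≡y (*-cancel-0 x≢0 (begin
    x * (y - z) ≡⟨ distribˡ x y (- z) ⟩
    x * y + x * (- z) ≡⟨ cong₂ _+_ eq (sym (-‿distribʳ-* x z)) ⟩
    x * z - x * z ≡⟨ -‿inverseʳ _ ⟩
    0# ∎))
    where open ≡-Reasoning

  scale-units : ∀ {x} → x ≢ 0# → map (x *_) units ↭ units
  scale-units {x} x≢0 = ∼bag⇒↭ (unique∧set⇒bag (Unique.map⁺ (*-cancelˡ x≢0) units-unique) units-unique (mk⇔ to from))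
    where
    x⁻¹ = proj₁ (inverse x x≢0)
    to : ∀ {z} → z ∈ map (x *_) units → z ∈ units
    to z∈ with ∈-map⁻ (x *_) z∈
    ... | y , y∈ , refl = ∈-units (*-≢0 x≢0 (units-≢0 y∈))
    unscale : ∀ z → x * (x⁻¹ * z) ≡ z
    unscale z = trans (sym (*-assoc x x⁻¹ z)) (trans (cong (_* z) (proj₂ (inverse x x≢0))) (*-identityˡ z))
    from : ∀ {z} → z ∈ units → z ∈ map (x *_) units
    from {z} z∈ = subst (_∈ map (x *_) units) (unscale z)
      (∈-map⁺ (x *_) (∈-units λ eq → units-≢0 z∈ (trans (sym (unscale z)) (trans (cong (x *_) eq) (zeroʳ x)))))

  -- Multiplication by `x` permutes the units, so their product is unchanged when it is multiplied
  -- by `x^(q-1)`.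
  fermat : ∀ {x} → x ≢ 0# → x ^ length units ≡ 1#
  fermat {x} x≢0 = *-cancelˡ (prod-≢0 units-≢0) (begin
    prod F units * x ^ length units ≡⟨ *-comm _ _ ⟩
    x ^ length units * prod F units ≡⟨ sym (prod-map-* x units) ⟩
    prod F (map (x *_) units) ≡⟨ prod-↭ (scale-units x≢0) ⟩
    prod F units ≡⟨ sym (*-identityʳ _) ⟩
    prod F units * 1# ∎)
    where open ≡-Reasoning

  x^q≡x : ∀ x → x ^ q ≡ x
  x^q≡x x = trans (cong (x ^_) (sym length-units)) (lemma (x ≟ 0#))
    where
    lemma : Dec (x ≡ 0#) → x ^ suc (length units) ≡ x
    lemma (yes refl) = zeroˡ _
    lemma (no x≢0)   = trans (cong (x *_) (fermat x≢0)) (*-identityʳ x)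

  iter-Op-value : ∀ n v → iter n (Op v) (const 1#) 0 ≡ v ^ n
  iter-Op-value zero    v = refl
  iter-Op-value (suc n) v = cong (v *_) (iter-Op-value n v)

  conv-const-1 : ∀ s k → conv s (const 1#) k ≡ s k
  conv-const-1 s zero    = *-identityʳ _
  conv-const-1 s (suc k) = trans (cong₂ _+_ (zeroʳ _) (conv-const-1 (s ∘ suc) k)) (+-identityˡ _)

  monomial : ℕ → Carrier → Seq
  monomial n u = iter n (Op u) (const 1#)

  Poly-monomial : ∀ n → Poly (suc n) (monomial n)
  Poly-monomial zero    = Poly-const 1#
  Poly-monomial (suc n) = Poly-Op₀ (Poly-monomial n)

  -- The leading terms cancel, by the recursion `(x + 1)^(n+1) - x^(n+1) = (x + 1)((x + 1)^n - x^n)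
  -- + x^n`.
  Poly-difference : ∀ n → Poly n (λ u → monomial n (u + 1#) ⊞ (- 1#) · monomial n u)
  Poly-difference zero = Poly-cong (λ u k → trans (cong (const 1# k +_) (-1*x≈-x _)) (-‿inverseʳ _)) (Poly-0 0)
  Poly-difference (suc n) = Poly-cong eq (Poly-⊞ (Poly-Op 1# (Poly-difference n)) (Poly-monomial n))
    where
    open ≡-Reasoning
    A : Carrier → Seq
    A u = monomial n (u + 1#)
    B : Carrier → Seq
    B u = monomial n u
    eq : ∀ u → Op (u + 1#) (A u) ⊞ (- 1#) · Op u (B u) ≋ Op (u + 1#) (A u ⊞ (- 1#) · B u) ⊞ B u
    eq u k = sym (begin
      Op (u + 1#) (A u ⊞ (- 1#) · B u) k + B u k
        ≡⟨ cong (_+ B u k) (trans (Op-⊞ (u + 1#) (A u) _ k) (cong (Op (u + 1#) (A u) k +_)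
             (trans (Op-· (u + 1#) (- 1#) (B u) k) (cong (- 1# *_) (Op-+ u 1# (B u) k))))) ⟩
      Op (u + 1#) (A u) k + - 1# * (Op u (B u) k + 1# * B u k) + B u k
        ≡⟨ S.solve 4 (λ a m b d → a :+ m :* (b :+ S.con 1 :* d) :+ d := a :+ m :* b :+ (m :* d :+ d)) refl
             (Op (u + 1#) (A u) k) (- 1#) (Op u (B u) k) (B u k) ⟩
      Op (u + 1#) (A u) k + - 1# * Op u (B u) k + (- 1# * B u k + B u k)
        ≡⟨ cong (Op (u + 1#) (A u) k + - 1# * Op u (B u) k +_)
             (trans (cong (_+ B u k) (-1*x≈-x _)) (-‿inverseˡ _)) ⟩
      Op (u + 1#) (A u) k + - 1# * Op u (B u) k + 0#
        ≡⟨ +-identityʳ _ ⟩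
      Op (u + 1#) (A u) k + - 1# * Op u (B u) k ∎)

  1≤q : 1 ≤ q
  1≤q = subst (1 ≤_) length-units (s≤s z≤n)

  -- (x + 1)^q - x^q - 1 has degree below q and vanishes on all of F.
  choose-q≡0 : ∀ k → suc k < q → ⟦ choose q (suc k) ⟧ ≡ 0#
  choose-q≡0 k k<q = begin
    ⟦ choose q (suc k) ⟧
      ≡⟨ sym (trans (cong (⟦ choose q (suc k) ⟧ *_) (trans (cong (_^ (q ∸ suc k)) (+-identityˡ 1#)) (1^ (q ∸ suc k)))) (*-identityʳ _)) ⟩
    -- In the expansion at 0 the coefficient of `z^(k+1)` comes from `(x + 1)^q` alone: `x^q`
    -- contributes a positive power of 0, and the constant 1 contributes nothing.
    row q (0# + 1#) (suc k)
      ≡⟨ sym (coefficient (0# + 1#)) ⟩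
    monomial q (0# + 1#) (suc k)
      ≡⟨ sym (trans (cong₂ _+_ (cong (monomial q (0# + 1#) (suc k) +_) (trans (cong (- 1# *_) low) (zeroʳ _))) refl)
           (trans (+-identityʳ _) (+-identityʳ _))) ⟩
    monomial q (0# + 1#) (suc k) + - 1# * monomial q 0# (suc k) + 0#
      ≡⟨ Poly-vanishing 1 elements unique (Poly-⊞ (Poly-difference q) (Poly-≤ 1≤q (Poly-const (- 1#))))
           (ℕₚ.≤-reflexive (trans (sym size) (sym (ℕₚ.*-identityʳ _)))) (λ { w _ zero _ → root w ; w _ (suc _) (s≤s ()) }) 0# (suc k) ⟩
    0# ∎
    where
    open ≡-Reasoning
    coefficient : ∀ v → monomial q v (suc k) ≡ row q v (suc k)
    coefficient v = trans (iter-Op q v (const 1#) (suc k)) (conv-const-1 (row q v) (suc k))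
    low : monomial q 0# (suc k) ≡ 0#
    low = trans (coefficient 0#) (trans (cong (⟦ choose q (suc k) ⟧ *_) (0^ (ℕₚ.m<n⇒0<n∸m k<q))) (zeroʳ _))
    root : ∀ w → monomial q (w + 1#) 0 + - 1# * monomial q w 0 + - 1# ≡ 0#
    root w = begin
      monomial q (w + 1#) 0 + - 1# * monomial q w 0 + - 1#
        ≡⟨ cong₂ (λ x y → x + - 1# * y + - 1#) (trans (iter-Op-value q (w + 1#)) (x^q≡x _)) (trans (iter-Op-value q w) (x^q≡x w)) ⟩
      w + 1# + - 1# * w + - 1#
        ≡⟨ S.solve 2 (λ w m → w :+ S.con 1 :+ m :* w :+ m := (w :+ m :* w) :+ (S.con 1 :+ m)) refl w (- 1#) ⟩
      (w + - 1# * w) + (1# + - 1#)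
        ≡⟨ cong₂ _+_ (trans (cong (w +_) (-1*x≈-x w)) (-‿inverseʳ w)) (-‿inverseʳ 1#) ⟩
      0# + 0# ≡⟨ +-identityˡ 0# ⟩
      0# ∎

  -- `(w + z)^q = w^q + z^q` and `w^q = w`, so below order `q` the polynomial `x^q` acts as the
  -- scalar `w`. This is the source of the saving in Stepanov's method: in the vanishing conditions
  -- `x^(qj)` has degree `j` in `w` instead of `q j`.
  iter-q-Op : ∀ w a k → k < q → iter q (Op w) a k ≡ w * a k
  iter-q-Op w a k k<q = begin
    iter q (Op w) a k ≡⟨ iter-Op q w a k ⟩
    conv (row q w) a k ≡⟨ conv-const (row q w) a k (λ i i<k → trans (cong (_* w ^ (q ∸ suc i)) (choose-q≡0 i (ℕₚ.≤-<-trans i<k k<q))) (zeroˡ _)) ⟩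
    ⟦ 1 ⟧ * w ^ q * a k ≡⟨ cong (_* a k) (trans (cong₂ _*_ ⟦1⟧ (x^q≡x w)) (*-identityˡ w)) ⟩
    w * a k ∎
    where open ≡-Reasoning

-- Euler's criterion and multiplicativity of the quadratic character.

module QuadraticCharacter {q : ℕ} (F : FiniteField q) (c : ℕ) (1≤c : 1 ≤ c) (q≡1+2c : q ≡ suc (c ℕ.+ c)) where

  open FiniteField F
  open Binomials
  open Series F
  open Fermat F
  open S using (_:+_; _:*_; _:=_)

  length-units≡2c : length units ≡ c ℕ.+ c
  length-units≡2c = ℕₚ.suc-injective (trans length-units q≡1+2c)

  χ : Carrier → Carrier
  χ x = x ^ c

  χ-* : ∀ x y → χ (x * y) ≡ χ x * χ y
  χ-* x y = ^-* x y c

  χ-square : ∀ {x} → x ≢ 0# → χ x * χ x ≡ 1#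
  χ-square {x} x≢0 = trans (sym (^-+ x c c)) (trans (cong (x ^_) (sym length-units≡2c)) (fermat x≢0))

  χ-±1 : ∀ {x} → x ≢ 0# → χ x ≡ 1# ⊎ χ x ≡ - 1#
  χ-±1 {x} x≢0 with χ x - 1# ≟ 0#
  ... | yes eq = inj₁ (x-y≡0⇒x≡y eq)
  ... | no neq = inj₂ (begin
    χ x ≡⟨ sym (x+y-y≡x (χ x) 1#) ⟩
    χ x + 1# - 1# ≡⟨ cong (_- 1#) (*-cancel-0 neq factor) ⟩
    0# - 1# ≡⟨ +-identityˡ _ ⟩
    - 1# ∎)
    where
    open ≡-Reasoning
    factor : (χ x - 1#) * (χ x + 1#) ≡ 0#
    factor = begin
      (χ x + - 1#) * (χ x + 1#)
        ≡⟨ S.solve 2 (λ y m → (y :+ m) :* (y :+ S.con 1) := (y :* y :+ m) :+ (y :+ m :* y)) refl (χ x) (- 1#) ⟩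
      (χ x * χ x + - 1#) + (χ x + - 1# * χ x)
        ≡⟨ cong₂ _+_ (trans (cong (_- 1#) (χ-square x≢0)) (-‿inverseʳ 1#)) (trans (cong (χ x +_) (-1*x≈-x _)) (-‿inverseʳ _)) ⟩
      0# + 0# ≡⟨ +-identityˡ 0# ⟩
      0# ∎

  choose-1 : ∀ n → choose n 1 ≡ n
  choose-1 zero    = refl
  choose-1 (suc n) = cong suc (choose-1 n)

  -- `q = choose q 1` is 0 in the field and equals `1 + 2c`; if 2 were 0 as well, this would give
  -- `1 = 0`.
  1≢-1 : 1# ≢ - 1#
  1≢-1 1≡-1 = 0≢1 (begin
    0# ≡⟨ sym (choose-q≡0 0 1<q) ⟩
    ⟦ choose q 1 ⟧ ≡⟨ cong ⟦_⟧ (trans (choose-1 q) q≡1+2c) ⟩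
    1# + ⟦ c ℕ.+ c ⟧ ≡⟨ cong (1# +_) (⟦⟧-+ c c) ⟩
    1# + (⟦ c ⟧ + ⟦ c ⟧) ≡⟨ cong (1# +_) (S.solve 1 (λ x → x :+ x := (S.con 1 :+ S.con 1) :* x) refl ⟦ c ⟧) ⟩
    1# + (1# + 1#) * ⟦ c ⟧ ≡⟨ cong (λ y → 1# + (1# + y) * ⟦ c ⟧) 1≡-1 ⟩
    1# + (1# - 1#) * ⟦ c ⟧ ≡⟨ cong (λ y → 1# + y * ⟦ c ⟧) (-‿inverseʳ 1#) ⟩
    1# + 0# * ⟦ c ⟧ ≡⟨ cong (1# +_) (zeroˡ _) ⟩
    1# + 0# ≡⟨ +-identityʳ 1# ⟩
    1# ∎)
    where
    open ≡-Reasoning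
    1<q : 1 < q
    1<q = subst (1 <_) (sym q≡1+2c) (s≤s (ℕₚ.≤-trans 1≤c (ℕₚ.m≤m+n c c)))

  -- cofactor x n is the quotient of y²ⁿ - xⁿ by y² - x.
  cofactor : Carrier → ℕ → Carrier → Seq
  cofactor x zero    u = 0ₛ
  cofactor x (suc n) u = const (x ^ n) ⊞ Op u (const 0# ⊞ Op u (cofactor x n u))

  Poly-cofactor : ∀ x n → Poly (n ℕ.+ n) (cofactor x n)
  Poly-cofactor x zero    = Poly-0 0
  Poly-cofactor x (suc n) = subst (λ m → Poly m (cofactor x (suc n))) (cong suc (sym (ℕₚ.+-suc n n)))
    (cons (x ^ n) (cons 0# (Poly-cofactor x n) (λ _ _ → refl)) (λ _ _ → refl))

  cofactor-spec : ∀ x n y → (y * y - x) * cofactor x n y 0 + x ^ n ≡ (y * y) ^ n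
  cofactor-spec x zero    y = trans (cong (_+ 1#) (zeroʳ _)) (+-identityˡ 1#)
  cofactor-spec x (suc n) y = begin
    d * (x ^ n + y * (0# + y * r)) + x * x ^ n
      ≡⟨ S.solve 5 (λ d x z y r → d :* (z :+ y :* (S.con 0 :+ y :* r)) :+ x :* z := y :* y :* (d :* r) :+ (d :+ x) :* z)
           refl d x (x ^ n) y r ⟩
    y * y * (d * r) + (d + x) * x ^ n
      ≡⟨ cong (λ z → y * y * (d * r) + z * x ^ n) (x-y+y≡x (y * y) x) ⟩
    y * y * (d * r) + y * y * x ^ n
      ≡⟨ sym (distribˡ (y * y) _ _) ⟩
    y * y * (d * r + x ^ n)
      ≡⟨ cong (y * y *_) (cofactor-spec x n y) ⟩
    y * y * (y * y) ^ n ∎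
    where
    open ≡-Reasoning
    d = y * y - x
    r = cofactor x n y 0

  -- If `x` is not a square, then `y² - x` is never 0, while `y^(2c) - x^c = 1 - 1` at every unit
  -- `y`. The cofactor then has all `2c` units as roots, and its degree is below `2c`, so it is
  -- zero; but its value at 0 is `x^(c-1)`.
  euler : ∀ {x} → x ≢ 0# → χ x ≡ 1# → ¬ (∀ y → y * y ≢ x)
  euler {x} x≢0 χx≡1 nonsquare = 0^≢ (ℕ.pred c) (trans (value-at-0 1≤c) (Poly-vanishing 1 units units-unique (Poly-cofactor x c)
    (ℕₚ.≤-reflexive (trans (sym length-units≡2c) (sym (ℕₚ.*-identityʳ _)))) (λ { w w∈ zero _ → root w w∈ ; w _ (suc _) (s≤s ()) }) 0# 0))
    where
    open ≡-Reasoning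
    0^≢ : ∀ n → x ^ n ≢ 0#
    0^≢ n = ^-≢0 n x≢0
    value-at-0 : ∀ {n} → 1 ≤ n → x ^ ℕ.pred n ≡ cofactor x n 0# 0
    value-at-0 (s≤s {n = n} _) = sym (trans (cong (x ^ n +_) (zeroˡ _)) (+-identityʳ _))
    root : ∀ y → y ∈ units → cofactor x c y 0 ≡ 0#
    root y y∈ = *-cancel-0 (λ eq → nonsquare y (x-y≡0⇒x≡y eq)) (begin
      (y * y - x) * cofactor x c y 0 ≡⟨ sym (x+y-y≡x _ (x ^ c)) ⟩
      (y * y - x) * cofactor x c y 0 + χ x - χ x ≡⟨ cong (_- χ x) (cofactor-spec x c y) ⟩
      (y * y) ^ c - χ x ≡⟨ cong₂ _-_ (trans (χ-* y y) (χ-square (units-≢0 y∈))) χx≡1 ⟩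
      1# - 1# ≡⟨ -‿inverseʳ 1# ⟩
      0# ∎)

  -- `η` is defined by a search for a square root, which does not interact with products. The view
  -- pairs each value of `η` with the value of the power map `χ`, which is visibly multiplicative.
  data ηView (x : Carrier) : ℤ → Set where
    isZero      : x ≡ 0# → ηView x (ℤ.+ 0)
    isSquare    : x ≢ 0# → χ x ≡ 1# → ηView x (ℤ.+ 1)
    isNonsquare : x ≢ 0# → χ x ≡ - 1# → ηView x ℤ.-[1+ 0 ]

  anyB-true : ∀ {A : Set} (p : A → Bool) xs → anyB p xs ≡ true → Σ A λ x → p x ≡ true
  anyB-true p (x ∷ xs) eq with p x in px
  ... | true  = x , px
  ... | false = anyB-true p xs eq

  anyB-false : ∀ {A : Set} (p : A → Bool) xs → anyB p xs ≡ false → ∀ {x} → x ∈ xs → p x ≡ false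
  anyB-false p (x ∷ xs) eq x∈ with p x in px
  anyB-false p (x ∷ xs) eq (here refl) | false = px
  anyB-false p (x ∷ xs) eq (there x∈)  | false = anyB-false p xs eq x∈

  η-view : ∀ x → ηView x (η F x)
  η-view x with x ≟ 0#
  ... | yes x≡0 = isZero x≡0
  ... | no x≢0 with anyB (λ y → ⌊ y * y ≟ x ⌋) elements in any
  ...   | true with anyB-true (λ y → ⌊ y * y ≟ x ⌋) elements any
  ...     | y , found with y * y ≟ x
  ...       | yes refl = isSquare x≢0 (trans (χ-* y y) (χ-square y≢0))
    where
    y≢0 : y ≢ 0#
    y≢0 refl = x≢0 (zeroˡ _)
  η-view x | no x≢0 | false with χ-±1 x≢0
  ...   | inj₂ χ≡-1 = isNonsquare x≢0 χ≡-1
  ...   | inj₁ χ≡1  = contradiction nonsquare (euler x≢0 χ≡1)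
    where
    nonsquare : ∀ y → y * y ≢ x
    nonsquare y eq with anyB-false (λ y → ⌊ y * y ≟ x ⌋) elements any (complete y)
    ... | none with y * y ≟ x
    ...   | no neq = neq eq

  χ≡1⇒η≡1 : ∀ {x} → x ≢ 0# → χ x ≡ 1# → η F x ≡ ℤ.+ 1
  χ≡1⇒η≡1 {x} x≢0 χ≡1 with η F x | η-view x
  ... | _ | isZero x≡0         = contradiction x≡0 x≢0
  ... | _ | isSquare _ _       = refl
  ... | _ | isNonsquare _ χ≡-1 = contradiction (trans (sym χ≡1) χ≡-1) 1≢-1

  χ≡-1⇒η≡-1 : ∀ {x} → x ≢ 0# → χ x ≡ - 1# → η F x ≡ ℤ.-[1+ 0 ]
  χ≡-1⇒η≡-1 {x} x≢0 χ≡-1 with η F x | η-view x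
  ... | _ | isZero x≡0      = contradiction x≡0 x≢0
  ... | _ | isSquare _ χ≡1  = contradiction (trans (sym χ≡1) χ≡-1) 1≢-1
  ... | _ | isNonsquare _ _ = refl

  η-0 : η F 0# ≡ ℤ.+ 0
  η-0 with η F 0# | η-view 0#
  ... | _ | isZero _          = refl
  ... | _ | isSquare 0≢0 _    = contradiction refl 0≢0
  ... | _ | isNonsquare 0≢0 _ = contradiction refl 0≢0

  -1*-1 : - 1# * - 1# ≡ 1#
  -1*-1 = trans (-1*x≈-x (- 1#)) (-‿involutive 1#)

  η-* : ∀ x y → η F (x * y) ≡ η F x ℤ.* η F y
  η-* x y with η F x | η-view x | η F y | η-view y
  ... | _ | isZero refl           | _ | _                     = trans (cong (η F) (zeroˡ y)) η-0
  ... | _ | isSquare _ _          | _ | isZero refl           = trans (cong (η F) (zeroʳ x)) η-0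
  ... | _ | isNonsquare _ _       | _ | isZero refl           = trans (cong (η F) (zeroʳ x)) η-0
  ... | _ | isSquare x≢0 χx       | _ | isSquare y≢0 χy       = χ≡1⇒η≡1 (*-≢0 x≢0 y≢0) (trans (χ-* x y) (trans (cong₂ _*_ χx χy) (*-identityˡ _)))
  ... | _ | isSquare x≢0 χx       | _ | isNonsquare y≢0 χy    = χ≡-1⇒η≡-1 (*-≢0 x≢0 y≢0) (trans (χ-* x y) (trans (cong₂ _*_ χx χy) (*-identityˡ _)))
  ... | _ | isNonsquare x≢0 χx    | _ | isSquare y≢0 χy       = χ≡-1⇒η≡-1 (*-≢0 x≢0 y≢0) (trans (χ-* x y) (trans (cong₂ _*_ χx χy) (*-identityʳ _)))
  ... | _ | isNonsquare x≢0 χx    | _ | isNonsquare y≢0 χy    = χ≡1⇒η≡1 (*-≢0 x≢0 y≢0) (trans (χ-* x y) (trans (cong₂ _*_ χx χy) -1*-1))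

-- Linear systems with more unknowns than equations.

module LinearAlgebra {q : ℕ} (F : FiniteField q) where

  open FiniteField F
  open Series F
  open S using (_:+_; _:*_; _:=_)

  Vector : ℕ → Set
  Vector n = Fin n → Carrier

  record Linear {n : ℕ} (ℓ : Vector n → Carrier) : Set where
    field
      resp : ∀ {u v} → (∀ i → u i ≡ v i) → ℓ u ≡ ℓ v
      add  : ∀ u v → ℓ (λ i → u i + v i) ≡ ℓ u + ℓ v
      mul  : ∀ x v → ℓ (λ i → x * v i) ≡ x * ℓ v
  open Linear

  Functional : ℕ → Set
  Functional n = Σ (Vector n → Carrier) Linear

  Linear-0 : ∀ {n} → Linear {n} (λ _ → 0#)
  Linear-0 = record { resp = λ _ → refl ; add = λ _ _ → sym (+-identityˡ 0#) ; mul = λ x _ → sym (zeroʳ x) }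

  Linear-proj : ∀ {n} (i : Fin n) → Linear (λ v → v i)
  Linear-proj i = record { resp = λ eq → eq i ; add = λ _ _ → refl ; mul = λ _ _ → refl }

  Linear-+ : ∀ {n} {ℓ ℓ′ : Vector n → Carrier} → Linear ℓ → Linear ℓ′ → Linear (λ v → ℓ v + ℓ′ v)
  Linear-+ {ℓ = ℓ} {ℓ′} p p′ = record
    { resp = λ eq → cong₂ _+_ (resp p eq) (resp p′ eq)
    ; add  = λ u v → trans (cong₂ _+_ (add p u v) (add p′ u v))
        (S.solve 4 (λ a b c d → (a :+ b) :+ (c :+ d) := (a :+ c) :+ (b :+ d)) refl (ℓ u) (ℓ v) (ℓ′ u) (ℓ′ v))
    ; mul  = λ x v → trans (cong₂ _+_ (mul p x v) (mul p′ x v)) (sym (distribˡ x _ _)) }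

  Linear-* : ∀ {n} {ℓ : Vector n → Carrier} y → Linear ℓ → Linear (λ v → y * ℓ v)
  Linear-* {ℓ = ℓ} y p = record
    { resp = λ eq → cong (y *_) (resp p eq)
    ; add  = λ u v → trans (cong (y *_) (add p u v)) (distribˡ y _ _)
    ; mul  = λ x v → trans (cong (y *_) (mul p x v)) (S.solve 3 (λ y x a → y :* (x :* a) := x :* (y :* a)) refl y x (ℓ v)) }

  infixr 5 _◂_
  _◂_ : ∀ {n} → Carrier → Vector n → Vector (suc n)
  (x ◂ v) zero    = x
  (x ◂ v) (suc i) = v i

  e₀ : ∀ {n} → Vector (suc n)
  e₀ = 1# ◂ λ _ → 0#

  AllZero : ∀ {n} → List (Functional n) → Vector n → Set
  AllZero ℓs v = All (λ ℓ → proj₁ ℓ v ≡ 0#) ℓs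

  pivot : ∀ {n} (ℓs : List (Functional (suc n))) → AllZero ℓs e₀ ⊎
          (Σ (Functional (suc n)) λ ℓ → Σ (List (Functional (suc n))) λ rest → proj₁ ℓ e₀ ≢ 0# ×
             length ℓs ≡ suc (length rest) × (∀ v → proj₁ ℓ v ≡ 0# → AllZero rest v → AllZero ℓs v))
  pivot []       = inj₁ []
  pivot (ℓ ∷ ℓs) with proj₁ ℓ e₀ ≟ 0#
  ... | no ≢0 = inj₂ (ℓ , ℓs , ≢0 , refl , λ _ → _∷_)
  ... | yes ≡0 with pivot ℓs
  ...   | inj₁ all                               = inj₁ (≡0 ∷ all)
  ...   | inj₂ (ℓ′ , rest , ≢0 , len , restore) =
            inj₂ (ℓ′ , ℓ ∷ rest , ≢0 , cong suc len , λ { v z (h ∷ hs) → h ∷ restore v z hs })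

  -- Gaussian elimination. If every functional kills `e₀`, that vector is a solution. Otherwise some
  -- functional expresses the first coordinate through the others; substituting it removes one
  -- unknown and one equation.
  kernel : ∀ n (ℓs : List (Functional n)) → length ℓs < n →
           Σ (Vector n) λ v → (Σ (Fin n) λ i → v i ≢ 0#) × AllZero ℓs v
  kernel (suc n) ℓs ℓs<n with pivot ℓs
  ... | inj₁ all = e₀ , (zero , (0≢1 ∘ sym)) , all
  ... | inj₂ ((ℓ , lin) , rest , ℓe₀≢0 , len , restore) =
        let v , (i , vi≢0) , zeros = kernel n (map restrict rest) (subst (_< n) (sym (length-map restrict rest)) (ℕₚ.≤-pred (subst (_< suc n) len ℓs<n)))
        in  lift v , (suc i , vi≢0) , restore (lift v) (lift-zero v) (unmap rest v zeros)
    where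
    open ≡-Reasoning
    y : Carrier
    y = proj₁ (inverse (ℓ e₀) ℓe₀≢0)
    head : Vector n → Carrier
    -- The first coordinate that makes the pivot vanish, `- ℓ(0, v) / ℓ(e₀)`.
    head v = - y * ℓ (0# ◂ v)
    lift : Vector n → Vector (suc n)
    lift v = head v ◂ v
    ◂-add : ∀ u v (i : Fin (suc n)) → (0# ◂ λ i → u i + v i) i ≡ (0# ◂ u) i + (0# ◂ v) i
    ◂-add u v zero    = sym (+-identityˡ 0#)
    ◂-add u v (suc i) = refl
    ◂-mul : ∀ x v (i : Fin (suc n)) → (0# ◂ λ i → x * v i) i ≡ x * (0# ◂ v) i
    ◂-mul x v zero    = sym (zeroʳ x)
    ◂-mul x v (suc i) = refl
    ◂-resp : ∀ {u v : Vector n} → (∀ i → u i ≡ v i) → ∀ i → (0# ◂ u) i ≡ (0# ◂ v) i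
    ◂-resp eq zero    = refl
    ◂-resp eq (suc i) = eq i
    head-linear : Linear head
    head-linear = Linear-* (- y) (record
      { resp = λ eq → resp lin (◂-resp eq)
      ; add  = λ u v → trans (resp lin (◂-add u v)) (add lin (0# ◂ u) (0# ◂ v))
      ; mul  = λ x v → trans (resp lin (◂-mul x v)) (mul lin x (0# ◂ v)) })
    restrict : Functional (suc n) → Functional n
    restrict (ℓ′ , lin′) = ℓ′ ∘ lift , record
      { resp = λ eq → resp lin′ λ { zero → resp head-linear eq ; (suc i) → eq i }
      ; add  = λ u v → trans (resp lin′ λ { zero → add head-linear u v ; (suc i) → refl }) (add lin′ (lift u) (lift v))
      ; mul  = λ x v → trans (resp lin′ λ { zero → mul head-linear x v ; (suc i) → refl }) (mul lin′ x (lift v)) }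
    unmap : ∀ ℓs v → AllZero (map restrict ℓs) v → AllZero ℓs (lift v)
    unmap []       v []       = []
    unmap (_ ∷ ℓs) v (h ∷ hs) = h ∷ unmap ℓs v hs
    split : ∀ v (i : Fin (suc n)) → lift v i ≡ head v * e₀ i + (0# ◂ v) i
    split v zero    = sym (trans (+-identityʳ _) (*-identityʳ _))
    split v (suc i) = sym (trans (cong (_+ v i) (zeroʳ _)) (+-identityˡ _))
    lift-zero : ∀ v → ℓ (lift v) ≡ 0#
    lift-zero v = begin
      ℓ (lift v) ≡⟨ resp lin (split v) ⟩
      ℓ (λ i → head v * e₀ i + (0# ◂ v) i) ≡⟨ add lin (λ i → head v * e₀ i) (0# ◂ v) ⟩
      ℓ (λ i → head v * e₀ i) + z ≡⟨ cong (_+ z) (mul lin (head v) e₀) ⟩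
      - y * z * ℓ e₀ + z ≡⟨ S.solve 4 (λ y z x m → m :* z :* x :+ z := m :* x :* z :+ z) refl y z (ℓ e₀) (- y) ⟩
      - y * ℓ e₀ * z + z ≡⟨ cong (λ x → x * z + z) (trans (sym (-‿distribˡ-* y _)) (cong -_ (trans (*-comm y _) (proj₂ (inverse (ℓ e₀) ℓe₀≢0))))) ⟩
      - 1# * z + z ≡⟨ cong (_+ z) (-1*x≈-x z) ⟩
      - z + z ≡⟨ -‿inverseˡ z ⟩
      0# ∎
      where
      z : Carrier
      z = ℓ (0# ◂ v)

  -- LinDeg E φ: φ v w is a polynomial in w of degree < E whose coefficients are linear in v.
  data LinDeg {n : ℕ} : ℕ → (Vector n → Carrier → Carrier) → Set where
    []   : ∀ {φ} → (∀ v w → φ v w ≡ 0#) → LinDeg 0 φ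
    cons : ∀ {E φ ψ} ℓ → Linear ℓ → LinDeg E ψ → (∀ v w → φ v w ≡ ℓ v + w * ψ v w) → LinDeg (suc E) φ

  module _ {n : ℕ} where

    Family : Set
    Family = Vector n → Carrier → Carrier

    LinDeg-cong : ∀ {E} {φ φ′ : Family} → (∀ v w → φ′ v w ≡ φ v w) → LinDeg E φ → LinDeg E φ′
    LinDeg-cong eq ([] h)           = [] (λ v w → trans (eq v w) (h v w))
    LinDeg-cong eq (cons ℓ lin d h) = cons ℓ lin d (λ v w → trans (eq v w) (h v w))

    LinDeg-0 : ∀ E → LinDeg {n} E (λ _ _ → 0#)
    LinDeg-0 zero    = [] (λ _ _ → refl)
    LinDeg-0 (suc E) = cons (λ _ → 0#) Linear-0 (LinDeg-0 E) (λ v w → sym (trans (+-identityˡ _) (zeroʳ w)))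

    LinDeg-+ : ∀ {E} {φ φ′ : Family} → LinDeg E φ → LinDeg E φ′ → LinDeg E (λ v w → φ v w + φ′ v w)
    LinDeg-+ ([] h) ([] h′) = [] (λ v w → trans (cong₂ _+_ (h v w) (h′ v w)) (+-identityˡ 0#))
    LinDeg-+ (cons {ψ = ψ} ℓ lin d h) (cons {ψ = ψ′} ℓ′ lin′ d′ h′) = cons _ (Linear-+ lin lin′) (LinDeg-+ d d′)
      (λ v w → trans (cong₂ _+_ (h v w) (h′ v w))
        (S.solve 5 (λ a b x y w → (a :+ w :* x) :+ (b :+ w :* y) := (a :+ b) :+ w :* (x :+ y)) refl (ℓ v) (ℓ′ v) (ψ v w) (ψ′ v w) w))

    LinDeg-* : ∀ {E} {φ : Family} x → LinDeg E φ → LinDeg E (λ v w → x * φ v w)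
    LinDeg-* x ([] h) = [] (λ v w → trans (cong (x *_) (h v w)) (zeroʳ x))
    LinDeg-* x (cons {ψ = ψ} ℓ lin d h) = cons _ (Linear-* x lin) (LinDeg-* x d)
      (λ v w → trans (cong (x *_) (h v w)) (S.solve 4 (λ x a w y → x :* (a :+ w :* y) := x :* a :+ w :* (x :* y)) refl x (ℓ v) w (ψ v w)))

    LinDeg-suc : ∀ {E} {φ : Family} → LinDeg E φ → LinDeg (suc E) φ
    LinDeg-suc ([] h)           = LinDeg-cong h (LinDeg-0 1)
    LinDeg-suc (cons ℓ lin d h) = cons ℓ lin (LinDeg-suc d) h

    LinDeg-≤ : ∀ {E E′} {φ : Family} → E ≤ E′ → LinDeg E φ → LinDeg E′ φ
    LinDeg-≤ {E′ = zero}   z≤n        ([] h)           = [] h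
    LinDeg-≤ {E′ = suc E′} z≤n        ([] h)           = LinDeg-suc (LinDeg-≤ z≤n ([] h))
    LinDeg-≤               (s≤s E≤E′) (cons ℓ lin d h) = cons ℓ lin (LinDeg-≤ E≤E′ d) h

    LinDeg-w* : ∀ {E} {φ : Family} → LinDeg E φ → LinDeg (suc E) (λ v w → w * φ v w)
    LinDeg-w* d = cons (λ _ → 0#) Linear-0 d (λ v w → sym (+-identityˡ _))

    LinDeg-shift* : ∀ {E} {φ : Family} a → LinDeg E φ → LinDeg (suc E) (λ v w → (w + a) * φ v w)
    LinDeg-shift* a d = LinDeg-cong (λ v w → distribʳ _ w a) (LinDeg-+ (LinDeg-w* d) (LinDeg-suc (LinDeg-* a d)))

    LinDeg-^* : ∀ {E} {φ : Family} e a → LinDeg E φ → LinDeg (e ℕ.+ E) (λ v w → (w + a) ^ e * φ v w)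
    LinDeg-^* zero    a d = LinDeg-cong (λ v w → *-identityˡ _) d
    LinDeg-^* (suc e) a d = LinDeg-cong (λ v w → *-assoc _ _ _) (LinDeg-shift* a (LinDeg-^* e a d))

    LinDeg-conv : ∀ {E} (s : Carrier → Seq) (x : Vector n → Carrier → Seq) →
                  (∀ i k → LinDeg E (λ v w → s w i * x v w k)) → ∀ k → LinDeg {n} E (λ v w → conv (s w) (x v w) k)
    LinDeg-conv s x d zero    = d 0 0
    LinDeg-conv s x d (suc k) = LinDeg-+ (d 0 (suc k)) (LinDeg-conv (λ w → s w ∘ suc) x (λ i → d (suc i)) k)

    coefficients : ∀ {E} {φ : Family} → LinDeg E φ → List (Functional n)
    coefficients ([] _)           = []
    coefficients (cons ℓ lin d _) = (ℓ , lin) ∷ coefficients d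

    length-coefficients : ∀ {E} {φ : Family} (d : LinDeg E φ) → length (coefficients d) ≡ E
    length-coefficients ([] _)         = refl
    length-coefficients (cons _ _ d _) = cong suc (length-coefficients d)

    coefficients-zero : ∀ {E} {φ : Family} (d : LinDeg E φ) v → AllZero (coefficients d) v → ∀ w → φ v w ≡ 0#
    coefficients-zero ([] h)         v []       w = h v w
    coefficients-zero (cons ℓ _ d h) v (z ∷ zs) w = trans (h v w)
      (trans (cong₂ (λ x y → x + w * y) z (coefficients-zero d v zs w)) (trans (+-identityˡ _) (zeroʳ w)))

    -- Each `φ k` is forced to be zero as a polynomial in `w`, one equation per coefficient. The
    -- number of equations is therefore independent of how many points `w` are to be treated.
    conditions : ∀ {E} {φ : ℕ → Family} → (∀ k → LinDeg E (φ k)) → ∀ m → Σ (List (Functional n)) λ ℓs → length ℓs ≡ m ℕ.* E ×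
                 (∀ v → AllZero ℓs v → ∀ k → k < m → ∀ w → φ k v w ≡ 0#)
    conditions d zero    = [] , refl , λ _ _ _ ()
    conditions d (suc m) =
      let ℓs , len , zeros = conditions (d ∘ suc) m
      in  coefficients (d 0) ++ ℓs , trans (length-++ (coefficients (d 0))) (cong₂ ℕ._+_ (length-coefficients (d 0)) len) ,
          λ { v z zero    _         → coefficients-zero (d 0) v (Allₚ.++⁻ˡ (coefficients (d 0)) z)
            ; v z (suc k) (s≤s k<m) → zeros v (Allₚ.++⁻ʳ (coefficients (d 0)) z) k k<m }

-- Stepanov's method for level sets of the character of a split polynomial.

-- The parameters of the auxiliary polynomial are m = 64d, J = 33d and B = 3200d², where d = 1 + e is the degree.
module StepanovParameters where

  open Data.Nat using (_+_; _*_)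

  64d≤3200d² : ∀ e → 64 * suc e ≤ 3200 * (suc e * suc e)
  64d≤3200d² e = ℕₚ.*-mono-≤ {64} {3200} (ℕₚ.m≤m+n 64 3136) (ℕₚ.m≤m*n (suc e) (suc e))

  -- This is `m (J + d m + B) < 2 J B`. To leading order in `B` it says `m < 2 J`, hence 33 as the
  -- first integer above half of 64. The excess `2 J - m = 2 d` leaves `2 d B = 6400 d³` to absorb
  -- `m (d m + J) = 4096 d³ + 2112 d²`, which fixes the size of `B`.
  conditions<unknowns : ∀ e → let d = suc e in
    64 * d * (33 * d + (d * (64 * d) + 3200 * (d * d))) < 33 * d * (3200 * (d * d) * 2)
  -- The slack is `2304 d³ - 2112 d² - 1`; written in `e = d - 1` all its coefficients are positive.
  conditions<unknowns e = ℕₚ.≤-trans (ℕₚ.m≤m+n _ (2304 * (e * (e * e)) + 4800 * (e * e) + 2688 * e + 191)) (ℕₚ.≤-reflexive (lem e))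
    where
    lem : ∀ e → 1 + 64 * (1 + e) * (33 * (1 + e) + ((1 + e) * (64 * (1 + e)) + 3200 * ((1 + e) * (1 + e)))) +
                (2304 * (e * (e * e)) + 4800 * (e * e) + 2688 * e + 191) ≡
                33 * (1 + e) * (3200 * ((1 + e) * (1 + e)) * 2)
    lem = solveℕ

  -- In the degree `J q + d c + B` the last two terms are together at most `d q`, because
  -- `B = 3200 d²`, `3200 d ≤ c` and `2 c ≤ q`. They raise 33/64 to 34/64.
  numerical-bound : ∀ e N {c q} → let d = suc e in 3200 * (d * d) ≤ c → c + c ≤ q →
    N * (64 * d) < 33 * d * q + (d * c + 3200 * (d * d)) → 64 * N ≤ 34 * q
  numerical-bound e N {c} {q} B≤c 2c≤q lt = ℕₚ.<⇒≤ (ℕₚ.*-cancelˡ-< d _ _ (begin-strict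
    d * (64 * N) ≡⟨ lem₁ d N ⟩
    N * (64 * d) <⟨ lt ⟩
    33 * d * q + (d * c + 3200 * (d * d)) ≡⟨ lem₂ d q c ⟩
    33 * d * q + d * (c + 3200 * d) ≤⟨ ℕₚ.+-monoʳ-≤ (33 * d * q) (ℕₚ.*-monoʳ-≤ d c+3200d≤q) ⟩
    33 * d * q + d * q ≡⟨ lem₃ d q ⟩
    d * (34 * q) ∎))
    where
    open ℕₚ.≤-Reasoning
    d = suc e
    c+3200d≤q : c + 3200 * d ≤ q
    c+3200d≤q = ℕₚ.≤-trans (ℕₚ.+-monoʳ-≤ c (ℕₚ.≤-trans (ℕₚ.*-monoʳ-≤ 3200 (ℕₚ.m≤m*n d d)) B≤c)) 2c≤q
    lem₁ : ∀ d n → d * (64 * n) ≡ n * (64 * d)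
    lem₁ = solveℕ
    lem₂ : ∀ d q c → 33 * d * q + (d * c + 3200 * (d * d)) ≡ 33 * d * q + d * (c + 3200 * d)
    lem₂ = solveℕ
    lem₃ : ∀ d q → 33 * d * q + d * q ≡ d * (34 * q)
    lem₃ = solveℕ

module Stepanov {q : ℕ} (F : FiniteField q) (c : ℕ) (1≤c : 1 ≤ c) (q≡1+2c : q ≡ suc (c ℕ.+ c)) where

  open FiniteField F
  open Binomials
  open Series F
  open Fermat F
  open LinearAlgebra F
  open S using (_:+_; _:*_; _:=_)

  Π^ : ℕ → List Carrier → Carrier → Carrier
  Π^ e []       w = 1#
  Π^ e (a ∷ as) w = (w - a) ^ e * Π^ e as w

  Π^-≢0 : ∀ m as w → Π^ c as w ≢ 0# → Π^ m as w ≢ 0#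
  Π^-≢0 m []       w h = h
  Π^-≢0 m (a ∷ as) w h = *-≢0
    (^-≢0 m (λ eq → h (trans (cong (_* Π^ c as w) (trans (cong (_^ c) eq) (0^ 1≤c))) (zeroˡ _))))
    (Π^-≢0 m as w (λ eq → h (trans (cong ((w - a) ^ c *_) eq) (zeroʳ _))))

  -- Multiplication by the c-th power of ∏ (x - a), expanded at w.
  timesPower : List Carrier → Carrier → Seq → Seq
  timesPower []       w x = x
  timesPower (a ∷ as) w x = iter c (Op (w - a)) (timesPower as w x)

  -- For orders `i ≤ m` this is the coefficient of `z^i` in `(v + z)^c` with the factor `v^(c-m)`
  -- taken out. Its degree in `v` is `m - i`, independent of `c`, which keeps the linear system
  -- small.
  reducedRow : ℕ → Carrier → Seq
  reducedRow m v i = ⟦ choose c i ⟧ * v ^ (m ∸ i)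

  -- Below order m, timesPower agrees with this up to the factor ∏ (w - a)^c / ∏ (w - a)^m.
  timesReduced : ℕ → List Carrier → Carrier → Seq → Seq
  timesReduced m []       w x = x
  timesReduced m (a ∷ as) w x = conv (reducedRow m (w - a)) (timesReduced m as w x)

  conv-row-reduced : ∀ m v s k → k ≤ m → k ≤ c → v ^ m * conv (row c v) s k ≡ v ^ c * conv (reducedRow m v) s k
  conv-row-reduced m v s k k≤m k≤c = trans (sym (conv-·ˡ (v ^ m) (row c v) s k))
    (trans (conv-congˡ s k entry) (conv-·ˡ (v ^ c) (reducedRow m v) s k))
    where
    open ≡-Reasoning
    entry : ∀ i → i ≤ k → v ^ m * (⟦ choose c i ⟧ * v ^ (c ∸ i)) ≡ v ^ c * (⟦ choose c i ⟧ * v ^ (m ∸ i))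
    entry i i≤k = begin
      v ^ m * (⟦ choose c i ⟧ * v ^ (c ∸ i)) ≡⟨ S.solve 3 (λ a b d → a :* (b :* d) := b :* (a :* d)) refl (v ^ m) ⟦ choose c i ⟧ (v ^ (c ∸ i)) ⟩
      ⟦ choose c i ⟧ * (v ^ m * v ^ (c ∸ i)) ≡⟨ cong (⟦ choose c i ⟧ *_) exponents ⟩
      ⟦ choose c i ⟧ * (v ^ c * v ^ (m ∸ i)) ≡⟨ S.solve 3 (λ a b d → b :* (a :* d) := a :* (b :* d)) refl (v ^ c) ⟦ choose c i ⟧ (v ^ (m ∸ i)) ⟩
      v ^ c * (⟦ choose c i ⟧ * v ^ (m ∸ i)) ∎
      where
      exponents : v ^ m * v ^ (c ∸ i) ≡ v ^ c * v ^ (m ∸ i)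
      exponents = trans (sym (^-+ v m (c ∸ i))) (trans (cong (v ^_) (begin
        m ℕ.+ (c ∸ i) ≡⟨ sym (ℕₚ.+-∸-assoc m (ℕₚ.≤-trans i≤k k≤c)) ⟩
        m ℕ.+ c ∸ i ≡⟨ cong (_∸ i) (ℕₚ.+-comm m c) ⟩
        c ℕ.+ m ∸ i ≡⟨ ℕₚ.+-∸-assoc c (ℕₚ.≤-trans i≤k k≤m) ⟩
        c ℕ.+ (m ∸ i) ∎)) (^-+ v c (m ∸ i)))

  timesPower-reduced : ∀ m as w x k → k ≤ m → k ≤ c → Π^ m as w * timesPower as w x k ≡ Π^ c as w * timesReduced m as w x k
  timesPower-reduced m []       w x k k≤m k≤c = refl
  timesPower-reduced m (a ∷ as) w x k k≤m k≤c = begin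
    v ^ m * P * iter c (Op v) s k ≡⟨ cong (v ^ m * P *_) (iter-Op c v s k) ⟩
    v ^ m * P * conv (row c v) s k ≡⟨ S.solve 3 (λ a b d → a :* b :* d := b :* (a :* d)) refl (v ^ m) P (conv (row c v) s k) ⟩
    P * (v ^ m * conv (row c v) s k) ≡⟨ cong (P *_) (conv-row-reduced m v s k k≤m k≤c) ⟩
    P * (v ^ c * conv (reducedRow m v) s k)
      ≡⟨ S.solve 3 (λ a b d → a :* (b :* d) := b :* (a :* d)) refl P (v ^ c) (conv (reducedRow m v) s k) ⟩
    v ^ c * (P * conv (reducedRow m v) s k)
      ≡⟨ cong (v ^ c *_) (sym (conv-·ʳ P (reducedRow m v) s k)) ⟩
    v ^ c * conv (reducedRow m v) (P · s) k
      ≡⟨ cong (v ^ c *_) (conv-congʳ (reducedRow m v) k (λ i i≤k → timesPower-reduced m as w x i (ℕₚ.≤-trans i≤k k≤m) (ℕₚ.≤-trans i≤k k≤c))) ⟩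
    v ^ c * conv (reducedRow m v) (P′ · s′) k
      ≡⟨ cong (v ^ c *_) (conv-·ʳ P′ (reducedRow m v) s′ k) ⟩
    v ^ c * (P′ * conv (reducedRow m v) s′ k)
      ≡⟨ sym (*-assoc _ _ _) ⟩
    v ^ c * P′ * conv (reducedRow m v) s′ k ∎
    where
    open ≡-Reasoning
    v = w - a
    P = Π^ m as w
    P′ = Π^ c as w
    s = timesPower as w x
    s′ = timesReduced m as w x

  horner : ∀ n → (Fin n → Carrier) → Carrier → Seq
  horner zero    r w = 0ₛ
  horner (suc n) r w = const (r zero) ⊞ Op w (horner n (r ∘ suc) w)

  Poly-horner : ∀ n r → Poly n (horner n r)
  Poly-horner zero    r = Poly-0 0
  Poly-horner (suc n) r = cons (r zero) (Poly-horner n (r ∘ suc)) (λ _ _ → refl)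

  horner-at-0 : ∀ n r b → horner n r 0# (toℕ b) ≡ r b
  horner-at-0 (suc n) r zero    = trans (cong (r zero +_) (zeroˡ _)) (+-identityʳ _)
  horner-at-0 (suc n) r (suc b) = trans (+-identityˡ _) (trans (Op-shift refl (horner n (r ∘ suc) 0#) (toℕ b)) (horner-at-0 n (r ∘ suc) b))

  horner-0 : ∀ n r w → (∀ b → r b ≡ 0#) → horner n r w ≋ 0ₛ
  horner-0 zero    r w h k = refl
  horner-0 (suc n) r w h k = trans (cong₂ _+_ (const≡0 k) (Op-0 w (horner-0 n (r ∘ suc) w (h ∘ suc)) k)) (+-identityˡ 0#)
    where
    const≡0 : const (r zero) ≋ 0ₛ
    const≡0 zero    = h zero
    const≡0 (suc k) = refl

  LinDeg-horner : ∀ {N} n (r : Vector N → Fin n → Carrier) → (∀ b → Linear (λ v → r v b)) →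
                  ∀ k → LinDeg n (λ v w → horner n (r v) w k)
  LinDeg-horner zero    r lin k       = LinDeg-0 0
  LinDeg-horner (suc n) r lin zero    = cons (λ v → r v zero) (lin zero) (LinDeg-horner n (λ v → r v ∘ suc) (lin ∘ suc) 0) (λ _ _ → refl)
  LinDeg-horner (suc n) r lin (suc k) = LinDeg-cong (λ v w → +-identityˡ _)
    (LinDeg-+ (LinDeg-w* (LinDeg-horner n (λ v → r v ∘ suc) (lin ∘ suc) (suc k)))
              (LinDeg-suc (LinDeg-horner n (λ v → r v ∘ suc) (lin ∘ suc) k)))

  LinDeg-timesReduced : ∀ {N E} m as (x : Vector N → Carrier → Seq) → (∀ k → LinDeg E (λ v w → x v w k)) →
                        ∀ k → LinDeg (length as ℕ.* m ℕ.+ E) (λ v w → timesReduced m as w (x v w) k)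
  LinDeg-timesReduced m []       x d = d
  LinDeg-timesReduced {E = E} m (a ∷ as) x d = LinDeg-conv (λ w → reducedRow m (w - a)) (λ v w → timesReduced m as w (x v w))
    (λ i k → LinDeg-cong (λ v w → *-assoc _ _ _) (LinDeg-* ⟦ choose c i ⟧
      (LinDeg-≤ (bound i) (LinDeg-^* (m ∸ i) (- a) (LinDeg-timesReduced m as x d k)))))
    where
    bound : ∀ i → m ∸ i ℕ.+ (length as ℕ.* m ℕ.+ E) ≤ m ℕ.+ length as ℕ.* m ℕ.+ E
    bound i = ℕₚ.≤-trans (ℕₚ.+-monoˡ-≤ (length as ℕ.* m ℕ.+ E) (ℕₚ.m∸n≤m m i)) (ℕₚ.≤-reflexive (sym (ℕₚ.+-assoc m (length as ℕ.* m) E)))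

  LinDeg-Π^* : ∀ {N E} m as {φ : Vector N → Carrier → Carrier} → LinDeg E φ → LinDeg (length as ℕ.* m ℕ.+ E) (λ v w → Π^ m as w * φ v w)
  LinDeg-Π^* m []       d = LinDeg-cong (λ v w → *-identityˡ _) d
  LinDeg-Π^* {E = E} m (a ∷ as) {φ} d = subst (λ z → LinDeg z (λ v w → Π^ m (a ∷ as) w * φ v w)) (sym (ℕₚ.+-assoc m (length as ℕ.* m) E))
    (LinDeg-cong (λ v w → *-assoc _ _ _) (LinDeg-^* m (- a) (LinDeg-Π^* m as d)))

  Poly-timesPower : ∀ {H G} as → Poly H G → Poly (length as ℕ.* c ℕ.+ H) (λ w → timesPower as w (G w))
  Poly-timesPower []       p = p
  Poly-timesPower {H} {G} (a ∷ as) p = subst (λ z → Poly z (λ w → timesPower (a ∷ as) w (G w))) (sym (ℕₚ.+-assoc c (length as ℕ.* c) H))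
    (Poly-iter c (- a) (Poly-timesPower as p))

  timesPower-0 : ∀ as w {x} → x ≋ 0ₛ → timesPower as w x ≋ 0ₛ
  timesPower-0 []       w h = h
  timesPower-0 (a ∷ as) w h = iter-Op-0 c (w - a) (timesPower-0 as w h)

  timesPower-cancel : ∀ as w {x m} → All (λ a → w - a ≢ 0#) as → (∀ k → k < m → timesPower as w x k ≡ 0#) → ∀ k → k < m → x k ≡ 0#
  timesPower-cancel []       w []           h = h
  timesPower-cancel (a ∷ as) w (w≢a ∷ rest) h = timesPower-cancel as w rest (iter-Op-cancel c w≢a h)

  module Auxiliary (as : List Carrier) (B : ℕ) where

    Coefficients : ℕ → Set
    Coefficients J = Fin J → Fin B → Carrier

    -- Σⱼ (rⱼ(x) + sⱼ(x) ∏ (x - a)^c) x^(qj), expanded at w.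
    aux : ∀ J → Coefficients J → Coefficients J → Carrier → Seq
    aux zero    r s w = 0ₛ
    aux (suc J) r s w = horner B (r zero) w ⊞ timesPower as w (horner B (s zero) w) ⊞ iter q (Op w) (aux J (r ∘ suc) (s ∘ suc) w)

    auxReduced : ℕ → Carrier → ∀ J → Coefficients J → Coefficients J → Carrier → Seq
    auxReduced m ε zero    r s w k = 0#
    auxReduced m ε (suc J) r s w k =
      Π^ m as w * horner B (r zero) w k + ε * timesReduced m as w (horner B (s zero) w) k + w * auxReduced m ε J (r ∘ suc) (s ∘ suc) w k

    Poly-aux : ∀ J r s → Poly (J ℕ.* q ℕ.+ (length as ℕ.* c ℕ.+ B)) (aux J r s)
    Poly-aux zero    r s = Poly-0 _
    Poly-aux (suc J) r s = Poly-⊞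
      (Poly-≤ (ℕₚ.m≤n+m _ (suc J ℕ.* q)) (Poly-⊞ (Poly-≤ (ℕₚ.m≤n+m B _) (Poly-horner B (r zero))) (Poly-timesPower as (Poly-horner B (s zero)))))
      (subst (λ z → Poly z (λ w → iter q (Op w) (aux J (r ∘ suc) (s ∘ suc) w))) (sym (ℕₚ.+-assoc q (J ℕ.* q) _)) (raise q (Poly-aux J (r ∘ suc) (s ∘ suc))))
      where
      raise : ∀ {H G} n → Poly H G → Poly (n ℕ.+ H) (λ w → iter n (Op w) (G w))
      raise zero    p = p
      raise (suc n) p = Poly-Op₀ (raise n p)

    LinDeg-auxReduced : ∀ {N} m ε J (r s : Vector N → Coefficients J) →
      (∀ j b → Linear (λ v → r v j b)) → (∀ j b → Linear (λ v → s v j b)) →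
      ∀ k → LinDeg (J ℕ.+ (length as ℕ.* m ℕ.+ B)) (λ v w → auxReduced m ε J (r v) (s v) w k)
    LinDeg-auxReduced m ε zero    r s lr ls k = LinDeg-0 _
    LinDeg-auxReduced m ε (suc J) r s lr ls k = LinDeg-+
      (LinDeg-≤ (ℕₚ.m≤n+m _ (suc J)) (LinDeg-+ (LinDeg-Π^* m as (LinDeg-horner B (λ v → r v zero) (lr zero) k))
        (LinDeg-* ε (LinDeg-timesReduced m as (λ v w → horner B (s v zero) w) (LinDeg-horner B (λ v → s v zero) (ls zero)) k))))
      (LinDeg-w* (LinDeg-auxReduced m ε J (λ v → r v ∘ suc) (λ v → s v ∘ suc) (lr ∘ suc) (ls ∘ suc) k))

    -- Where `f^c = ε`, the power `x^q` acts as `w` and the large powers of `w - a` are absorbed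
    -- into `ε`. With `d` roots, the coefficient becomes a polynomial in `w` of degree below
    -- `J + d m + B` instead of `J q + d c + B`. The price is the factor `∏ (w - a)^m`, which is
    -- nonzero when `ε` is.
    aux-reduced : ∀ m ε J r s w k → k ≤ m → k ≤ c → k < q → Π^ c as w ≡ ε → Π^ m as w * aux J r s w k ≡ auxReduced m ε J r s w k
    aux-reduced m ε zero    r s w k k≤m k≤c k<q eq = zeroʳ _
    aux-reduced m ε (suc J) r s w k k≤m k≤c k<q eq = begin
      P * (a + b + iter q (Op w) t k) ≡⟨ cong (λ z → P * (a + b + z)) (iter-q-Op w t k k<q) ⟩
      P * (a + b + w * t k) ≡⟨ S.solve 5 (λ p a b w t → p :* (a :+ b :+ w :* t) := p :* a :+ p :* b :+ w :* (p :* t)) refl P a b w (t k) ⟩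
      P * a + P * b + w * (P * t k)
        ≡⟨ cong₂ (λ y z → P * a + y + w * z) (trans (timesPower-reduced m as w (horner B (s zero) w) k k≤m k≤c) (cong (_* _) eq))
             (aux-reduced m ε J (r ∘ suc) (s ∘ suc) w k k≤m k≤c k<q eq) ⟩
      P * a + ε * timesReduced m as w (horner B (s zero) w) k + w * auxReduced m ε J (r ∘ suc) (s ∘ suc) w k ∎
      where
      open ≡-Reasoning
      P = Π^ m as w
      a = horner B (r zero) w k
      b = timesPower as w (horner B (s zero) w) k
      t = aux J (r ∘ suc) (s ∘ suc) w

  -- If 0 is a simple root of the product, its c-th power is zᶜ times a unit of the power series ring.
  -- Hence, as q = 2c + 1, the coefficients of z⁰ … z^(q-1) determine r₀ and s₀ when these have degree < B ≤ c.
  aux-injective : ∀ as B → All (_≢ 0#) as → B ≤ c → let open Auxiliary (0# ∷ as) B in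
                  ∀ J r s → aux J r s 0# ≋ 0ₛ → ∀ j b → r j b ≡ 0# × s j b ≡ 0#
  aux-injective as B as≢0 B≤c (suc J) r s h = λ { zero b → r₀≡0 b , s₀≡0 b ; (suc j) b → aux-injective as B as≢0 B≤c J (r ∘ suc) (s ∘ suc) tail≡0 j b }
    where
    open ≡-Reasoning
    open Auxiliary (0# ∷ as) B
    0-a≢0 : All (λ a → 0# - a ≢ 0#) as
    0-a≢0 = All.map (λ a≢0 eq → a≢0 (sym (x-y≡0⇒x≡y eq))) as≢0
    R₀ = horner B (r zero) 0#
    S₀ = horner B (s zero) 0#
    t = aux J (r ∘ suc) (s ∘ suc) 0#
    low-q : ∀ k → k < q → R₀ k + timesPower (0# ∷ as) 0# S₀ k ≡ 0#
    low-q k k<q = trans (sym (+-identityʳ _)) (trans (cong (R₀ k + timesPower (0# ∷ as) 0# S₀ k +_) (sym (iter-Op-shift-< q refl t k k<q))) (h k))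
    c<q : c < q
    c<q = subst (c <_) (sym q≡1+2c) (s≤s (ℕₚ.m≤m+n c c))
    r₀≡0 : ∀ b → r zero b ≡ 0#
    r₀≡0 b = begin
      r zero b ≡⟨ sym (horner-at-0 B (r zero) b) ⟩
      R₀ (toℕ b) ≡⟨ sym (+-identityʳ _) ⟩
      R₀ (toℕ b) + 0# ≡⟨ cong (R₀ (toℕ b) +_) (sym (iter-Op-shift-< c (-‿inverseʳ 0#) (timesPower as 0# S₀) (toℕ b) b<c)) ⟩
      R₀ (toℕ b) + timesPower (0# ∷ as) 0# S₀ (toℕ b) ≡⟨ low-q (toℕ b) (ℕₚ.<-trans b<c c<q) ⟩
      0# ∎
      where
      b<c : toℕ b < c
      b<c = ℕₚ.<-≤-trans (Finₚ.toℕ<n b) B≤c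
    power≡0 : ∀ k → k < q → timesPower (0# ∷ as) 0# S₀ k ≡ 0#
    power≡0 k k<q = trans (sym (trans (cong (_+ timesPower (0# ∷ as) 0# S₀ k) (horner-0 B (r zero) 0# r₀≡0 k)) (+-identityˡ _))) (low-q k k<q)
    S₀≡0 : ∀ k → k < suc c → S₀ k ≡ 0#
    S₀≡0 = timesPower-cancel as 0# 0-a≢0 λ k k≤c → trans (sym (iter-Op-shift-+ c (-‿inverseʳ 0#) (timesPower as 0# S₀) k))
      (power≡0 (c ℕ.+ k) (subst (c ℕ.+ k <_) (sym q≡1+2c) (s≤s (ℕₚ.+-monoʳ-≤ c (ℕₚ.≤-pred k≤c)))))
    s₀≡0 : ∀ b → s zero b ≡ 0#
    s₀≡0 b = trans (sym (horner-at-0 B (s zero) b)) (S₀≡0 (toℕ b) (ℕₚ.m≤n⇒m≤1+n (ℕₚ.<-≤-trans (Finₚ.toℕ<n b) B≤c)))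
    -- With the summand `j = 0` gone, the whole expansion at 0 is `z^q` times that of the remaining
    -- sum.
    tail≡0 : t ≋ 0ₛ
    tail≡0 k = begin
      t k ≡⟨ sym (iter-Op-shift-+ q refl t k) ⟩
      iter q (Op 0#) t (q ℕ.+ k) ≡⟨ sym (+-identityˡ _) ⟩
      0# + iter q (Op 0#) t (q ℕ.+ k) ≡⟨ cong (_+ iter q (Op 0#) t (q ℕ.+ k)) (sym (trans (cong₂ _+_ (horner-0 B (r zero) 0# r₀≡0 (q ℕ.+ k))
                                           (timesPower-0 (0# ∷ as) 0# (horner-0 B (s zero) 0# s₀≡0) (q ℕ.+ k))) (+-identityˡ 0#))) ⟩
      aux (suc J) r s 0# (q ℕ.+ k) ≡⟨ h (q ℕ.+ k) ⟩
      0# ∎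

  -- The `2 J B` unknown coefficients outnumber the equations, so a nontrivial choice satisfies all
  -- of them. By `aux-injective` the resulting polynomial is not zero, yet it vanishes to order `m`
  -- on `ws`; hence `m` times the number of points stays below its degree bound.
  vanishing-bound : ∀ as ws ε m J B → All (_≢ 0#) as → Unique ws → ε ≢ 0# → (∀ w → w ∈ ws → Π^ c (0# ∷ as) w ≡ ε) →
    B ≤ c → m ≤ c → m ℕ.* (J ℕ.+ (suc (length as) ℕ.* m ℕ.+ B)) < J ℕ.* (B ℕ.* 2) →
    length ws ℕ.* m < J ℕ.* q ℕ.+ (suc (length as) ℕ.* c ℕ.+ B)
  vanishing-bound as ws ε m J B as≢0 un ε≢0 value B≤c m≤c few = ℕₚ.≰⇒> λ H≤ →
    contradict (aux-injective as B as≢0 B≤c J (r v) (s v) (Poly-vanishing m ws un (Poly-aux J (r v) (s v)) H≤ vanishing 0#))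
    where
    open Auxiliary (0# ∷ as) B
    U = J ℕ.* (B ℕ.* 2)
    r s : Vector U → Coefficients J
    r v j b = v (Fin.combine j (Fin.combine b zero))
    s v j b = v (Fin.combine j (Fin.combine b (suc zero)))
    system = conditions (LinDeg-auxReduced m ε J r s (λ j b → Linear-proj (Fin.combine j (Fin.combine b zero))) (λ j b → Linear-proj (Fin.combine j (Fin.combine b (suc zero))))) m
    solution = kernel U (proj₁ system) (subst (_< U) (sym (proj₁ (proj₂ system))) few)
    v : Vector U
    v = proj₁ solution
    vanishing : ∀ w → w ∈ ws → ∀ k → k < m → aux J (r v) (s v) w k ≡ 0#
    vanishing w w∈ k k<m = *-cancel-0 (Π^-≢0 m (0# ∷ as) w (λ eq → ε≢0 (trans (sym (value w w∈)) eq)))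
      (trans (aux-reduced m ε J (r v) (s v) w k k≤m k≤c (ℕₚ.≤-<-trans k≤c (subst (c <_) (sym q≡1+2c) (s≤s (ℕₚ.m≤m+n c c)))) (value w w∈))
        (proj₂ (proj₂ system) v (proj₂ (proj₂ solution)) k k<m w))
      where
      k≤m = ℕₚ.<⇒≤ k<m
      k≤c = ℕₚ.≤-trans k≤m m≤c
    contradict : ¬ (∀ j b → r v j b ≡ 0# × s v j b ≡ 0#)
    contradict zeros = proj₂ (proj₁ (proj₂ solution)) (all-zero (proj₁ (proj₁ (proj₂ solution))))
      where
      entry : ∀ (j : Fin J) (b : Fin B) (t : Fin 2) → v (Fin.combine j (Fin.combine b t)) ≡ 0#
      entry j b zero       = proj₁ (zeros j b)
      entry j b (suc zero) = proj₂ (zeros j b)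
      all-zero : ∀ i → v i ≡ 0#
      all-zero i = subst (λ i → v i ≡ 0#)
        (trans (cong (Fin.combine (proj₁ jbt)) (Finₚ.combine-remQuot {B} 2 (proj₂ jbt)))
          (Finₚ.combine-remQuot {J} (B ℕ.* 2) i))
        (entry (proj₁ jbt) (proj₁ bt) (proj₂ bt))
        where
        jbt = Fin.remQuot {J} (B ℕ.* 2) i
        bt = Fin.remQuot {B} 2 (proj₂ jbt)

  level-set-bound₀ : ∀ as ws ε → All (_≢ 0#) as → Unique ws → ε ≢ 0# → (∀ w → w ∈ ws → Π^ c (0# ∷ as) w ≡ ε) →
    3200 ℕ.* (suc (length as) ℕ.* suc (length as)) ≤ c → 64 ℕ.* length ws ≤ 34 ℕ.* q
  level-set-bound₀ as ws ε as≢0 un ε≢0 value B≤c = numerical-bound (length as) (length ws) B≤c (subst (c ℕ.+ c ≤_) (sym q≡1+2c) (ℕₚ.n≤1+n _))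
    (vanishing-bound as ws ε (64 ℕ.* d) (33 ℕ.* d) (3200 ℕ.* (d ℕ.* d)) as≢0 un ε≢0 value B≤c (ℕₚ.≤-trans (64d≤3200d² (length as)) B≤c)
      (conditions<unknowns (length as)))
    where
    open StepanovParameters
    d = suc (length as)

  -- The injectivity argument needs 0 to be a simple root. Translating by the first of the distinct
  -- roots achieves this.
  level-set-bound : ∀ as ws ε → 1 ≤ length as → Unique as → Unique ws → ε ≢ 0# → (∀ w → w ∈ ws → Π^ c as w ≡ ε) →
    3200 ℕ.* (length as ℕ.* length as) ≤ c → 64 ℕ.* length ws ≤ 34 ℕ.* q
  level-set-bound (a ∷ as) ws ε _ (a∉as ∷ _) un ε≢0 value small = subst (λ n → 64 ℕ.* n ≤ 34 ℕ.* q) (length-map (_- a) ws)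
    (level-set-bound₀ (map (_- a) as) (map (_- a) ws) ε (Allₚ.map⁺ (All.map (λ a≢b b-a≡0 → a≢b (sym (x-y≡0⇒x≡y b-a≡0))) a∉as))
      (Unique.map⁺ translate-injective un) ε≢0 value′ (subst (λ n → 3200 ℕ.* (suc n ℕ.* suc n) ≤ c) (sym (length-map (_- a) as)) small))
    where
    translate-injective : ∀ {x y} → x - a ≡ y - a → x ≡ y
    translate-injective {x} {y} eq = trans (sym (x-y+y≡x x a)) (trans (cong (_+ a) eq) (x-y+y≡x y a))
    difference : ∀ w b → (w - a) - (b - a) ≡ w - b
    difference w b = trans (sym (x+y-y≡x ((w - a) - (b - a)) (b - a + - b))) (trans (cong₂ _+_ lemma (cong -_ lemma′)) refl-)
      where
      lemma : (w - a) - (b - a) + (b - a + - b) ≡ w - a - b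
      lemma = trans (sym (+-assoc _ _ _)) (cong (_+ - b) (x-y+y≡x (w - a) (b - a)))
      lemma′ : b - a + - b ≡ - a
      lemma′ = trans (+-comm _ _) (trans (sym (+-assoc _ _ _)) (trans (cong (_+ - a) (-‿inverseˡ b)) (+-identityˡ _)))
      refl- : w - a - b + - (- a) ≡ w - b
      refl- = trans (cong (w - a - b +_) (-‿involutive a)) (trans (S.solve 4 (λ w m n a → w :+ m :+ n :+ a := w :+ n :+ (m :+ a)) refl w (- a) (- b) a)
        (trans (cong (w - b +_) (-‿inverseˡ a)) (+-identityʳ _)))
    Π^-translate : ∀ bs w → Π^ c (map (_- a) bs) (w - a) ≡ Π^ c bs w
    Π^-translate []       w = refl
    Π^-translate (b ∷ bs) w = cong₂ (λ x y → x ^ c * y) (difference w b) (Π^-translate bs w)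
    value′ : ∀ w → w ∈ map (_- a) ws → Π^ c (0# ∷ map (_- a) as) w ≡ ε
    value′ w w∈ with ∈-map⁻ (_- a) w∈
    ... | u , u∈ , refl = trans (cong₂ (λ x y → x ^ c * y) (trans (cong (u - a +_) -0#≈0#) (+-identityʳ _)) (Π^-translate as u)) (value u u∈)

-- Elementary symmetric functions of signs.

-- A sequence s stands for the generating function Σ s k zᵏ over ℤ.
module ElementarySymmetric where

  open Binomials
  open Data.Integer using (+_; -[1+_]; _+_; _*_; -_; ∣_∣)

  -- step v s = (1 + v z) s.
  step : ℤ → (ℕ → ℤ) → ℕ → ℤ
  step v s zero    = s 0
  step v s (suc u) = s (suc u) + v * s u

  one : ℕ → ℤ
  one zero    = + 1
  one (suc u) = + 0

  esym : ∀ {A : Set} → (A → ℤ) → List A → ℕ → ℤ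
  esym f []       = one
  esym f (x ∷ xs) = step (f x) (esym f xs)

  infix 4 _≗ᶻ_
  _≗ᶻ_ : (ℕ → ℤ) → (ℕ → ℤ) → Set
  s ≗ᶻ t = ∀ u → s u ≡ t u

  step-cong : ∀ {v w s t} → v ≡ w → s ≗ᶻ t → step v s ≗ᶻ step w t
  step-cong refl eq zero    = eq 0
  step-cong {v} refl eq (suc u) = cong₂ (λ x y → x + v * y) (eq (suc u)) (eq u)

  step-comm : ∀ v w s → step v (step w s) ≗ᶻ step w (step v s)
  step-comm v w s zero          = refl
  step-comm v w s (suc zero)    = lem (s 1) (s 0) v w
    where
    lem : ∀ a b v w → a + w * b + v * b ≡ a + v * b + w * b
    lem = solveℤ
  step-comm v w s (suc (suc u)) = lem (s (suc (suc u))) (s (suc u)) (s u) v w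
    where
    lem : ∀ a b c v w → a + w * b + v * (b + w * c) ≡ a + v * b + w * (b + v * c)
    lem = solveℤ

  step-0 : ∀ s → step (+ 0) s ≗ᶻ s
  step-0 s zero    = refl
  step-0 s (suc u) = ℤₚ.+-identityʳ _

  step-iter-comm : ∀ v n w s → step v (iter n (step w) s) ≗ᶻ iter n (step w) (step v s)
  step-iter-comm v zero    w s u = refl
  step-iter-comm v (suc n) w s u = trans (step-comm v w (iter n (step w) s) u) (step-cong refl (step-iter-comm v n w s) u)

  iter-iter-comm : ∀ m v n w s → iter m (step v) (iter n (step w) s) ≗ᶻ iter n (step w) (iter m (step v) s)
  iter-iter-comm zero    v n w s u = refl
  iter-iter-comm (suc m) v n w s u = trans (step-cong refl (iter-iter-comm m v n w s) u) (step-iter-comm v n w (iter m (step v) s) u)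

  iter-+ : ∀ m n v s → iter (m ℕ.+ n) (step v) s ≗ᶻ iter m (step v) (iter n (step v) s)
  iter-+ zero    n v s u = refl
  iter-+ (suc m) n v s u = step-cong refl (iter-+ m n v s) u

  data IsSign : ℤ → Set where
    zero  : IsSign (+ 0)
    plus  : IsSign (+ 1)
    minus : IsSign -[1+ 0 ]

  count : ∀ {A : Set} → (A → ℤ) → ℤ → List A → ℕ
  count f v xs = length (filter (λ x → f x ℤ.≟ v) xs)

  -- A value 0 contributes the factor 1 and the remaining factors commute, so the generating
  -- function is `(1 + z)^P (1 - z)^M`.
  esym-signs : ∀ {A : Set} (f : A → ℤ) xs → (∀ x → IsSign (f x)) →
               esym f xs ≗ᶻ iter (count f (+ 1) xs) (step (+ 1)) (iter (count f -[1+ 0 ] xs) (step -[1+ 0 ]) one)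
  esym-signs f []       signs u = refl
  esym-signs f (x ∷ xs) signs u with f x | signs x | esym-signs f xs signs
  ... | _ | zero  | ih = trans (step-0 (esym f xs) u) (ih u)
  ... | _ | plus  | ih = step-cong refl ih u
  ... | _ | minus | ih = trans (step-cong refl ih u) (step-iter-comm -[1+ 0 ] (count f (+ 1) xs) (+ 1) _ u)

  count-total : ∀ {A : Set} (f : A → ℤ) xs → (∀ x → IsSign (f x)) →
                count f (+ 1) xs ℕ.+ count f -[1+ 0 ] xs ℕ.+ count f (+ 0) xs ≡ length xs
  count-total f []       signs = refl
  count-total f (x ∷ xs) signs with f x | signs x | count-total f xs signs
  ... | _ | zero  | ih = trans (ℕₚ.+-suc _ _) (cong suc ih)
  ... | _ | plus  | ih = cong suc ih
  ... | _ | minus | ih = trans (cong (ℕ._+ count f (+ 0) xs) (ℕₚ.+-suc (count f (+ 1) xs) _)) (cong suc ih)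

  -- For `v = ±1` this is `(1 - z²)^M`. The factored form is what is left of
  -- `(1 + v z)^a (1 - v z)^M` once the `a - M` surplus factors are split off.
  balanced : ℕ → ℤ → ℕ → ℤ
  balanced M v = iter M (step v) (iter M (step (- v)) one)

  balanced-suc : ∀ M v → balanced (suc M) v ≗ᶻ step v (step (- v) (balanced M v))
  balanced-suc M v u = step-cong refl (λ u → sym (step-iter-comm (- v) M v (iter M (step (- v)) one) u)) u

  double : ℕ → ℕ
  double zero    = zero
  double (suc k) = suc (suc (double k))

  double≡2* : ∀ k → double k ≡ 2 ℕ.* k
  double≡2* zero    = refl
  double≡2* (suc k) = trans (cong (λ n → suc (suc n)) (double≡2* k)) (sym (ℕₚ.*-suc 2 k))

  parity : ∀ u → (Σ ℕ λ k → u ≡ double k) ⊎ (Σ ℕ λ k → u ≡ suc (double k))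
  parity zero    = inj₁ (0 , refl)
  parity (suc u) with parity u
  ... | inj₁ (k , refl) = inj₂ (k , refl)
  ... | inj₂ (k , refl) = inj₁ (suc k , refl)

  -- (1 + v z)(1 - v z) = 1 - z² when v² = 1.
  difference-of-squares : ∀ v s u → v * v ≡ + 1 → step v (step (- v) s) (suc (suc u)) ≡ s (suc (suc u)) + - s u
  difference-of-squares v s u v²≡1 = trans (lem (s (suc (suc u))) (s (suc u)) (s u) v)
    (trans (cong (λ x → s (suc (suc u)) + - (x * s u)) v²≡1) (cong (λ x → s (suc (suc u)) + - x) (ℤₚ.*-identityˡ (s u))))
    where
    lem : ∀ a b c v → a + - v * b + v * (b + - v * c) ≡ a + - (v * v * c)
    lem = solveℤ

  balanced-odd : ∀ M v → v * v ≡ + 1 → ∀ k → balanced M v (suc (double k)) ≡ + 0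
  balanced-odd zero    v v²≡1 k       = refl
  balanced-odd (suc M) v v²≡1 zero    = trans (balanced-suc M v 1) (trans (lem (balanced M v 1) (balanced M v 0) v) (balanced-odd M v v²≡1 0))
    where
    lem : ∀ a b v → a + - v * b + v * b ≡ a
    lem = solveℤ
  balanced-odd (suc M) v v²≡1 (suc k) = trans (balanced-suc M v (suc (double (suc k)))) (trans (difference-of-squares v (balanced M v) (suc (double k)) v²≡1)
    (cong₂ (λ x y → x + - y) (balanced-odd M v v²≡1 (suc k)) (balanced-odd M v v²≡1 k)))

  balanced-even : ∀ M v → v * v ≡ + 1 → ∀ k → ∣ balanced M v (double k) ∣ ≤ choose M k
  balanced-even zero    v v²≡1 zero    = ℕₚ.≤-refl
  balanced-even zero    v v²≡1 (suc k) = z≤n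
  balanced-even (suc M) v v²≡1 zero    = subst (λ x → ∣ x ∣ ≤ 1) (sym (balanced-suc M v 0)) (balanced-even M v v²≡1 zero)
  balanced-even (suc M) v v²≡1 (suc k) = begin
    ∣ balanced (suc M) v (double (suc k)) ∣ ≡⟨ cong ∣_∣ (trans (balanced-suc M v (double (suc k))) (difference-of-squares v (balanced M v) (double k) v²≡1)) ⟩
    ∣ balanced M v (double (suc k)) + - balanced M v (double k) ∣ ≤⟨ ℤₚ.∣i+j∣≤∣i∣+∣j∣ (balanced M v (double (suc k))) _ ⟩
    ∣ balanced M v (double (suc k)) ∣ ℕ.+ ∣ - balanced M v (double k) ∣
      ≡⟨ cong (∣ balanced M v (double (suc k)) ∣ ℕ.+_) (ℤₚ.∣-i∣≡∣i∣ (balanced M v (double k))) ⟩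
    ∣ balanced M v (double (suc k)) ∣ ℕ.+ ∣ balanced M v (double k) ∣ ≤⟨ ℕₚ.+-mono-≤ (balanced-even M v v²≡1 (suc k)) (balanced-even M v v²≡1 k) ⟩
    choose M (suc k) ℕ.+ choose M k ≡⟨ ℕₚ.+-comm (choose M (suc k)) _ ⟩
    choose (suc M) (suc k) ∎
    where open ℕₚ.≤-Reasoning

  -- Being majorised coefficientwise by `(1 + z)^m` survives multiplication by `1 ± z`, at the price
  -- of one more factor `1 + z`. The cutoff `U` is there because the majorisation it starts from
  -- holds in low degrees only.
  iter-step-bound : ∀ m n v s U → ∣ v ∣ ≡ 1 → (∀ u → u ≤ U → ∣ s u ∣ ≤ choose m u) →
                    ∀ u → u ≤ U → ∣ iter n (step v) s u ∣ ≤ choose (n ℕ.+ m) u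
  iter-step-bound m zero    v s U ∣v∣≡1 h u       u≤U = h u u≤U
  iter-step-bound m (suc n) v s U ∣v∣≡1 h zero    u≤U = iter-step-bound m n v s U ∣v∣≡1 h zero u≤U
  iter-step-bound m (suc n) v s U ∣v∣≡1 h (suc u) u≤U = begin
    ∣ t (suc u) + v * t u ∣ ≤⟨ ℤₚ.∣i+j∣≤∣i∣+∣j∣ (t (suc u)) (v * t u) ⟩
    ∣ t (suc u) ∣ ℕ.+ ∣ v * t u ∣ ≡⟨ cong (∣ t (suc u) ∣ ℕ.+_) (trans (ℤₚ.abs-* v (t u)) (trans (cong (ℕ._* ∣ t u ∣) ∣v∣≡1) (ℕₚ.*-identityˡ _))) ⟩
    ∣ t (suc u) ∣ ℕ.+ ∣ t u ∣ ≤⟨ ℕₚ.+-mono-≤ (iter-step-bound m n v s U ∣v∣≡1 h (suc u) u≤U)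
                                                       (iter-step-bound m n v s U ∣v∣≡1 h u (ℕₚ.≤-trans (ℕₚ.n≤1+n u) u≤U)) ⟩
    choose (n ℕ.+ m) (suc u) ℕ.+ choose (n ℕ.+ m) u ≡⟨ ℕₚ.+-comm (choose (n ℕ.+ m) (suc u)) _ ⟩
    choose (suc (n ℕ.+ m)) (suc u) ∎
    where
    open ℕₚ.≤-Reasoning
    t = iter n (step v) s

  balanced-bound : ∀ M m v U → v * v ≡ + 1 → (∀ k → double k ≤ U → choose M k ≤ choose m (double k)) →
                   ∀ u → u ≤ U → ∣ balanced M v u ∣ ≤ choose m u
  balanced-bound M m v U v²≡1 h u u≤U with parity u
  ... | inj₁ (k , refl) = ℕₚ.≤-trans (balanced-even M v v²≡1 k) (h k u≤U)
  ... | inj₂ (k , refl) = subst (λ x → ∣ x ∣ ≤ choose m u) (sym (balanced-odd M v v²≡1 k)) z≤n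

  -- In `(1 ± z)^|P-M| (1 - z²)^min(P,M)` the second factor has `z^(2k)`-coefficient at most
  -- `choose (length xs) k`, hence is majorised by `(1 + z)^m` up to degree `U`. The first factor
  -- adds at most `D` to the exponent.
  esym-bound : ∀ {A : Set} (f : A → ℤ) xs D m U → (∀ x → IsSign (f x)) →
    (∀ k → double k ≤ U → choose (length xs) k ≤ choose m (double k)) →
    count f (+ 1) xs ≤ D ℕ.+ count f -[1+ 0 ] xs → count f -[1+ 0 ] xs ≤ D ℕ.+ count f (+ 1) xs →
    ∀ u → u ≤ U → ∣ esym f xs u ∣ ≤ choose (D ℕ.+ m) u
  esym-bound f xs D m U signs h P≤ M≤ u u≤U = subst (λ x → ∣ x ∣ ≤ choose (D ℕ.+ m) u) (sym (esym-signs f xs signs u)) (goal (ℕₚ.≤-total M P))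
    where
    P M : ℕ
    P = count f (+ 1) xs
    M = count f -[1+ 0 ] xs
    total : P ℕ.+ M ≤ length xs
    total = subst (P ℕ.+ M ≤_) (count-total f xs signs) (ℕₚ.m≤m+n _ _)
    unbalanced : ∀ a b v → v * v ≡ + 1 → ∣ v ∣ ≡ 1 → b ≤ a → a ≤ D ℕ.+ b → b ≤ length xs →
                 ∣ iter a (step v) (iter b (step (- v)) one) u ∣ ≤ choose (D ℕ.+ m) u
    unbalanced a b v v²≡1 ∣v∣≡1 b≤a a≤D+b b≤len = begin
      ∣ iter a (step v) t u ∣ ≡⟨ cong (λ z → ∣ iter z (step v) t u ∣) (sym (ℕₚ.m∸n+n≡m b≤a)) ⟩
      ∣ iter (a ∸ b ℕ.+ b) (step v) t u ∣ ≡⟨ cong ∣_∣ (iter-+ (a ∸ b) b v t u) ⟩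
      ∣ iter (a ∸ b) (step v) (balanced b v) u ∣ ≤⟨ iter-step-bound m (a ∸ b) v (balanced b v) U ∣v∣≡1
                                                               (balanced-bound b m v U v²≡1 (λ k le → ℕₚ.≤-trans (choose-mono k b≤len) (h k le))) u u≤U ⟩
      choose (a ∸ b ℕ.+ m) u ≤⟨ choose-mono u (ℕₚ.+-monoˡ-≤ m (ℕₚ.m≤n+o⇒m∸n≤o a b (subst (a ≤_) (ℕₚ.+-comm D b) a≤D+b))) ⟩
      choose (D ℕ.+ m) u ∎
      where
      open ℕₚ.≤-Reasoning
      t = iter b (step (- v)) one
    goal : M ≤ P ⊎ P ≤ M → ∣ iter P (step (+ 1)) (iter M (step -[1+ 0 ]) one) u ∣ ≤ choose (D ℕ.+ m) u
    goal (inj₁ M≤P) = unbalanced P M (+ 1) refl refl M≤P P≤ (ℕₚ.≤-trans (ℕₚ.m≤n+m M P) total)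
    goal (inj₂ P≤M) = subst (λ x → ∣ x ∣ ≤ choose (D ℕ.+ m) u) (sym (iter-iter-comm P (+ 1) M -[1+ 0 ] one u))
      (unbalanced M P -[1+ 0 ] refl refl P≤M M≤ (ℕₚ.≤-trans (ℕₚ.m≤m+n P M) total))

-- Sums over subsets and over ordered pairs of subsets.

module SubsetSums {A : Set} where

  open Binomials
  open Data.Integer using (+_; _+_; _*_; ∣_∣)

  -- With Kronecker's delta, a restriction to subsets of a given size is a factor inside a linear
  -- sum, and `δ (suc m) (suc n)` reduces to `δ m n` exactly when the recursion puts an element into
  -- the subset.
  δ : ℕ → ℕ → ℤ
  δ zero    zero    = + 1
  δ zero    (suc n) = + 0
  δ (suc m) zero    = + 0
  δ (suc m) (suc n) = δ m n

  subsetSum : List A → (List A → ℤ) → ℤ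
  subsetSum []      φ = φ []
  subsetSum (x ∷ L) φ = subsetSum L φ + subsetSum L (φ ∘ (x ∷_))

  subsetSum-cong : ∀ L {φ ψ : List A → ℤ} → (∀ T → T ⊆ L → φ T ≡ ψ T) → subsetSum L φ ≡ subsetSum L ψ
  subsetSum-cong []      h = h [] []
  subsetSum-cong (x ∷ L) h = cong₂ _+_ (subsetSum-cong L (λ T T⊆L → h T (x ∷ʳ T⊆L))) (subsetSum-cong L (λ T T⊆L → h (x ∷ T) (refl ∷ T⊆L)))

  subsetSum-0 : ∀ L {φ : List A → ℤ} → (∀ T → φ T ≡ + 0) → subsetSum L φ ≡ + 0
  subsetSum-0 []      h = h []
  subsetSum-0 (x ∷ L) h = cong₂ _+_ (subsetSum-0 L h) (subsetSum-0 L (h ∘ (x ∷_)))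

  subsetSum-+ : ∀ L (φ ψ : List A → ℤ) → subsetSum L (λ T → φ T + ψ T) ≡ subsetSum L φ + subsetSum L ψ
  subsetSum-+ []      φ ψ = refl
  subsetSum-+ (x ∷ L) φ ψ = trans (cong₂ _+_ (subsetSum-+ L φ ψ) (subsetSum-+ L (φ ∘ (x ∷_)) (ψ ∘ (x ∷_))))
    (lem (subsetSum L φ) (subsetSum L ψ) (subsetSum L (φ ∘ (x ∷_))) (subsetSum L (ψ ∘ (x ∷_))))
    where
    lem : ∀ a b c d → (a + b) + (c + d) ≡ (a + c) + (b + d)
    lem = solveℤ

  subsetSum-* : ∀ L c (φ : List A → ℤ) → subsetSum L (λ T → c * φ T) ≡ c * subsetSum L φ
  subsetSum-* []      c φ = refl
  subsetSum-* (x ∷ L) c φ = trans (cong₂ _+_ (subsetSum-* L c φ) (subsetSum-* L c (φ ∘ (x ∷_)))) (sym (ℤₚ.*-distribˡ-+ c _ _))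

  subsetSum-swap : ∀ L K (Φ : List A → List A → ℤ) →
                   subsetSum L (λ T → subsetSum K (Φ T)) ≡ subsetSum K (λ U → subsetSum L (λ T → Φ T U))
  subsetSum-swap []      K Φ = refl
  subsetSum-swap (x ∷ L) K Φ = trans (cong₂ _+_ (subsetSum-swap L K Φ) (subsetSum-swap L K (Φ ∘ (x ∷_))))
    (sym (subsetSum-+ K (λ U → subsetSum L (λ T → Φ T U)) (λ U → subsetSum L (λ T → Φ (x ∷ T) U))))

  subsetSum-empty : ∀ L (φ : List A → ℤ) → subsetSum L (λ T → δ (length T) 0 * φ T) ≡ φ []
  subsetSum-empty []      φ = ℤₚ.*-identityˡ _
  subsetSum-empty (x ∷ L) φ = trans (cong₂ _+_ (subsetSum-empty L φ) (subsetSum-0 L (λ T → ℤₚ.*-zeroˡ (φ (x ∷ T))))) (ℤₚ.+-identityʳ _)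

  subsetSum-count : ∀ L n → subsetSum L (λ T → δ (length T) n) ≡ + choose (length L) n
  subsetSum-count []      zero    = refl
  subsetSum-count []      (suc n) = refl
  subsetSum-count (x ∷ L) zero    = trans (cong₂ _+_ (subsetSum-count L 0) (subsetSum-0 L (λ _ → refl))) refl
  subsetSum-count (x ∷ L) (suc n) = trans (cong₂ _+_ (subsetSum-count L (suc n)) (subsetSum-count L n))
    (cong +_ (ℕₚ.+-comm (choose (length L) (suc n)) _))

  subsetSum-bound : ∀ L n b (φ : List A → ℤ) → (∀ T → T ⊆ L → length T ≡ n → ∣ φ T ∣ ≤ b) →
                    ∣ subsetSum L (λ T → δ (length T) n * φ T) ∣ ≤ choose (length L) n ℕ.* b
  subsetSum-bound []      zero    b φ h = ℕₚ.≤-trans (ℕₚ.≤-reflexive (cong ∣_∣ (ℤₚ.*-identityˡ (φ [])))) (ℕₚ.≤-trans (h [] [] refl) (ℕₚ.≤-reflexive (sym (ℕₚ.*-identityˡ b))))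
  subsetSum-bound []      (suc n) b φ h = ℕₚ.≤-reflexive (cong ∣_∣ (ℤₚ.*-zeroˡ (φ [])))
  subsetSum-bound (x ∷ L) zero    b φ h = subst (λ z → ∣ z ∣ ≤ 1 ℕ.* b) (sym (subsetSum-empty (x ∷ L) φ))
    (ℕₚ.≤-trans (h [] (minimum (x ∷ L)) refl) (ℕₚ.≤-reflexive (sym (ℕₚ.*-identityˡ b))))
  subsetSum-bound (x ∷ L) (suc n) b φ h = begin
    ∣ subsetSum L (λ T → δ (length T) (suc n) * φ T) + subsetSum L (λ T → δ (length T) n * φ (x ∷ T)) ∣
      ≤⟨ ℤₚ.∣i+j∣≤∣i∣+∣j∣ (subsetSum L (λ T → δ (length T) (suc n) * φ T)) _ ⟩
    ∣ subsetSum L (λ T → δ (length T) (suc n) * φ T) ∣ ℕ.+ ∣ subsetSum L (λ T → δ (length T) n * φ (x ∷ T)) ∣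
      ≤⟨ ℕₚ.+-mono-≤ (subsetSum-bound L (suc n) b φ (λ T T⊆L → h T (x ∷ʳ T⊆L)))
                     (subsetSum-bound L n b (φ ∘ (x ∷_)) (λ T T⊆L len → h (x ∷ T) (refl ∷ T⊆L) (cong suc len))) ⟩
    choose (length L) (suc n) ℕ.* b ℕ.+ choose (length L) n ℕ.* b
      ≡⟨ trans (sym (ℕₚ.*-distribʳ-+ b (choose (length L) (suc n)) (choose (length L) n))) (cong (ℕ._* b) (ℕₚ.+-comm (choose (length L) (suc n)) (choose (length L) n))) ⟩
    choose (suc (length L)) (suc n) ℕ.* b ∎
    where open ℕₚ.≤-Reasoning

  data Split : List A → List A → List A → Set where
    []    : Split [] [] []
    left  : ∀ {T U S} x → Split T U S → Split (x ∷ T) U (x ∷ S)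
    right : ∀ {T U S} x → Split T U S → Split T (x ∷ U) (x ∷ S)

  splitSum : List A → (List A → List A → ℤ) → ℤ
  splitSum []      Φ = Φ [] []
  splitSum (x ∷ S) Φ = splitSum S (λ T U → Φ T (x ∷ U)) + splitSum S (λ T U → Φ (x ∷ T) U)

  splitSum-cong : ∀ S {Φ Ψ : List A → List A → ℤ} → (∀ T U → Split T U S → Φ T U ≡ Ψ T U) → splitSum S Φ ≡ splitSum S Ψ
  splitSum-cong []      h = h [] [] []
  splitSum-cong (x ∷ S) h = cong₂ _+_ (splitSum-cong S (λ T U s → h T (x ∷ U) (right x s))) (splitSum-cong S (λ T U s → h (x ∷ T) U (left x s)))

  splitSum-* : ∀ S c (Φ : List A → List A → ℤ) → splitSum S (λ T U → c * Φ T U) ≡ c * splitSum S Φ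
  splitSum-* []      c Φ = refl
  splitSum-* (x ∷ S) c Φ = trans (cong₂ _+_ (splitSum-* S c (λ T U → Φ T (x ∷ U))) (splitSum-* S c (λ T U → Φ (x ∷ T) U))) (sym (ℤₚ.*-distribˡ-+ c _ _))

  Split-⊆ˡ : ∀ {T U S} → Split T U S → T ⊆ S
  Split-⊆ˡ []          = []
  Split-⊆ˡ (left x s)  = refl ∷ Split-⊆ˡ s
  Split-⊆ˡ (right x s) = x ∷ʳ Split-⊆ˡ s

  Split-length : ∀ {T U S} → Split T U S → length S ≡ length T ℕ.+ length U
  Split-length []          = refl
  Split-length (left x s)  = cong suc (Split-length s)
  Split-length {T} (right x s) = trans (cong suc (Split-length s)) (sym (ℕₚ.+-suc (length T) _))

  Split-All : ∀ {T U S} {P : A → Set} → Split T U S → All P S → All P T × All P U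
  Split-All []          []       = [] , []
  Split-All (left x s)  (p ∷ ps) = let ts , us = Split-All s ps in p ∷ ts , us
  Split-All (right x s) (p ∷ ps) = let ts , us = Split-All s ps in ts , p ∷ us

  Split-disjoint : ∀ {T U S} → Split T U S → Unique S → All (λ a → All (a ≢_) U) T
  Split-disjoint []          []         = []
  Split-disjoint (left x s)  (x∉S ∷ un) = proj₂ (Split-All s x∉S) ∷ Split-disjoint s un
  Split-disjoint (right x s) (x∉S ∷ un) = All.zipWith (λ { (x≢a , a∉U) → (λ a≡x → x≢a (sym a≡x)) ∷ a∉U }) (proj₁ (Split-All s x∉S) , Split-disjoint s un)

  -- An element of `L` is outside `S`, in `T`, or in `U`. Independent `T` and `U` allow a fourth
  -- choice, membership in both, and there the summand is 0 by hypothesis.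
  subsetSum-split : ∀ L (Φ : List A → List A → ℤ) → (∀ {T U x} → x ∈ T → x ∈ U → Φ T U ≡ + 0) →
                    subsetSum L (λ S → splitSum S Φ) ≡ subsetSum L (λ T → subsetSum L (Φ T))
  subsetSum-split []      Φ h = refl
  subsetSum-split (x ∷ L) Φ h = begin
    subsetSum L (λ S → splitSum S Φ) + subsetSum L (λ S → splitSum S Φʳ + splitSum S Φˡ)
      ≡⟨ cong₂ _+_ (subsetSum-split L Φ h) (trans (subsetSum-+ L (λ S → splitSum S Φʳ) (λ S → splitSum S Φˡ))
           (cong₂ _+_ (subsetSum-split L Φʳ (λ p r → h p (there r))) (subsetSum-split L Φˡ (λ p r → h (there p) r)))) ⟩
    s Φ + (s Φʳ + s Φˡ) ≡⟨ lem (s Φ) (s Φʳ) (s Φˡ) ⟩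
    s Φ + s Φʳ + (s Φˡ + + 0) ≡⟨ cong (λ z → s Φ + s Φʳ + (s Φˡ + z)) (sym (subsetSum-0 L (λ T → subsetSum-0 L (λ U → h (here refl) (here refl))))) ⟩
    s Φ + s Φʳ + (s Φˡ + s (λ T U → Φ (x ∷ T) (x ∷ U)))
      ≡⟨ sym (cong₂ _+_ (subsetSum-+ L (λ T → subsetSum L (Φ T)) _) (subsetSum-+ L (λ T → subsetSum L (Φ (x ∷ T))) _)) ⟩
    subsetSum (x ∷ L) (λ T → subsetSum (x ∷ L) (Φ T)) ∎
    where
    open ≡-Reasoning
    Φʳ Φˡ : List A → List A → ℤ
    Φʳ T U = Φ T (x ∷ U)
    Φˡ T U = Φ (x ∷ T) U
    s : (List A → List A → ℤ) → ℤ
    s Φ = subsetSum L (λ T → subsetSum L (Φ T))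
    lem : ∀ a b c → a + (b + c) ≡ a + b + (c + + 0)
    lem = solveℤ

  Π : (A → ℤ) → List A → ℤ
  Π f []       = + 1
  Π f (x ∷ xs) = f x * Π f xs

  Π-cong : ∀ {f g : A → ℤ} {xs} → All (λ x → f x ≡ g x) xs → Π f xs ≡ Π g xs
  Π-cong []         = refl
  Π-cong (eq ∷ eqs) = cong₂ _*_ eq (Π-cong eqs)

  Π-≗ : ∀ {f g : A → ℤ} xs → (∀ x → f x ≡ g x) → Π f xs ≡ Π g xs
  Π-≗ xs h = Π-cong (All.universal h xs)

  Π-* : ∀ f g xs → Π (λ x → f x * g x) xs ≡ Π f xs * Π g xs
  Π-* f g []       = refl
  Π-* f g (x ∷ xs) = trans (cong (f x * g x *_) (Π-* f g xs)) (lem (f x) (g x) (Π f xs) (Π g xs))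
    where
    lem : ∀ a b c d → a * b * (c * d) ≡ a * c * (b * d)
    lem = solveℤ

  Π-1 : ∀ xs → Π (λ _ → + 1) xs ≡ + 1
  Π-1 []       = refl
  Π-1 (x ∷ xs) = trans (ℤₚ.*-identityˡ _) (Π-1 xs)

  Π-const : ∀ c xs → Π (λ _ → c) xs ≡ c ℤ.^ length xs
  Π-const c []       = refl
  Π-const c (x ∷ xs) = cong (c *_) (Π-const c xs)

  Π-swap : ∀ (f : A → A → ℤ) xs ys → Π (λ x → Π (f x) ys) xs ≡ Π (λ y → Π (λ x → f x y) xs) ys
  Π-swap f []       ys = sym (Π-1 ys)
  Π-swap f (x ∷ xs) ys = trans (cong (Π (f x) ys *_) (Π-swap f xs ys)) (sym (Π-* (f x) (λ y → Π (λ x → f x y) xs) ys))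

  Π-0 : ∀ {f : A → ℤ} {x xs} → x ∈ xs → f x ≡ + 0 → Π f xs ≡ + 0
  Π-0 {f} {xs = x ∷ xs} (here refl) eq = trans (cong (_* Π f xs) eq) (ℤₚ.*-zeroˡ (Π f xs))
  Π-0 {f} {xs = x ∷ xs} (there x∈) eq = trans (cong (f x *_) (Π-0 {f} x∈ eq)) (ℤₚ.*-zeroʳ (f x))

  Π-Split : ∀ f {T U S} → Split T U S → Π f S ≡ Π f T * Π f U
  Π-Split f []          = refl
  Π-Split f (left {T} {U} x s) = trans (cong (f x *_) (Π-Split f s)) (sym (ℤₚ.*-assoc (f x) (Π f T) (Π f U)))
  Π-Split f (right {T} {U} x s) = trans (cong (f x *_) (Π-Split f s)) (lem (f x) (Π f T) (Π f U))
    where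
    lem : ∀ a b c → a * (b * c) ≡ b * (a * c)
    lem = solveℤ

  Π-1+ : ∀ (g : A → ℤ) S → Π (λ a → + 1 + g a) S ≡ splitSum S (λ T U → Π g T)
  Π-1+ g []      = refl
  Π-1+ g (x ∷ S) = trans (cong ((+ 1 + g x) *_) (Π-1+ g S)) (trans (lem (g x) (splitSum S (λ T U → Π g T)))
    (cong (λ z → splitSum S (λ T U → Π g T) + z) (sym (splitSum-* S (g x) (λ T U → Π g T)))))
    where
    lem : ∀ a b → (+ 1 + a) * b ≡ b + a * b
    lem = solveℤ

  subsetSum-esym : ∀ (f : A → ℤ) L u → subsetSum L (λ U → δ (length U) u * Π f U) ≡ ElementarySymmetric.esym f L u
  subsetSum-esym f []      zero    = refl
  subsetSum-esym f []      (suc u) = refl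
  subsetSum-esym f (x ∷ L) zero    = trans (cong₂ _+_ (subsetSum-esym f L 0) (subsetSum-0 L (λ U → ℤₚ.*-zeroˡ (f x * Π f U)))) (ℤₚ.+-identityʳ _)
  subsetSum-esym f (x ∷ L) (suc u) = cong₂ _+_ (subsetSum-esym f L (suc u))
    (trans (trans (subsetSum-cong L (λ U _ → lem (δ (length U) u) (f x) (Π f U))) (subsetSum-* L (f x) (λ U → δ (length U) u * Π f U)))
      (cong (f x *_) (subsetSum-esym f L u)))
    where
    lem : ∀ a b c → a * (b * c) ≡ b * (a * c)
    lem = solveℤ

  sum≤ : ℕ → (ℕ → ℤ) → ℤ
  sum≤ zero    f = f 0
  sum≤ (suc n) f = f 0 + sum≤ n (f ∘ suc)

  sum≤-cong : ∀ n {f g : ℕ → ℤ} → (∀ t → f t ≡ g t) → sum≤ n f ≡ sum≤ n g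
  sum≤-cong zero    h = h 0
  sum≤-cong (suc n) h = cong₂ _+_ (h 0) (sum≤-cong n (h ∘ suc))

  sum≤-* : ∀ n (f : ℕ → ℤ) c → sum≤ n f * c ≡ sum≤ n (λ t → f t * c)
  sum≤-* zero    f c = refl
  sum≤-* (suc n) f c = trans (ℤₚ.*-distribʳ-+ c (f 0) _) (cong (λ z → f 0 * c + z) (sum≤-* n (f ∘ suc) c))

  subsetSum-sum≤ : ∀ L n (φ : ℕ → List A → ℤ) → subsetSum L (λ T → sum≤ n (λ t → φ t T)) ≡ sum≤ n (λ t → subsetSum L (φ t))
  subsetSum-sum≤ L zero    φ = refl
  subsetSum-sum≤ L (suc n) φ = trans (subsetSum-+ L (φ 0) _) (cong (λ z → subsetSum L (φ 0) + z) (subsetSum-sum≤ L n (φ ∘ suc)))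

  δ-+ : ∀ m u n → δ (m ℕ.+ u) n ≡ sum≤ n (λ t → δ m t * δ u (n ∸ t))
  δ-+ zero    u zero    = sym (ℤₚ.*-identityˡ _)
  δ-+ zero    u (suc n) = sym (trans (cong₂ _+_ (ℤₚ.*-identityˡ (δ u (suc n))) (sum≤-0 n (λ t → ℤₚ.*-zeroˡ (δ u (n ∸ t))))) (ℤₚ.+-identityʳ _))
    where
    sum≤-0 : ∀ n {f : ℕ → ℤ} → (∀ t → f t ≡ + 0) → sum≤ n f ≡ + 0
    sum≤-0 zero    h = h 0
    sum≤-0 (suc n) h = cong₂ _+_ (h 0) (sum≤-0 n (h ∘ suc))
  δ-+ (suc m) u zero    = sym (ℤₚ.*-zeroˡ (δ u 0))
  δ-+ (suc m) u (suc n) = trans (δ-+ m u n) (sym (trans (cong (_+ sum≤ n (λ t → δ m t * δ u (n ∸ t))) (ℤₚ.*-zeroˡ (δ u (suc n)))) (ℤₚ.+-identityˡ _)))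

-- Expansion of the counting weight into character sums.

module CharacterExpansion {q : ℕ} (F : FiniteField q) (c : ℕ) (1≤c : 1 ≤ c) (q≡1+2c : q ≡ suc (c ℕ.+ c)) where

  open FiniteField F
  open Binomials
  open Series F using (-1*x≈-x; -‿inverseʳ; -‿involutive; -0#≈0#; ⁻¹-anti-homo‿-; x-y≡0⇒x≡y; 1^)
  open QuadraticCharacter F c 1≤c q≡1+2c
  open ElementarySymmetric using (IsSign; zero; plus; minus)
  open SubsetSums {Carrier}

  data IsUnit : ℤ → Set where
    plus  : IsUnit (ℤ.+ 1)
    minus : IsUnit ℤ.-[1+ 0 ]

  unit-* : ∀ {x y} → IsUnit x → IsUnit y → IsUnit (x ℤ.* y)
  unit-* plus  plus  = plus
  unit-* plus  minus = minus
  unit-* minus plus  = minus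
  unit-* minus minus = plus

  unit-square : ∀ {x} → IsUnit x → x ℤ.* x ≡ ℤ.+ 1
  unit-square plus  = refl
  unit-square minus = refl

  unit-^ : ∀ {x} → IsUnit x → ∀ n → IsUnit (x ℤ.^ n)
  unit-^ p zero    = plus
  unit-^ p (suc n) = unit-* p (unit-^ p n)

  ∣unit∣ : ∀ {x} → IsUnit x → ℤ.∣ x ∣ ≡ 1
  ∣unit∣ plus  = refl
  ∣unit∣ minus = refl

  η-sign : ∀ x → IsSign (η F x)
  η-sign x with η F x | η-view x
  ... | _ | isZero _        = zero
  ... | _ | isSquare _ _    = plus
  ... | _ | isNonsquare _ _ = minus

  η-unit : ∀ {x} → x ≢ 0# → IsUnit (η F x)
  η-unit {x} x≢0 with η F x | η-view x
  ... | _ | isZero x≡0      = contradiction x≡0 x≢0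
  ... | _ | isSquare _ _    = plus
  ... | _ | isNonsquare _ _ = minus

  η-1 : η F 1# ≡ ℤ.+ 1
  η-1 = χ≡1⇒η≡1 (0≢1 ∘ sym) (1^ c)

  σ : ℤ
  σ = η F (- 1#)

  -1≢0 : - 1# ≢ 0#
  -1≢0 eq = 0≢1 (trans (sym -0#≈0#) (trans (cong -_ (sym eq)) (-‿involutive 1#)))

  σ-unit : IsUnit σ
  σ-unit = η-unit -1≢0

  η-neg : ∀ x → η F (- x) ≡ σ ℤ.* η F x
  η-neg x = trans (cong (η F) (sym (-1*x≈-x x))) (η-* (- 1#) x)

  e : Carrier → Carrier → ℤ
  e a b = η F (a - b)

  e-swap : ∀ a b → e a b ≡ σ ℤ.* e b a
  e-swap a b = trans (cong (η F) (sym (⁻¹-anti-homo‿- b a))) (η-neg (b - a))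

  e-refl : ∀ a → e a a ≡ ℤ.+ 0
  e-refl a = trans (cong (η F) (-‿inverseʳ a)) η-0

  e-unit : ∀ {a b} → a ≢ b → IsUnit (e a b)
  e-unit a≢b = η-unit (a≢b ∘ x-y≡0⇒x≡y)

  -- `Δ` omits the factor with `b = a`. Putting 1 on the diagonal makes `η (Δ S a)` a product over
  -- all of `S`, which splits along `T` and `U`; the value 0 of `e` on the diagonal is what makes
  -- `X` vanish when `T` and `U` meet.
  e′ : Carrier → Carrier → ℤ
  e′ a b with a ≟ b
  ... | yes _ = ℤ.+ 1
  ... | no  _ = e a b

  e′-refl : ∀ a → e′ a a ≡ ℤ.+ 1
  e′-refl a with a ≟ a
  ... | yes _  = refl
  ... | no a≢a = contradiction refl a≢a

  e′-≢ : ∀ {a b} → a ≢ b → e′ a b ≡ e a b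
  e′-≢ {a} {b} a≢b with a ≟ b
  ... | yes a≡b = contradiction a≡b a≢b
  ... | no _    = refl

  e′-unit : ∀ a b → IsUnit (e′ a b)
  e′-unit a b with a ≟ b
  ... | yes _  = plus
  ... | no a≢b = e-unit a≢b

  e′-swap : ∀ {a b} → a ≢ b → e′ a b ℤ.* e′ b a ≡ σ
  e′-swap {a} {b} a≢b = begin
    e′ a b ℤ.* e′ b a ≡⟨ cong₂ ℤ._*_ (trans (e′-≢ a≢b) (e-swap a b)) (e′-≢ (a≢b ∘ sym)) ⟩
    σ ℤ.* e b a ℤ.* e b a ≡⟨ ℤₚ.*-assoc σ (e b a) (e b a) ⟩
    σ ℤ.* (e b a ℤ.* e b a) ≡⟨ cong (σ ℤ.*_) (unit-square (e-unit (a≢b ∘ sym))) ⟩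
    σ ℤ.* ℤ.+ 1 ≡⟨ ℤₚ.*-identityʳ σ ⟩
    σ ∎
    where open ≡-Reasoning

  η-Δ : ∀ S a → η F (Δ F S a) ≡ Π (e′ a) S
  η-Δ []      a = η-1
  η-Δ (b ∷ S) a with a ≟ b
  ... | yes _ = trans (η-Δ S a) (sym (ℤₚ.*-identityˡ _))
  ... | no _  = trans (η-* (a - b) _) (cong (e a b ℤ.*_) (η-Δ S a))

  Π-unit : ∀ {f : Carrier → ℤ} S → (∀ x → IsUnit (f x)) → IsUnit (Π f S)
  Π-unit []      h = plus
  Π-unit (x ∷ S) h = unit-* (h x) (Π-unit S h)

  η-Δ-unit : ∀ S a → IsUnit (η F (Δ F S a))
  η-Δ-unit S a = subst IsUnit (sym (η-Δ S a)) (Π-unit S (e′-unit a))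

  tri : ℕ → ℕ
  tri zero    = zero
  tri (suc n) = n ℕ.+ tri n

  -- Each unordered pair contributes `η(a - b) η(b - a) = η(-1)`, and there are `tri (length T)`
  -- pairs.
  Π-self : ∀ T → Unique T → Π (λ a → Π (e′ a) T) T ≡ σ ℤ.^ tri (length T)
  Π-self []      _          = refl
  Π-self (x ∷ T) (x∉T ∷ un) = begin
    e′ x x ℤ.* Π (e′ x) T ℤ.* Π (λ a → e′ a x ℤ.* Π (e′ a) T) T
      ≡⟨ cong₂ ℤ._*_ (cong (ℤ._* Π (e′ x) T) (e′-refl x)) (Π-* (λ a → e′ a x) (λ a → Π (e′ a) T) T) ⟩
    ℤ.+ 1 ℤ.* Π (e′ x) T ℤ.* (Π (λ a → e′ a x) T ℤ.* Π (λ a → Π (e′ a) T) T)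
      ≡⟨ lem (Π (e′ x) T) _ _ ⟩
    Π (e′ x) T ℤ.* Π (λ a → e′ a x) T ℤ.* Π (λ a → Π (e′ a) T) T
      ≡⟨ cong₂ ℤ._*_ (trans (sym (Π-* (e′ x) (λ a → e′ a x) T)) (trans (Π-cong (All.map e′-swap x∉T)) (Π-const σ T))) (Π-self T un) ⟩
    σ ℤ.^ length T ℤ.* σ ℤ.^ tri (length T)
      ≡⟨ sym (ℤₚ.^-distribˡ-+-* σ (length T) (tri (length T))) ⟩
    σ ℤ.^ tri (suc (length T)) ∎
    where
    open ≡-Reasoning
    lem : ∀ a b c → ℤ.+ 1 ℤ.* a ℤ.* (b ℤ.* c) ≡ a ℤ.* b ℤ.* c
    lem = solveℤ

  X : List Carrier → List Carrier → ℤ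
  X T U = Π (λ a → Π (e a) U) T

  X-swap : ∀ T U → X T U ≡ σ ℤ.^ (length T ℕ.* length U) ℤ.* X U T
  X-swap T U = begin
    Π (λ a → Π (e a) U) T
      ≡⟨ Π-≗ T (λ a → trans (Π-≗ U (e-swap a)) (trans (Π-* (λ _ → σ) (λ b → e b a) U) (cong (ℤ._* Π (λ b → e b a) U) (Π-const σ U)))) ⟩
    Π (λ a → σ ℤ.^ length U ℤ.* Π (λ b → e b a) U) T
      ≡⟨ Π-* (λ _ → σ ℤ.^ length U) (λ a → Π (λ b → e b a) U) T ⟩
    Π (λ _ → σ ℤ.^ length U) T ℤ.* Π (λ a → Π (λ b → e b a) U) T
      ≡⟨ cong₂ ℤ._*_ (trans (Π-const _ T) (trans (ℤₚ.^-*-assoc σ (length U) (length T)) (cong (σ ℤ.^_) (ℕₚ.*-comm (length U) (length T))))) (Π-swap (λ a b → e b a) T U) ⟩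
    σ ℤ.^ (length T ℕ.* length U) ℤ.* X U T ∎
    where open ≡-Reasoning

  X-meet : ∀ {T U x} → x ∈ T → x ∈ U → X T U ≡ ℤ.+ 0
  X-meet {T} {U} {x} x∈T x∈U = Π-0 {λ a → Π (e a) U} x∈T (Π-0 {e x} x∈U (e-refl x))

  κ : ℤ → ℕ → ℤ
  κ ε t = ε ℤ.^ t ℤ.* σ ℤ.^ tri t

  weight : ℤ → List Carrier → ℤ
  weight ε S = Π (λ a → ℤ.+ 1 ℤ.+ ε ℤ.* η F (Δ F S a)) S

  unique-⊆ : ∀ {S L : List Carrier} → S ⊆ L → Unique L → Unique S
  unique-⊆ []          []         = []
  unique-⊆ (y ∷ʳ p)    (_ ∷ un)   = unique-⊆ p un
  unique-⊆ (refl ∷ p)  (x∉ ∷ un)  = All-resp-⊆ p x∉ ∷ unique-⊆ p un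

  -- For `a` in `T` the factors of `η (Δ S a)` come from `T` and from `U`. The former multiply to a
  -- power of `η(-1)` that depends only on the size of `T`; the latter give `X T U`, as `T` and `U`
  -- are disjoint and the diagonal is not met.
  weight-expand : ∀ ε S → Unique S → weight ε S ≡ splitSum S (λ T U → κ ε (length T) ℤ.* X T U)
  weight-expand ε S un = trans (Π-1+ (λ a → ε ℤ.* η F (Δ F S a)) S) (splitSum-cong S term)
    where
    open ≡-Reasoning
    term : ∀ T U → Split T U S → Π (λ a → ε ℤ.* η F (Δ F S a)) T ≡ κ ε (length T) ℤ.* X T U
    term T U s = begin
      Π (λ a → ε ℤ.* η F (Δ F S a)) T
        ≡⟨ Π-≗ T (λ a → cong (ε ℤ.*_) (trans (η-Δ S a) (Π-Split (e′ a) s))) ⟩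
      Π (λ a → ε ℤ.* (Π (e′ a) T ℤ.* Π (e′ a) U)) T
        ≡⟨ trans (Π-* (λ _ → ε) _ T) (cong₂ ℤ._*_ (Π-const ε T) (Π-* (λ a → Π (e′ a) T) (λ a → Π (e′ a) U) T)) ⟩
      ε ℤ.^ length T ℤ.* (Π (λ a → Π (e′ a) T) T ℤ.* Π (λ a → Π (e′ a) U) T)
        ≡⟨ cong₂ (λ x y → ε ℤ.^ length T ℤ.* (x ℤ.* y)) (Π-self T (unique-⊆ (Split-⊆ˡ s) un))
             (Π-cong (All.map (λ a∉U → Π-cong (All.map e′-≢ a∉U)) (Split-disjoint s un))) ⟩
      ε ℤ.^ length T ℤ.* (σ ℤ.^ tri (length T) ℤ.* X T U)
        ≡⟨ sym (ℤₚ.*-assoc (ε ℤ.^ length T) _ _) ⟩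
      κ ε (length T) ℤ.* X T U ∎

  Z : ℕ → ℕ → ℤ
  Z n t = subsetSum elements (λ T → δ (length T) t ℤ.* subsetSum elements (λ U → δ (length U) (n ∸ t) ℤ.* X T U))

  δ-subst : ∀ m t (f : ℕ → ℤ) → δ m t ℤ.* f m ≡ δ m t ℤ.* f t
  δ-subst zero    zero    f = refl
  δ-subst zero    (suc t) f = trans (ℤₚ.*-zeroˡ (f 0)) (sym (ℤₚ.*-zeroˡ (f (suc t))))
  δ-subst (suc m) zero    f = trans (ℤₚ.*-zeroˡ (f (suc m))) (sym (ℤₚ.*-zeroˡ (f 0)))
  δ-subst (suc m) (suc t) f = δ-subst m t (f ∘ suc)

  weightSum : ℤ → ℕ → ℤ
  weightSum ε n = subsetSum elements (λ S → δ (length S) n ℤ.* weight ε S)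

  weightSum-expand : ∀ ε n → weightSum ε n ≡ sum≤ n (λ t → κ ε t ℤ.* Z n t)
  weightSum-expand ε n = begin
    subsetSum L (λ S → δ (length S) n ℤ.* weight ε S)
      ≡⟨ subsetSum-cong L (λ S S⊆L → trans (cong (δ (length S) n ℤ.*_) (weight-expand ε S (unique-⊆ S⊆L unique)))
           (trans (sym (splitSum-* S (δ (length S) n) (λ T U → κ ε (length T) ℤ.* X T U)))
             (splitSum-cong S (λ T U s → cong (λ m → δ m n ℤ.* (κ ε (length T) ℤ.* X T U)) (Split-length s))))) ⟩
    subsetSum L (λ S → splitSum S Φ)
      ≡⟨ subsetSum-split L Φ (λ {T} {U} x∈T x∈U → trans (cong (λ z → δ (length T ℕ.+ length U) n ℤ.* (κ ε (length T) ℤ.* z)) (X-meet x∈T x∈U))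
           (trans (cong (δ (length T ℕ.+ length U) n ℤ.*_) (ℤₚ.*-zeroʳ (κ ε (length T)))) (ℤₚ.*-zeroʳ (δ (length T ℕ.+ length U) n)))) ⟩
    subsetSum L (λ T → subsetSum L (Φ T))
      ≡⟨ subsetSum-cong L (λ T _ → subsetSum-cong L (λ U _ → expand T U)) ⟩
    subsetSum L (λ T → subsetSum L (λ U → sum≤ n (λ t → Ψ t T U)))
      ≡⟨ subsetSum-cong L (λ T _ → subsetSum-sum≤ L n (λ t → Ψ t T)) ⟩
    subsetSum L (λ T → sum≤ n (λ t → subsetSum L (Ψ t T)))
      ≡⟨ subsetSum-sum≤ L n (λ t T → subsetSum L (Ψ t T)) ⟩
    sum≤ n (λ t → subsetSum L (λ T → subsetSum L (Ψ t T)))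
      ≡⟨ sum≤-cong n (λ t → trans (subsetSum-cong L (λ T _ → trans (subsetSum-* L (κ ε t) _) (cong (κ ε t ℤ.*_) (subsetSum-* L (δ (length T) t) _))))
           (subsetSum-* L (κ ε t) _)) ⟩
    sum≤ n (λ t → κ ε t ℤ.* Z n t) ∎
    where
    open ≡-Reasoning
    L = elements
    Φ : List Carrier → List Carrier → ℤ
    Φ T U = δ (length T ℕ.+ length U) n ℤ.* (κ ε (length T) ℤ.* X T U)
    Ψ : ℕ → List Carrier → List Carrier → ℤ
    Ψ t T U = κ ε t ℤ.* (δ (length T) t ℤ.* (δ (length U) (n ∸ t) ℤ.* X T U))
    expand : ∀ T U → Φ T U ≡ sum≤ n (λ t → Ψ t T U)
    expand T U = trans (cong (ℤ._* (κ ε (length T) ℤ.* X T U)) (δ-+ (length T) (length U) n))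
      (trans (sum≤-* n (λ t → δ (length T) t ℤ.* δ (length U) (n ∸ t)) _) (sum≤-cong n term))
      where
      lem₁ : ∀ a b k x → a ℤ.* b ℤ.* (k ℤ.* x) ≡ a ℤ.* k ℤ.* (b ℤ.* x)
      lem₁ = solveℤ
      lem₂ : ∀ a k y → a ℤ.* k ℤ.* y ≡ k ℤ.* (a ℤ.* y)
      lem₂ = solveℤ
      term : ∀ t → δ (length T) t ℤ.* δ (length U) (n ∸ t) ℤ.* (κ ε (length T) ℤ.* X T U) ≡ Ψ t T U
      term t = trans (lem₁ (δ (length T) t) (δ (length U) (n ∸ t)) (κ ε (length T)) (X T U))
        (trans (cong (ℤ._* (δ (length U) (n ∸ t) ℤ.* X T U)) (δ-subst (length T) t (κ ε))) (lem₂ (δ (length T) t) (κ ε t) _))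

  Z-first : ∀ n → Z n 0 ≡ ℤ.+ choose q n
  Z-first n = trans (subsetSum-empty elements _) (trans (subsetSum-cong elements (λ U _ → ℤₚ.*-identityʳ (δ (length U) n)))
    (trans (subsetSum-count elements n) (cong (λ m → ℤ.+ choose m n) size)))

  Z-last : ∀ n → Z n n ≡ ℤ.+ choose q n
  Z-last n = trans (subsetSum-cong elements (λ T _ → trans (cong (δ (length T) n ℤ.*_)
      (trans (cong (λ m → subsetSum elements (λ U → δ (length U) m ℤ.* X T U)) (ℕₚ.n∸n≡0 n)) (trans (subsetSum-empty elements (X T)) (Π-1 T))))
      (ℤₚ.*-identityʳ (δ (length T) n))))
    (trans (subsetSum-count elements n) (cong (λ m → ℤ.+ choose m n) size))

  -- Exchanging `T` and `U` costs a factor `η(-1)` for each of the `t (n - t)` pairs. Only the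
  -- absolute value is used later, where it reduces the estimate to `t ≤ n/2`.
  Z-swap : ∀ n t → t ≤ n → Z n t ≡ σ ℤ.^ (t ℕ.* (n ∸ t)) ℤ.* Z n (n ∸ t)
  Z-swap n t t≤n = begin
    subsetSum L (λ T → δ (length T) t ℤ.* subsetSum L (λ U → δ (length U) u ℤ.* X T U))
      ≡⟨ subsetSum-cong L (λ T _ → sym (subsetSum-* L (δ (length T) t) _)) ⟩
    subsetSum L (λ T → subsetSum L (λ U → δ (length T) t ℤ.* (δ (length U) u ℤ.* X T U)))
      ≡⟨ subsetSum-swap L L _ ⟩
    subsetSum L (λ U → subsetSum L (λ T → δ (length T) t ℤ.* (δ (length U) u ℤ.* X T U)))
      ≡⟨ subsetSum-cong L (λ U _ → trans (subsetSum-cong L (λ T _ → term T U)) (trans (subsetSum-* L s _) (cong (s ℤ.*_) (subsetSum-* L (δ (length U) u) _)))) ⟩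
    subsetSum L (λ U → s ℤ.* (δ (length U) u ℤ.* subsetSum L (λ T → δ (length T) t ℤ.* X U T)))
      ≡⟨ subsetSum-* L s _ ⟩
    s ℤ.* subsetSum L (λ U → δ (length U) u ℤ.* subsetSum L (λ T → δ (length T) t ℤ.* X U T))
      ≡⟨ cong (λ m → s ℤ.* subsetSum L (λ U → δ (length U) u ℤ.* subsetSum L (λ T → δ (length T) m ℤ.* X U T))) (sym (ℕₚ.m∸[m∸n]≡n t≤n)) ⟩
    s ℤ.* Z n u ∎
    where
    open ≡-Reasoning
    L = elements
    u = n ∸ t
    s = σ ℤ.^ (t ℕ.* u)
    lem₁ : ∀ a b s x → a ℤ.* (b ℤ.* (s ℤ.* x)) ≡ b ℤ.* x ℤ.* (a ℤ.* s)
    lem₁ = solveℤ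
    lem₂ : ∀ a b s x → b ℤ.* x ℤ.* (a ℤ.* s) ≡ a ℤ.* x ℤ.* (b ℤ.* s)
    lem₂ = solveℤ
    lem₃ : ∀ a b s x → a ℤ.* x ℤ.* (b ℤ.* s) ≡ s ℤ.* (b ℤ.* (a ℤ.* x))
    lem₃ = solveℤ
    term : ∀ T U → δ (length T) t ℤ.* (δ (length U) u ℤ.* X T U) ≡ s ℤ.* (δ (length U) u ℤ.* (δ (length T) t ℤ.* X U T))
    term T U = begin
      a ℤ.* (b ℤ.* X T U) ≡⟨ cong (λ z → a ℤ.* (b ℤ.* z)) (X-swap T U) ⟩
      a ℤ.* (b ℤ.* (σ ℤ.^ (length T ℕ.* length U) ℤ.* X U T)) ≡⟨ lem₁ a b _ (X U T) ⟩
      b ℤ.* X U T ℤ.* (a ℤ.* σ ℤ.^ (length T ℕ.* length U)) ≡⟨ cong (b ℤ.* X U T ℤ.*_) (δ-subst (length T) t (λ m → σ ℤ.^ (m ℕ.* length U))) ⟩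
      b ℤ.* X U T ℤ.* (a ℤ.* σ ℤ.^ (t ℕ.* length U)) ≡⟨ lem₂ a b _ (X U T) ⟩
      a ℤ.* X U T ℤ.* (b ℤ.* σ ℤ.^ (t ℕ.* length U)) ≡⟨ cong (a ℤ.* X U T ℤ.*_) (δ-subst (length U) u (λ m → σ ℤ.^ (t ℕ.* m))) ⟩
      a ℤ.* X U T ℤ.* (b ℤ.* s) ≡⟨ lem₃ a b s (X U T) ⟩
      s ℤ.* (b ℤ.* (a ℤ.* X U T)) ∎
      where
      a = δ (length T) t
      b = δ (length U) u

  ∣Z∣-swap : ∀ n t → t ≤ n → ℤ.∣ Z n t ∣ ≡ ℤ.∣ Z n (n ∸ t) ∣
  ∣Z∣-swap n t t≤n = trans (cong ℤ.∣_∣ (Z-swap n t t≤n)) (trans (ℤₚ.abs-* (σ ℤ.^ (t ℕ.* (n ∸ t))) _)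
    (trans (cong (ℕ._* ℤ.∣ Z n (n ∸ t) ∣) (∣unit∣ (unit-^ σ-unit (t ℕ.* (n ∸ t))))) (ℕₚ.*-identityˡ _)))

-- Numerical inequalities for small n.

module Estimates where

  open Data.Nat using (_+_; _*_; _^_; _/_)
  open Binomials
  open ElementarySymmetric using (double; double≡2*)

  module Small (n q : ℕ) (1≤n : 1 ≤ n) (small : (32 * n) ^ 4 < q) where

    open ℕₚ.≤-Reasoning

    instance
      nonZero-n : NonZero n
      nonZero-n = ℕ.>-nonZero 1≤n

    -- `1048576` is `32^4`; the later size conditions compare smaller multiples of `n` and `n²` with
    -- it.
    quadratic-small : 1048576 * (n * n) < q
    quadratic-small = ℕₚ.≤-<-trans (ℕₚ.≤-trans (ℕₚ.*-monoʳ-≤ 1048576 (ℕₚ.m≤m*n (n * n) (n * n) {{ℕₚ.m*n≢0 n n}})) (ℕₚ.≤-reflexive (lem 32 n))) small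
      where
      lem : ∀ a n → a * a * a * a * (n * n * (n * n)) ≡ (a * n) * ((a * n) * ((a * n) * ((a * n) * 1)))
      lem = solveℕ

    linear-small : 1048576 * n < q
    linear-small = ℕₚ.≤-<-trans (ℕₚ.*-monoʳ-≤ 1048576 (ℕₚ.m≤m*n n n)) quadratic-small

    scaled-small : ∀ {r} → r ≤ 1048576 → r * n ≤ q
    scaled-small r≤ = ℕₚ.≤-trans (ℕₚ.*-monoˡ-≤ n r≤) (ℕₚ.<⇒≤ linear-small)

    n≤q : n ≤ q
    n≤q = subst (_≤ q) (ℕₚ.*-identityˡ n) (scaled-small (s≤s z≤n))

    product-small : ∀ {t u} → t ≤ n → u ≤ n → 2 * (t * u) ≤ q
    product-small t≤n u≤n = ℕₚ.≤-trans (ℕₚ.*-mono-≤ {2} {1048576} (s≤s (s≤s z≤n)) (ℕₚ.*-mono-≤ t≤n u≤n)) (ℕₚ.<⇒≤ quadratic-small)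

    degree-small : ∀ {c t} → q ≡ suc (c + c) → t ≤ n → 3200 * (t * t) ≤ c
    degree-small {c} {t} q≡ t≤n = ℕₚ.*-cancelˡ-≤ 2 (begin
      2 * (3200 * (t * t)) ≡⟨ sym (ℕₚ.*-assoc 2 3200 (t * t)) ⟩
      6400 * (t * t) ≤⟨ ℕₚ.*-mono-≤ {6400} {1048576} (ℕₚ.m≤m+n 6400 1042176) (ℕₚ.*-mono-≤ t≤n t≤n) ⟩
      1048576 * (n * n) ≤⟨ ℕₚ.≤-pred (subst (1048576 * (n * n) <_) q≡ quadratic-small) ⟩
      c + c ≡⟨ cong (c +_) (sym (ℕₚ.+-identityʳ c)) ⟩
      2 * c ∎)

    -- `D` bounds the imbalance between the two level sets, and `E` is the exponent of the power of
    -- `1 + z` that majorises `(1 - z²)^min(P,M)` up to degree `n`. Together they stay below `q/8`.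
    D E : ℕ
    D = (5 * q) / 64
    E = q / 64

    D+E-small : 8 * (D + E) ≤ q
    D+E-small = ℕₚ.*-cancelˡ-≤ 8 (begin
      8 * (8 * (D + E)) ≡⟨ lem D E ⟩
      D * 64 + E * 64 ≤⟨ ℕₚ.+-mono-≤ (DivMod.m/n*n≤m (5 * q) 64) (DivMod.m/n*n≤m q 64) ⟩
      5 * q + q ≡⟨ lem′ q ⟩
      6 * q ≤⟨ ℕₚ.*-monoˡ-≤ q (ℕₚ.m≤m+n 6 2) ⟩
      8 * q ∎)
      where
      lem : ∀ a b → 8 * (8 * (a + b)) ≡ a * 64 + b * 64
      lem = solveℕ
      lem′ : ∀ q → 5 * q + q ≡ 6 * q
      lem′ = solveℕ

    16384n≤E : 16384 * n ≤ E
    16384n≤E = subst (_≤ E) (trans (cong (_/ 64) (trans (ℕₚ.*-assoc 64 16384 n) (ℕₚ.*-comm 64 (16384 * n)))) (DivMod.m*n/n≡m (16384 * n) 64)) (DivMod./-monoˡ-≤ 64 (ℕₚ.<⇒≤ linear-small))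

    q≤128E : q ≤ 128 * E
    q≤128E = begin
      q ≡⟨ DivMod.m≡m%n+[m/n]*n q 64 ⟩
      q ℕ.% 64 + E * 64 ≤⟨ ℕₚ.+-monoˡ-≤ (E * 64) (ℕₚ.≤-trans (ℕₚ.<⇒≤ (DivMod.m%n<n q 64)) (ℕₚ.*-monoˡ-≤ 64 1≤E)) ⟩
      E * 64 + E * 64 ≡⟨ lem E ⟩
      128 * E ∎
      where
      1≤E : 1 ≤ E
      1≤E = ℕₚ.≤-trans 1≤n (ℕₚ.≤-trans (ℕₚ.m≤n*m n 16384) 16384n≤E)
      lem : ∀ a → a * 64 + a * 64 ≡ 128 * a
      lem = solveℕ

    -- The ratio condition of `choose-halve` sets `q` times at most `2n` against roughly `E²`. It
    -- holds because `E` is about `q/64`, while `q` exceeds `32^4 n`.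
    halving : ∀ k → double k ≤ n → choose q k ≤ choose E (double k)
    halving k 2k≤n = subst (λ z → choose q k ≤ choose E z) (sym (double≡2* k)) (choose-halve q E k condition)
      where
      Y : ℕ
      Y = E ∸ n
      E≤2Y : E ≤ 2 * Y
      E≤2Y = ℕₚ.+-cancelʳ-≤ (2 * n) E (2 * Y) (begin
        E + 2 * n ≤⟨ ℕₚ.+-monoʳ-≤ E (ℕₚ.≤-trans (ℕₚ.*-monoˡ-≤ n (ℕₚ.m≤m+n 2 16382)) 16384n≤E) ⟩
        E + E ≡⟨ cong (E +_) (sym (ℕₚ.+-identityʳ E)) ⟩
        2 * E ≡⟨ cong (2 *_) (sym (ℕₚ.m∸n+n≡m (ℕₚ.≤-trans (ℕₚ.m≤n*m n 16384) 16384n≤E))) ⟩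
        2 * (Y + n) ≡⟨ ℕₚ.*-distribˡ-+ 2 Y n ⟩
        2 * Y + 2 * n ∎)
      512n≤Y : 512 * n ≤ Y
      512n≤Y = ℕₚ.m+n≤o⇒m≤o∸n (512 * n) (ℕₚ.≤-trans (ℕₚ.≤-reflexive (ℕₚ.+-comm (512 * n) n)) (ℕₚ.≤-trans (ℕₚ.*-monoˡ-≤ n (ℕₚ.m≤m+n 513 15871)) 16384n≤E))
      condition : ∀ i → suc (2 * i) < 2 * k → q * (2 * suc (2 * i)) ≤ (E ∸ 2 * i) * (E ∸ suc (2 * i))
      condition i lt = ℕₚ.*-cancelˡ-≤ 2 (begin
        2 * (q * (2 * suc (2 * i))) ≤⟨ ℕₚ.*-monoʳ-≤ 2 (ℕₚ.*-mono-≤ q≤128E (ℕₚ.*-monoʳ-≤ 2 i≤n)) ⟩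
        2 * (128 * E * (2 * n)) ≡⟨ lem E n ⟩
        E * (512 * n) ≤⟨ ℕₚ.*-mono-≤ E≤2Y 512n≤Y ⟩
        2 * Y * Y ≡⟨ ℕₚ.*-assoc 2 Y Y ⟩
        2 * (Y * Y) ≤⟨ ℕₚ.*-monoʳ-≤ 2 (ℕₚ.*-mono-≤ (ℕₚ.∸-monoʳ-≤ E (ℕₚ.≤-trans (ℕₚ.n≤1+n _) i≤n)) (ℕₚ.∸-monoʳ-≤ E i≤n)) ⟩
        2 * ((E ∸ 2 * i) * (E ∸ suc (2 * i))) ∎)
        where
        i≤n : suc (2 * i) ≤ n
        i≤n = ℕₚ.<⇒≤ (ℕₚ.<-≤-trans lt (subst (_≤ n) (double≡2* k) 2k≤n))
        lem : ∀ a n → 2 * (128 * a * (2 * n)) ≡ a * (512 * n)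
        lem = solveℕ

    -- `P - M = 2P - q + N`. Here `2P ≤ 68q/64` leaves `4q/64`, and the zeros, `N ≤ n ≤ q/64`, bring
    -- it to `5q/64`.
    discrepancy : ∀ P M N {t} → 64 * P ≤ 34 * q → P + M + N ≡ q → N ≤ t → t ≤ n → P ≤ D + M
    discrepancy P M N bound total N≤t t≤n = ℕₚ.≤-trans (ℕₚ.m≤n+m∸n P M) (ℕₚ.≤-trans (ℕₚ.≤-reflexive (ℕₚ.+-comm M (P ∸ M))) (ℕₚ.+-monoˡ-≤ M
      (subst (_≤ D) (DivMod.m*n/n≡m (P ∸ M) 64) (DivMod./-monoˡ-≤ 64 excess))))
      where
      lem₁ : ∀ p → 64 * p + 64 * p ≡ 2 * (64 * p)
      lem₁ = solveℕ
      lem₂ : ∀ p m z → 2 * (34 * (p + m + z)) ≡ 64 * p + (64 * m + (64 * z + 4 * (p + m + z)))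
      lem₂ = solveℕ
      lem₃ : ∀ m q → 64 * m + (q + 4 * q) ≡ m * 64 + 5 * q
      lem₃ = solveℕ
      64N≤q : 64 * N ≤ q
      64N≤q = ℕₚ.≤-trans (ℕₚ.*-monoʳ-≤ 64 (ℕₚ.≤-trans N≤t t≤n)) (scaled-small (ℕₚ.m≤m+n 64 1048512))
      excess : (P ∸ M) * 64 ≤ 5 * q
      excess = subst (_≤ 5 * q) (sym (ℕₚ.*-distribʳ-∸ 64 P M)) (ℕₚ.m≤n+o⇒m∸n≤o (P * 64) (M * 64) (subst (_≤ M * 64 + 5 * q) (ℕₚ.*-comm 64 P)
        (ℕₚ.+-cancelˡ-≤ (64 * P) _ _ (begin
          64 * P + 64 * P ≡⟨ lem₁ P ⟩
          2 * (64 * P) ≤⟨ ℕₚ.*-monoʳ-≤ 2 bound ⟩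
          2 * (34 * q) ≡⟨ cong (λ z → 2 * (34 * z)) (sym total) ⟩
          2 * (34 * (P + M + N)) ≡⟨ lem₂ P M N ⟩
          64 * P + (64 * M + (64 * N + 4 * (P + M + N))) ≡⟨ cong (λ z → 64 * P + (64 * M + (64 * N + 4 * z))) total ⟩
          64 * P + (64 * M + (64 * N + 4 * q)) ≤⟨ ℕₚ.+-monoʳ-≤ (64 * P) (ℕₚ.+-monoʳ-≤ (64 * M) (ℕₚ.+-monoˡ-≤ (4 * q) 64N≤q)) ⟩
          64 * P + (64 * M + (q + 4 * q)) ≡⟨ cong (64 * P +_) (lem₃ M q) ⟩
          64 * P + (M * 64 + 5 * q) ∎))))

    -- 2^(n + ⌊n/2⌋) ≤ 8^u as n ≤ 2u.
    weighted-product : ∀ t u → t + u ≡ n → 2 * t ≤ n →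
      2 ^ n * 2 ^ (n / 2) * (choose q t * choose (D + E) u) ≤ 2 * (choose n t * choose q n)
    weighted-product t u t+u≡n 2t≤n = begin
      2 ^ n * 2 ^ (n / 2) * (choose q t * choose (D + E) u) ≤⟨ ℕₚ.*-monoˡ-≤ _ powers ⟩
      8 ^ u * (choose q t * choose (D + E) u) ≡⟨ lem (8 ^ u) (choose q t) _ ⟩
      -- The factor `8^u` is paid for by enlarging `D + E` eightfold, which still fits into `q`.
      choose q t * (8 ^ u * choose (D + E) u) ≤⟨ ℕₚ.*-monoʳ-≤ (choose q t) (ℕₚ.≤-trans (choose-dilate 7 (D + E) u) (choose-mono u D+E-small)) ⟩
      choose q t * choose q u ≤⟨ choose-product-≤ q t u (subst (_≤ q) (sym t+u≡n) n≤q) (product-small t≤n u≤n) ⟩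
      2 * (choose (t + u) t * choose q (t + u)) ≡⟨ cong (λ z → 2 * (choose z t * choose q z)) t+u≡n ⟩
      2 * (choose n t * choose q n) ∎
      where
      lem : ∀ a b c → a * (b * c) ≡ b * (a * c)
      lem = solveℕ
      t≤n : t ≤ n
      t≤n = subst (t ≤_) t+u≡n (ℕₚ.m≤m+n t u)
      u≤n : u ≤ n
      u≤n = subst (u ≤_) t+u≡n (ℕₚ.m≤n+m u t)
      n≤2u : n ≤ 2 * u
      n≤2u = ℕₚ.+-cancelˡ-≤ n n (2 * u) (begin
        n + n ≡⟨ cong (n +_) (sym (ℕₚ.+-identityʳ n)) ⟩
        2 * n ≡⟨ cong (2 *_) (sym t+u≡n) ⟩
        2 * (t + u) ≡⟨ ℕₚ.*-distribˡ-+ 2 t u ⟩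
        2 * t + 2 * u ≤⟨ ℕₚ.+-monoˡ-≤ (2 * u) 2t≤n ⟩
        n + 2 * u ∎)
      half≤u : n / 2 ≤ u
      half≤u = ℕₚ.≤-trans (DivMod./-monoˡ-≤ 2 n≤2u) (ℕₚ.≤-reflexive (trans (cong (_/ 2) (ℕₚ.*-comm 2 u)) (DivMod.m*n/n≡m u 2)))
      powers : 2 ^ n * 2 ^ (n / 2) ≤ 8 ^ u
      powers = begin
        2 ^ n * 2 ^ (n / 2) ≡⟨ sym (ℕₚ.^-distribˡ-+-* 2 n (n / 2)) ⟩
        2 ^ (n + n / 2) ≤⟨ ℕₚ.^-monoʳ-≤ 2 (ℕₚ.≤-trans (ℕₚ.+-mono-≤ n≤2u half≤u) (ℕₚ.≤-reflexive (lem′ u))) ⟩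
        2 ^ (3 * u) ≡⟨ sym (ℕₚ.^-*-assoc 2 3 u) ⟩
        8 ^ u ∎
        where
        lem′ : ∀ u → 2 * u + u ≡ 3 * u
        lem′ = solveℕ

-- Bounds for the mixed terms of the expansion.

module ErrorTerm {q : ℕ} (F : FiniteField q) (c : ℕ) (1≤c : 1 ≤ c) (q≡1+2c : q ≡ suc (c ℕ.+ c))
                 (n : ℕ) (1≤n : 1 ≤ n) (small : (32 ℕ.* n) ℕ.^ 4 < q) where

  open FiniteField F
  open Binomials
  open Series F
  open QuadraticCharacter F c 1≤c q≡1+2c
  open Stepanov F c 1≤c q≡1+2c using (Π^; level-set-bound)
  open ElementarySymmetric using (IsSign; zero; plus; minus; esym; esym-bound; count; count-total)
  open SubsetSums {Carrier}
  open CharacterExpansion F c 1≤c q≡1+2c using (-1≢0; e; e-unit; η-sign; X; Z; ∣Z∣-swap; unique-⊆; IsUnit; plus; minus)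
  open Estimates.Small n q 1≤n small
  open S using (_:+_; _:*_; _:=_)

  f : List Carrier → Carrier → ℤ
  f T w = Π (λ a → e a w) T

  sign-* : ∀ {x y} → IsSign x → IsSign y → IsSign (x ℤ.* y)
  sign-* zero  _     = zero
  sign-* plus  zero  = zero
  sign-* plus  plus  = plus
  sign-* plus  minus = minus
  sign-* minus zero  = zero
  sign-* minus plus  = minus
  sign-* minus minus = plus

  f-sign : ∀ T w → IsSign (f T w)
  f-sign []      w = plus
  f-sign (a ∷ T) w = sign-* (η-sign (a - w)) (f-sign T w)

  embed : ℤ → Carrier
  embed (ℤ.+ 0)     = 0#
  embed (ℤ.+ suc _) = 1#
  embed ℤ.-[1+ _ ]  = - 1#

  embed-* : ∀ {x y} → IsSign x → IsSign y → embed (x ℤ.* y) ≡ embed x * embed y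
  embed-* {y = y} zero  _     = trans (cong embed (ℤₚ.*-zeroˡ y)) (sym (zeroˡ (embed y)))
  embed-* plus  zero  = sym (zeroʳ _)
  embed-* plus  plus  = sym (*-identityˡ _)
  embed-* plus  minus = sym (*-identityˡ _)
  embed-* minus zero  = sym (zeroʳ _)
  embed-* minus plus  = sym (*-identityʳ _)
  embed-* minus minus = sym -1*-1

  embed-η : ∀ x → embed (η F x) ≡ χ x
  embed-η x with η F x | η-view x
  ... | _ | isZero refl       = sym (0^ 1≤c)
  ... | _ | isSquare _ eq     = sym eq
  ... | _ | isNonsquare _ eq  = sym eq

  -- Stepanov's product uses `w - a` and the character sum `a - w`. The discrepancy is one `χ(-1)`
  -- per element of `T`, constant in `w`, so both have the same level sets.
  Π^-value : ∀ T w → Π^ c T w ≡ χ (- 1#) ^ length T * embed (f T w)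
  Π^-value []      w = sym (*-identityˡ 1#)
  Π^-value (a ∷ T) w = begin
    (w - a) ^ c * Π^ c T w
      ≡⟨ cong₂ _*_ (trans (cong χ flip) (trans (χ-* (- 1#) (a - w)) (cong (χ (- 1#) *_) (sym (embed-η (a - w)))))) (Π^-value T w) ⟩
    χ (- 1#) * embed (e a w) * (χ (- 1#) ^ length T * embed (f T w))
      ≡⟨ S.solve 4 (λ a b c d → a :* b :* (c :* d) := a :* c :* (b :* d)) refl (χ (- 1#)) (embed (e a w)) (χ (- 1#) ^ length T) (embed (f T w)) ⟩
    χ (- 1#) ^ suc (length T) * (embed (e a w) * embed (f T w))
      ≡⟨ cong (χ (- 1#) ^ suc (length T) *_) (sym (embed-* (η-sign (a - w)) (f-sign T w))) ⟩
    χ (- 1#) ^ suc (length T) * embed (f (a ∷ T) w) ∎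
    where
    open ≡-Reasoning
    flip : w - a ≡ - 1# * (a - w)
    flip = trans (sym (⁻¹-anti-homo‿- a w)) (sym (-1*x≈-x (a - w)))

  level-set : ∀ T v → IsUnit v → 1 ≤ length T → length T ≤ n → Unique T → 64 ℕ.* count (f T) v elements ≤ 34 ℕ.* q
  level-set T v v-unit 1≤T T≤n un = level-set-bound T (filter (λ w → f T w ℤ.≟ v) elements) (χ (- 1#) ^ length T * embed v) 1≤T un
    (Unique.filter⁺ (λ w → f T w ℤ.≟ v) unique) (*-≢0 (^-≢0 (length T) (^-≢0 c -1≢0)) (embed-≢0 v-unit))
    (λ w w∈ → trans (Π^-value T w) (cong (λ z → χ (- 1#) ^ length T * embed z) (proj₂ (∈-filter⁻ (λ w → f T w ℤ.≟ v) {xs = elements} w∈))))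
    (degree-small q≡1+2c T≤n)
    where
    embed-≢0 : ∀ {v} → IsUnit v → embed v ≢ 0#
    embed-≢0 plus  = 0≢1 ∘ sym
    embed-≢0 minus = -1≢0

  length-≤ : ∀ {xs ys : List Carrier} → Unique xs → (∀ {x} → x ∈ xs → x ∈ ys) → length xs ≤ length ys
  length-≤ {[]}     un         h = z≤n
  length-≤ {x ∷ xs} {ys} (x∉xs ∷ un) h with ∈-∃++ (h (here refl))
  ... | ys₁ , ys₂ , refl = ℕₚ.≤-trans (s≤s (length-≤ un rest)) (ℕₚ.≤-reflexive (begin
      suc (length (ys₁ ++ ys₂)) ≡⟨ cong suc (length-++ ys₁) ⟩
      suc (length ys₁ ℕ.+ length ys₂) ≡⟨ sym (ℕₚ.+-suc (length ys₁) (length ys₂)) ⟩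
      length ys₁ ℕ.+ suc (length ys₂) ≡⟨ sym (length-++ ys₁) ⟩
      length (ys₁ ++ x ∷ ys₂) ∎))
    where
    open ≡-Reasoning
    rest : ∀ {y} → y ∈ xs → y ∈ ys₁ ++ ys₂
    rest {y} y∈ with ∈-++⁻ ys₁ (h (there y∈))
    ... | inj₁ y∈₁         = ∈-++⁺ˡ y∈₁
    ... | inj₂ (here y≡x)  = contradiction (sym y≡x) (All.lookup x∉xs y∈)
    ... | inj₂ (there y∈₂) = ∈-++⁺ʳ ys₁ y∈₂

  zeros-bound : ∀ T → count (f T) (ℤ.+ 0) elements ≤ length T
  zeros-bound T = length-≤ (Unique.filter⁺ (λ w → f T w ℤ.≟ ℤ.+ 0) unique)
    (λ w∈ → root T (proj₂ (∈-filter⁻ (λ w → f T w ℤ.≟ ℤ.+ 0) {xs = elements} w∈)))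
    where
    root : ∀ T {w} → f T w ≡ ℤ.+ 0 → w ∈ T
    root (a ∷ T) {w} eq with a ≟ w
    ... | yes refl = here refl
    ... | no a≢w with ℤₚ.i*j≡0⇒i≡0∨j≡0 (e a w) eq
    ...   | inj₂ fT≡0 = there (root T fT≡0)
    ...   | inj₁ e≡0 with e a w | e-unit a≢w
    root (a ∷ T) {w} eq | no a≢w | inj₁ () | _ | plus
    root (a ∷ T) {w} eq | no a≢w | inj₁ () | _ | minus

  inner-bound : ∀ T u → 1 ≤ length T → length T ≤ n → Unique T → u ≤ n →
    ℤ.∣ subsetSum elements (λ U → δ (length U) u ℤ.* X T U) ∣ ≤ choose (D ℕ.+ E) u
  inner-bound T u 1≤T T≤n un u≤n = subst (λ z → ℤ.∣ z ∣ ≤ choose (D ℕ.+ E) u) (sym inner)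
    (esym-bound (f T) elements D E n (f-sign T) (λ k 2k≤n → subst (λ m → choose m k ≤ _) (sym size) (halving k 2k≤n))
      (discrepancy P M N (level-set T _ plus 1≤T T≤n un) total (zeros-bound T) T≤n)
      (discrepancy M P N (level-set T _ minus 1≤T T≤n un) (trans (cong (ℕ._+ N) (ℕₚ.+-comm M P)) total) (zeros-bound T) T≤n)
      u u≤n)
    where
    P M N : ℕ
    P = count (f T) (ℤ.+ 1) elements
    M = count (f T) ℤ.-[1+ 0 ] elements
    N = count (f T) (ℤ.+ 0) elements
    total : P ℕ.+ M ℕ.+ N ≡ q
    total = trans (count-total (f T) elements (f-sign T)) size
    inner : subsetSum elements (λ U → δ (length U) u ℤ.* X T U) ≡ esym (f T) elements u
    inner = trans (subsetSum-cong elements (λ U _ → cong (δ (length U) u ℤ.*_) (Π-swap e T U))) (subsetSum-esym (f T) elements u)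

  Z-bound : ∀ t → 1 ≤ t → t ≤ n → ℤ.∣ Z n t ∣ ≤ choose q t ℕ.* choose (D ℕ.+ E) (n ∸ t)
  Z-bound t 1≤t t≤n = subst (λ m → ℤ.∣ Z n t ∣ ≤ choose m t ℕ.* choose (D ℕ.+ E) (n ∸ t)) size
    (subsetSum-bound elements t _ _ (λ { T T⊆ refl → inner-bound T (n ∸ length T) 1≤t t≤n (unique-⊆ T⊆ unique) (ℕₚ.m∸n≤m n (length T)) }))

  -- The scaling is chosen for the sum over `t`: the `choose n t` add up to at most `2^n`, which the
  -- first factor cancels, and `2^(n/2)` is kept.
  Z-weighted : ∀ t → 1 ≤ t → t < n → 2 ℕ.^ n ℕ.* 2 ℕ.^ (n ℕ./ 2) ℕ.* ℤ.∣ Z n t ∣ ≤ 2 ℕ.* (choose n t ℕ.* choose q n)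
  Z-weighted t 1≤t t<n with ℕₚ.≤-total (2 ℕ.* t) n
  ... | inj₁ 2t≤n = ℕₚ.≤-trans (ℕₚ.*-monoʳ-≤ (2 ℕ.^ n ℕ.* 2 ℕ.^ (n ℕ./ 2)) (Z-bound t 1≤t (ℕₚ.<⇒≤ t<n))) (weighted-product t (n ∸ t) (ℕₚ.m+[n∸m]≡n (ℕₚ.<⇒≤ t<n)) 2t≤n)
  ... | inj₂ n≤2t = ℕₚ.≤-trans (ℕₚ.*-monoʳ-≤ (2 ℕ.^ n ℕ.* 2 ℕ.^ (n ℕ./ 2)) (ℕₚ.≤-trans (ℕₚ.≤-reflexive (∣Z∣-swap n t t≤n)) (Z-bound u 1≤u (ℕₚ.m∸n≤m n t))))
      (ℕₚ.≤-trans (weighted-product u (n ∸ u) (ℕₚ.m+[n∸m]≡n (ℕₚ.m∸n≤m n t)) 2u≤n) (ℕₚ.≤-reflexive (cong (λ z → 2 ℕ.* (z ℕ.* choose q n)) symmetric)))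
    where
    t≤n : t ≤ n
    t≤n = ℕₚ.<⇒≤ t<n
    u : ℕ
    u = n ∸ t
    1≤u : 1 ≤ u
    1≤u = ℕₚ.m<n⇒0<n∸m t<n
    2u≤n : 2 ℕ.* u ≤ n
    2u≤n = subst (_≤ n) (sym (ℕₚ.*-distribˡ-∸ 2 n t)) (ℕₚ.m≤n+o⇒m∸n≤o (2 ℕ.* n) (2 ℕ.* t)
      (ℕₚ.≤-trans (ℕₚ.≤-reflexive (cong (n ℕ.+_) (ℕₚ.+-identityʳ n))) (ℕₚ.+-monoˡ-≤ n n≤2t)))
    symmetric : choose n u ≡ choose n t
    symmetric = trans (choose≡C n u) (trans (sym (Comb.nCk≡nC[n∸k] t≤n)) (sym (choose≡C n t)))

-- From the sets to the weights, the sign of the last term, and the empty cases.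

module Counting {q : ℕ} (F : FiniteField q) (c : ℕ) (1≤c : 1 ≤ c) (q≡1+2c : q ≡ suc (c ℕ.+ c)) where

  open FiniteField F
  open Binomials
  open SubsetSums {Carrier}
  open CharacterExpansion F c 1≤c q≡1+2c

  indicator : Bool → ℤ
  indicator true  = ℤ.+ 1
  indicator false = ℤ.+ 0

  δ-refl : ∀ n → δ n n ≡ ℤ.+ 1
  δ-refl zero    = refl
  δ-refl (suc n) = δ-refl n

  δ-≢ : ∀ {m n} → m ≢ n → δ m n ≡ ℤ.+ 0
  δ-≢ {zero}  {zero}  m≢n = contradiction refl m≢n
  δ-≢ {zero}  {suc n} _   = refl
  δ-≢ {suc m} {zero}  _   = refl
  δ-≢ {suc m} {suc n} m≢n = δ-≢ (m≢n ∘ cong suc)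

  listSum : (List Carrier → ℤ) → List (List Carrier) → ℤ
  listSum φ = foldr (λ S s → φ S ℤ.+ s) (ℤ.+ 0)

  listSum-++ : ∀ φ xs ys → listSum φ (xs ++ ys) ≡ listSum φ xs ℤ.+ listSum φ ys
  listSum-++ φ []       ys = sym (ℤₚ.+-identityˡ _)
  listSum-++ φ (x ∷ xs) ys = trans (cong (λ z → φ x ℤ.+ z) (listSum-++ φ xs ys)) (sym (ℤₚ.+-assoc (φ x) _ _))

  listSum-map : ∀ φ (g : List Carrier → List Carrier) xs → listSum φ (map g xs) ≡ listSum (φ ∘ g) xs
  listSum-map φ g []       = refl
  listSum-map φ g (x ∷ xs) = cong (λ z → φ (g x) ℤ.+ z) (listSum-map φ g xs)

  listSum-sublists : ∀ φ L → listSum φ (sublists F L) ≡ subsetSum L φ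
  listSum-sublists φ []      = ℤₚ.+-identityʳ _
  listSum-sublists φ (x ∷ L) = trans (listSum-++ φ (sublists F L) _)
    (cong₂ ℤ._+_ (listSum-sublists φ L) (trans (listSum-map φ (x ∷_) (sublists F L)) (listSum-sublists (φ ∘ (x ∷_)) L)))

  length-filter : ∀ (p : List Carrier → Bool) {P : List Carrier → Set} (P? : ∀ S → Dec (P S)) (φ : List Carrier → ℤ) →
    (∀ S → P S → φ S ≡ ℤ.+ 1) → (∀ S → ¬ P S → φ S ≡ ℤ.+ 0) → ∀ xs →
    ℤ.+ length (filter (λ S → p S Data.Bool.≟ true) (filter P? xs)) ≡ listSum (λ S → φ S ℤ.* indicator (p S)) xs
  length-filter p P? φ φ-yes φ-no []       = refl
  length-filter p P? φ φ-yes φ-no (S ∷ xs) with P? S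
  ... | no ¬P = trans (length-filter p P? φ φ-yes φ-no xs) (sym (trans (cong (ℤ._+ listSum (λ S → φ S ℤ.* indicator (p S)) xs)
      (trans (cong (ℤ._* indicator (p S)) (φ-no S ¬P)) (ℤₚ.*-zeroˡ (indicator (p S))))) (ℤₚ.+-identityˡ _)))
  ... | yes P with p S
  ...   | true  = trans (cong ℤ.suc (length-filter p P? φ φ-yes φ-no xs)) (cong (λ z → z ℤ.* ℤ.+ 1 ℤ.+ listSum (λ S → φ S ℤ.* indicator (p S)) xs) (sym (φ-yes S P)))
  ...   | false = trans (length-filter p P? φ φ-yes φ-no xs)
                    (sym (trans (cong (ℤ._+ listSum (λ S → φ S ℤ.* indicator (p S)) xs) (ℤₚ.*-zeroʳ (φ S))) (ℤₚ.+-identityˡ _)))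

  length-subsets : ∀ (p : List Carrier → Bool) n →
    ℤ.+ length (filter (λ S → p S Data.Bool.≟ true) (nSubsets F n)) ≡ subsetSum elements (λ S → δ (length S) n ℤ.* indicator (p S))
  length-subsets p n = trans (length-filter p (λ S → length S ℕ.≟ n) (λ S → δ (length S) n)
    (λ S len → trans (cong (δ (length S)) (sym len)) (δ-refl (length S))) (λ S → δ-≢) (sublists F elements)) (listSum-sublists _ elements)

  allB-cong : ∀ {p p′ : Carrier → Bool} S → (∀ a → p a ≡ p′ a) → allB p S ≡ allB p′ S
  allB-cong []      h = refl
  allB-cong (a ∷ S) h = cong₂ _∧_ (h a) (allB-cong S h)

  allB⁺ : ∀ {p : Carrier → Bool} S → (∀ {a} → a ∈ S → p a ≡ true) → allB p S ≡ true
  allB⁺ []      h = refl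
  allB⁺ {p} (a ∷ S) h rewrite h (here refl) = allB⁺ S (h ∘ there)

  allB⁻ : ∀ {p : Carrier → Bool} S → allB p S ≡ true → ∀ {a} → a ∈ S → p a ≡ true
  allB⁻ {p} (x ∷ S) eq a∈ with p x in px
  allB⁻ {p} (x ∷ S) eq (here refl) | true = px
  allB⁻ {p} (x ∷ S) eq (there a∈)  | true = allB⁻ S eq a∈

  ≟⁻ : ∀ {x y : ℤ} → ⌊ x ℤ.≟ y ⌋ ≡ true → x ≡ y
  ≟⁻ {x} {y} eq with x ℤ.≟ y
  ... | yes x≡y = x≡y

  ≟⁺ : ∀ {x y : ℤ} → x ≡ y → ⌊ x ℤ.≟ y ⌋ ≡ true
  ≟⁺ {x} {y} x≡y with x ℤ.≟ y
  ... | yes _  = refl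
  ... | no x≢y = contradiction x≡y x≢y

  allOne : (Carrier → ℤ) → List Carrier → Bool
  allOne g S = allB (λ a → ⌊ g a ℤ.≟ ℤ.+ 1 ⌋) S

  -- Every factor `1 + g a` is 2 or 0.
  Π-indicator : ∀ (g : Carrier → ℤ) S → (∀ a → IsUnit (g a)) → Π (λ a → ℤ.+ 1 ℤ.+ g a) S ≡ indicator (allOne g S) ℤ.* ℤ.+ (2 ℕ.^ length S)
  Π-indicator g []      h = refl
  Π-indicator g (x ∷ S) h with g x | h x
  ... | _ | plus  = trans (cong (ℤ.+ 2 ℤ.*_) (Π-indicator g S h))
    (trans (lem (indicator (allOne g S)) (ℤ.+ (2 ℕ.^ length S))) (cong (indicator (allOne g S) ℤ.*_) (sym (ℤₚ.pos-* 2 (2 ℕ.^ length S)))))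
    where
    lem : ∀ a b → ℤ.+ 2 ℤ.* (a ℤ.* b) ≡ a ℤ.* (ℤ.+ 2 ℤ.* b)
    lem = solveℤ
  ... | _ | minus = trans (ℤₚ.*-zeroˡ (Π (λ a → ℤ.+ 1 ℤ.+ g a) S)) (sym (ℤₚ.*-zeroˡ (ℤ.+ (2 ℕ.^ suc (length S)))))

  weight-indicator : ∀ ε S → IsUnit ε → weight ε S ≡ indicator (allOne (λ a → ε ℤ.* η F (Δ F S a)) S) ℤ.* ℤ.+ (2 ℕ.^ length S)
  weight-indicator ε S ε-unit = Π-indicator (λ a → ε ℤ.* η F (Δ F S a)) S (λ a → unit-* ε-unit (η-Δ-unit S a))

  δ-weight : ∀ ε S n → IsUnit ε → δ (length S) n ℤ.* weight ε S ≡ δ (length S) n ℤ.* indicator (allOne (λ a → ε ℤ.* η F (Δ F S a)) S) ℤ.* ℤ.+ (2 ℕ.^ n)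
  δ-weight ε S n ε-unit = trans (cong (δ (length S) n ℤ.*_) (weight-indicator ε S ε-unit))
    (trans (δ-subst (length S) n (λ m → i ℤ.* ℤ.+ (2 ℕ.^ m))) (sym (ℤₚ.*-assoc (δ (length S) n) i (ℤ.+ (2 ℕ.^ n)))))
    where
    i = indicator (allOne (λ a → ε ℤ.* η F (Δ F S a)) S)

  length-scaled : ∀ (p : List Carrier → Bool) n → ℤ.+ (length (filter (λ S → p S Data.Bool.≟ true) (nSubsets F n)) ℕ.* 2 ℕ.^ n) ≡
    subsetSum elements (λ S → δ (length S) n ℤ.* indicator (p S) ℤ.* ℤ.+ (2 ℕ.^ n))
  length-scaled p n = begin
    ℤ.+ (length (filter (λ S → p S Data.Bool.≟ true) (nSubsets F n)) ℕ.* 2 ℕ.^ n)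
      ≡⟨ ℤₚ.pos-* (length (filter (λ S → p S Data.Bool.≟ true) (nSubsets F n))) (2 ℕ.^ n) ⟩
    ℤ.+ length (filter (λ S → p S Data.Bool.≟ true) (nSubsets F n)) ℤ.* ℤ.+ (2 ℕ.^ n)
      ≡⟨ cong (ℤ._* ℤ.+ (2 ℕ.^ n)) (length-subsets p n) ⟩
    subsetSum elements (λ S → δ (length S) n ℤ.* indicator (p S)) ℤ.* ℤ.+ (2 ℕ.^ n)
      ≡⟨ ℤₚ.*-comm _ (ℤ.+ (2 ℕ.^ n)) ⟩
    ℤ.+ (2 ℕ.^ n) ℤ.* subsetSum elements (λ S → δ (length S) n ℤ.* indicator (p S))
      ≡⟨ sym (subsetSum-* elements (ℤ.+ (2 ℕ.^ n)) _) ⟩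
    subsetSum elements (λ S → ℤ.+ (2 ℕ.^ n) ℤ.* (δ (length S) n ℤ.* indicator (p S)))
      ≡⟨ subsetSum-cong elements (λ S _ → ℤₚ.*-comm (ℤ.+ (2 ℕ.^ n)) (δ (length S) n ℤ.* indicator (p S))) ⟩
    subsetSum elements (λ S → δ (length S) n ℤ.* indicator (p S) ℤ.* ℤ.+ (2 ℕ.^ n)) ∎
    where open ≡-Reasoning

  Ω̃-count : ∀ n → ℤ.+ (length (Ω̃ F n) ℕ.* 2 ℕ.^ n) ≡ weightSum σ n
  Ω̃-count n = trans (length-scaled (allMinusSquare F) n) (subsetSum-cong elements (λ S _ →
    trans (cong (λ b → δ (length S) n ℤ.* indicator b ℤ.* ℤ.+ (2 ℕ.^ n)) (allB-cong S (λ a → cong (λ z → ⌊ z ℤ.≟ ℤ.+ 1 ⌋) (η-neg (Δ F S a)))))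
      (sym (δ-weight σ S n σ-unit))))

  -- The common value is 1 or -1, and not both since the list is nonempty. On the empty list the
  -- left side would be 1 and the right side 2.
  allEqual-indicator : ∀ (d : Carrier → ℤ) x S → (∀ a → IsUnit (d a)) → let S′ = x ∷ S in
    indicator (allB (λ a → allB (λ b → ⌊ d a ℤ.≟ d b ⌋) S′) S′) ≡
    indicator (allOne (λ a → ℤ.+ 1 ℤ.* d a) S′) ℤ.+ indicator (allOne (λ a → ℤ.-[1+ 0 ] ℤ.* d a) S′)
  allEqual-indicator d x S unit = lemma _ refl _ refl _ refl
    where
    S′ = x ∷ S
    from : ∀ ε {a} → IsUnit ε → IsUnit a → ε ℤ.* a ≡ ℤ.+ 1 → a ≡ ε
    from _ plus  plus  _ = refl
    from _ minus minus _ = refl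
    constant : ∀ ε → IsUnit ε → allOne (λ a → ε ℤ.* d a) S′ ≡ true → ∀ {a} → a ∈ S′ → d a ≡ ε
    constant ε ε-unit eq {a} a∈ = from ε ε-unit (unit a) (≟⁻ (allB⁻ S′ eq a∈))
    equal : ∀ ε → IsUnit ε → allOne (λ a → ε ℤ.* d a) S′ ≡ true → allB (λ a → allB (λ b → ⌊ d a ℤ.≟ d b ⌋) S′) S′ ≡ true
    equal ε ε-unit eq = allB⁺ S′ (λ a∈ → allB⁺ S′ (λ b∈ → ≟⁺ (trans (constant ε ε-unit eq a∈) (sym (constant ε ε-unit eq b∈)))))
    lemma : ∀ i → i ≡ allB (λ a → allB (λ b → ⌊ d a ℤ.≟ d b ⌋) S′) S′ →
            ∀ j → j ≡ allOne (λ a → ℤ.+ 1 ℤ.* d a) S′ → ∀ k → k ≡ allOne (λ a → ℤ.-[1+ 0 ] ℤ.* d a) S′ →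
            indicator i ≡ indicator j ℤ.+ indicator k
    lemma i eqᵢ true  eqⱼ true  eqₖ with trans (sym (constant (ℤ.+ 1) plus (sym eqⱼ) (here refl))) (constant ℤ.-[1+ 0 ] minus (sym eqₖ) (here refl))
    ... | ()
    lemma i eqᵢ true  eqⱼ false eqₖ = cong indicator (trans eqᵢ (equal (ℤ.+ 1) plus (sym eqⱼ)))
    lemma i eqᵢ false eqⱼ true  eqₖ = cong indicator (trans eqᵢ (equal ℤ.-[1+ 0 ] minus (sym eqₖ)))
    lemma false eqᵢ false eqⱼ false eqₖ = refl
    lemma true  eqᵢ false eqⱼ false eqₖ = contradict (unit-cases (unit x))
      where
      same : ∀ {b} → b ∈ S′ → d x ≡ d b
      same b∈ = ≟⁻ (allB⁻ S′ (allB⁻ S′ (sym eqᵢ) (here refl)) b∈)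
      unit-cases : ∀ {y} → IsUnit y → y ≡ ℤ.+ 1 ⊎ y ≡ ℤ.-[1+ 0 ]
      unit-cases plus  = inj₁ refl
      unit-cases minus = inj₂ refl
      contradict : d x ≡ ℤ.+ 1 ⊎ d x ≡ ℤ.-[1+ 0 ] → indicator true ≡ ℤ.+ 0
      contradict (inj₁ dx) = contradiction (trans eqⱼ (allB⁺ {λ a → ⌊ ℤ.+ 1 ℤ.* d a ℤ.≟ ℤ.+ 1 ⌋} S′ (λ b∈ → ≟⁺ (cong (ℤ.+ 1 ℤ.*_) (trans (sym (same b∈)) dx))))) λ ()
      contradict (inj₂ dx) = contradiction (trans eqₖ (allB⁺ {λ a → ⌊ ℤ.-[1+ 0 ] ℤ.* d a ℤ.≟ ℤ.+ 1 ⌋} S′ (λ b∈ → ≟⁺ (cong (ℤ.-[1+ 0 ] ℤ.*_) (trans (sym (same b∈)) dx))))) λ ()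

  Ω-count : ∀ n → 1 ≤ n → ℤ.+ (length (Ω F n) ℕ.* 2 ℕ.^ n) ≡ weightSum (ℤ.+ 1) n ℤ.+ weightSum ℤ.-[1+ 0 ] n
  Ω-count n 1≤n = trans (length-scaled (allEqualη F) n) (trans (subsetSum-cong elements (λ S _ → term S 1≤n)) (subsetSum-+ elements _ _))
    where
    lem : ∀ a i j p → a ℤ.* (i ℤ.+ j) ℤ.* p ≡ a ℤ.* i ℤ.* p ℤ.+ a ℤ.* j ℤ.* p
    lem = solveℤ
    term : ∀ S {n} → 1 ≤ n → δ (length S) n ℤ.* indicator (allEqualη F S) ℤ.* ℤ.+ (2 ℕ.^ n) ≡
                      δ (length S) n ℤ.* weight (ℤ.+ 1) S ℤ.+ δ (length S) n ℤ.* weight ℤ.-[1+ 0 ] S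
    term []      (s≤s _) = refl
    term (x ∷ S) {n} _   = trans (cong (λ z → δ (suc (length S)) n ℤ.* z ℤ.* ℤ.+ (2 ℕ.^ n)) (allEqual-indicator (λ a → η F (Δ F (x ∷ S) a)) x S (η-Δ-unit (x ∷ S))))
      (trans (lem (δ (suc (length S)) n) _ _ (ℤ.+ (2 ℕ.^ n))) (sym (cong₂ ℤ._+_ (δ-weight (ℤ.+ 1) (x ∷ S) n plus) (δ-weight ℤ.-[1+ 0 ] (x ∷ S) n minus))))

  periodic : ∀ p (g : ℕ → ℤ) → (∀ m → g (p ℕ.+ m) ≡ g m) → ∀ r k → g (r ℕ.+ k ℕ.* p) ≡ g r
  periodic p g h r zero    = cong g (ℕₚ.+-identityʳ r)
  periodic p g h r (suc k) = trans (cong g (lem r p (k ℕ.* p))) (trans (h (r ℕ.+ k ℕ.* p)) (periodic p g h r k))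
    where
    lem : ∀ r p s → r ℕ.+ (p ℕ.+ s) ≡ p ℕ.+ (r ℕ.+ s)
    lem = solveℕ

  periodic-% : ∀ p .{{_ : NonZero p}} (g : ℕ → ℤ) → (∀ m → g (p ℕ.+ m) ≡ g m) → ∀ n {r} → n ℕ.% p ≡ r → g n ≡ g r
  periodic-% p g h n refl = trans (cong g (DivMod.m≡m%n+[m/n]*n n p)) (periodic p g h (n ℕ.% p) (n ℕ./ p))

  unit-^-2+ : ∀ {ε} → IsUnit ε → ∀ m → ε ℤ.^ (2 ℕ.+ m) ≡ ε ℤ.^ m
  unit-^-2+ {ε} h m = trans (sym (ℤₚ.*-assoc ε ε (ε ℤ.^ m))) (trans (cong (ℤ._* ε ℤ.^ m) (unit-square h)) (ℤₚ.*-identityˡ _))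

  unit-^-even : ∀ {ε} → IsUnit ε → ∀ m → ε ℤ.^ (m ℕ.* 2) ≡ ℤ.+ 1
  unit-^-even {ε} h m = periodic 2 (ε ℤ.^_) (unit-^-2+ h) 0 m

  -- `tri (4 + m) - tri m = 4m + 6` is even.
  unit-^-tri : ∀ {ε} → IsUnit ε → ∀ m → ε ℤ.^ tri (4 ℕ.+ m) ≡ ε ℤ.^ tri m
  unit-^-tri {ε} h m = trans (cong (ε ℤ.^_) (lem m (tri m))) (trans (ℤₚ.^-distribˡ-+-* ε ((3 ℕ.+ m ℕ.* 2) ℕ.* 2) (tri m))
    (trans (cong (ℤ._* ε ℤ.^ tri m) (unit-^-even h (3 ℕ.+ m ℕ.* 2))) (ℤₚ.*-identityˡ _)))
    where
    lem : ∀ m t → 3 ℕ.+ m ℕ.+ (2 ℕ.+ m ℕ.+ (1 ℕ.+ m ℕ.+ (m ℕ.+ t))) ≡ (3 ℕ.+ m ℕ.* 2) ℕ.* 2 ℕ.+ t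
    lem = solveℕ

  -- The parities of `n` and `n(n-1)/2` depend on `n` mod 4 only, so the sign of the last term can
  -- be read off at a residue.
  κ-4+ : ∀ {ε} → IsUnit ε → ∀ m → κ ε (4 ℕ.+ m) ≡ κ ε m
  κ-4+ h m = cong₂ ℤ._*_ (trans (unit-^-2+ h (2 ℕ.+ m)) (unit-^-2+ h m)) (unit-^-tri σ-unit m)

  κ-0mod4 : ∀ {ε} n → IsUnit ε → n ℕ.% 4 ≡ 0 → κ ε n ≡ ℤ.+ 1
  κ-0mod4 {ε} n h = periodic-% 4 (κ ε) (κ-4+ h) n

  κσ-3mod4 : ∀ n → n ℕ.% 4 ≡ 3 → κ σ n ≡ ℤ.+ 1
  κσ-3mod4 n n%4≡3 = trans (periodic-% 4 (κ σ) (κ-4+ σ-unit) n n%4≡3) (unit-square (unit-^ σ-unit 3))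

  κ-even : σ ≡ ℤ.+ 1 → ∀ {ε} n → IsUnit ε → n ℕ.% 2 ≡ 0 → κ ε n ≡ ℤ.+ 1
  κ-even σ≡1 {ε} n h n%2≡0 = cong₂ ℤ._*_ (periodic-% 2 (ε ℤ.^_) (unit-^-2+ h) n n%2≡0) (trans (cong (ℤ._^ tri n) σ≡1) (ℤₚ.^-zeroˡ (tri n)))

  κσ-1 : σ ≡ ℤ.+ 1 → ∀ n → κ σ n ≡ ℤ.+ 1
  κσ-1 σ≡1 n = trans (cong₂ (λ x y → x ℤ.^ n ℤ.* y ℤ.^ tri n) σ≡1 σ≡1) (cong₂ ℤ._*_ (ℤₚ.^-zeroˡ n) (ℤₚ.^-zeroˡ (tri n)))

  Π-η-Δ : ∀ S → Unique S → Π (λ a → η F (Δ F S a)) S ≡ σ ℤ.^ tri (length S)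
  Π-η-Δ S un = trans (Π-≗ S (η-Δ S)) (Π-self S un)

  ∈-sublists : ∀ {S} L → S ∈ sublists F L → S ⊆ L
  ∈-sublists []      (here refl) = []
  ∈-sublists (x ∷ L) S∈ with ∈-++⁻ (sublists F L) S∈
  ... | inj₁ S∈L = x ∷ʳ ∈-sublists L S∈L
  ... | inj₂ S∈xL with ∈-map⁻ (x ∷_) S∈xL
  ...   | T , T∈L , refl = refl ∷ ∈-sublists L T∈L

  filter-subsets-empty : ∀ (p : List Carrier → Bool) n → (∀ S → Unique S → length S ≡ n → p S ≡ true → ⊥) →
                         filter (λ S → p S Data.Bool.≟ true) (nSubsets F n) ≡ []
  filter-subsets-empty p n h = filter-none (λ S → p S Data.Bool.≟ true) (All.tabulate λ {S} S∈ pS →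
    let S∈′ , len = ∈-filter⁻ (λ S → length S ℕ.≟ n) {xs = sublists F elements} S∈
    in  h S (unique-⊆ (∈-sublists elements S∈′) unique) len pS)

  -- If the `n` values agree, their product is an even power of a sign, hence 1. It is also
  -- `η(-1)^(n(n-1)/2)`, whose exponent is odd for `n ≡ 2` mod 4.
  Ω-empty : σ ≡ ℤ.-[1+ 0 ] → ∀ n → n ℕ.% 4 ≡ 2 → Ω F n ≡ []
  Ω-empty σ≡-1 n n%4≡2 = filter-subsets-empty (allEqualη F) n contradict
    where
    contradict : ∀ S → Unique S → length S ≡ n → allEqualη F S ≡ true → ⊥
    contradict []      un refl eq = contradiction n%4≡2 λ ()
    contradict (x ∷ S) un refl eq = contradiction (begin
      ℤ.+ 1 ≡⟨ sym (trans (periodic-% 4 (η F (Δ F (x ∷ S) x) ℤ.^_) power-4+ n n%4≡2) (unit-^-even h 1)) ⟩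
      η F (Δ F (x ∷ S) x) ℤ.^ n ≡⟨ sym (Π-const (η F (Δ F (x ∷ S) x)) (x ∷ S)) ⟩
      Π (λ _ → η F (Δ F (x ∷ S) x)) (x ∷ S) ≡⟨ Π-cong (All.tabulate (λ a∈ → ≟⁻ (allB⁻ (x ∷ S) (allB⁻ (x ∷ S) eq (here refl)) a∈))) ⟩
      Π (λ a → η F (Δ F (x ∷ S) a)) (x ∷ S) ≡⟨ Π-η-Δ (x ∷ S) un ⟩
      σ ℤ.^ tri n ≡⟨ periodic-% 4 (λ m → σ ℤ.^ tri m) (unit-^-tri σ-unit) n n%4≡2 ⟩
      σ ℤ.* ℤ.+ 1 ≡⟨ cong (ℤ._* ℤ.+ 1) σ≡-1 ⟩
      ℤ.-[1+ 0 ] ∎) λ ()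
      where
      open ≡-Reasoning
      h = η-Δ-unit (x ∷ S) x
      power-4+ : ∀ m → η F (Δ F (x ∷ S) x) ℤ.^ (4 ℕ.+ m) ≡ η F (Δ F (x ∷ S) x) ℤ.^ m
      power-4+ m = trans (unit-^-2+ h (2 ℕ.+ m)) (unit-^-2+ h m)

  -- The product of all `η(-Δ)` is `η(-1)` to the power `n + n(n-1)/2`, which is odd for `n ≡ 1` mod
  -- 4, while each of the values should be 1.
  Ω̃-empty : σ ≡ ℤ.-[1+ 0 ] → ∀ n → n ℕ.% 4 ≡ 1 → Ω̃ F n ≡ []
  Ω̃-empty σ≡-1 n n%4≡1 = filter-subsets-empty (allMinusSquare F) n contradict
    where
    contradict : ∀ S → Unique S → length S ≡ n → allMinusSquare F S ≡ true → ⊥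
    contradict S un refl eq = contradiction (begin
      ℤ.+ 1 ≡⟨ sym (Π-1 S) ⟩
      Π (λ _ → ℤ.+ 1) S ≡⟨ Π-cong (All.tabulate (λ {a} a∈ → trans (sym (≟⁻ (allB⁻ S eq a∈))) (η-neg (Δ F S a)))) ⟩
      Π (λ a → σ ℤ.* η F (Δ F S a)) S ≡⟨ Π-* (λ _ → σ) (λ a → η F (Δ F S a)) S ⟩
      Π (λ _ → σ) S ℤ.* Π (λ a → η F (Δ F S a)) S ≡⟨ cong₂ ℤ._*_ (Π-const σ S) (Π-η-Δ S un) ⟩
      κ σ n ≡⟨ periodic-% 4 (κ σ) (κ-4+ σ-unit) n n%4≡1 ⟩
      σ ℤ.* ℤ.+ 1 ℤ.* ℤ.+ 1 ≡⟨ cong (λ z → z ℤ.* ℤ.+ 1 ℤ.* ℤ.+ 1) σ≡-1 ⟩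
      ℤ.-[1+ 0 ] ∎) λ ()
      where open ≡-Reasoning

-- Main term and relative error.

module MainEstimate {q : ℕ} (F : FiniteField q) (c : ℕ) (1≤c : 1 ≤ c) (q≡1+2c : q ≡ suc (c ℕ.+ c)) where

  open FiniteField F using (Carrier)
  open Binomials
  open SubsetSums {Carrier}
  open CharacterExpansion F c 1≤c q≡1+2c
  open Counting F c 1≤c q≡1+2c

  sum< : ℕ → (ℕ → ℤ) → ℤ
  sum< zero    g = ℤ.+ 0
  sum< (suc n) g = g 0 ℤ.+ sum< n (g ∘ suc)

  sumℕ< : ℕ → (ℕ → ℕ) → ℕ
  sumℕ< zero    g = 0
  sumℕ< (suc n) g = g 0 ℕ.+ sumℕ< n (g ∘ suc)

  sum≤-last : ∀ n g → sum≤ n g ≡ sum< n g ℤ.+ g n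
  sum≤-last zero    g = sym (ℤₚ.+-identityˡ (g 0))
  sum≤-last (suc n) g = trans (cong (λ z → g 0 ℤ.+ z) (sum≤-last n (g ∘ suc))) (sym (ℤₚ.+-assoc (g 0) _ _))

  sum<-bound : ∀ K b m (g : ℕ → ℤ) (h : ℕ → ℕ) → (∀ t → t < m → K ℕ.* ℤ.∣ g t ∣ ≤ b ℕ.* h t) → K ℕ.* ℤ.∣ sum< m g ∣ ≤ b ℕ.* sumℕ< m h
  sum<-bound K b zero    g h le = ℕₚ.≤-reflexive (trans (ℕₚ.*-zeroʳ K) (sym (ℕₚ.*-zeroʳ b)))
  sum<-bound K b (suc m) g h le = begin
    K ℕ.* ℤ.∣ g 0 ℤ.+ sum< m (g ∘ suc) ∣ ≤⟨ ℕₚ.*-monoʳ-≤ K (ℤₚ.∣i+j∣≤∣i∣+∣j∣ (g 0) (sum< m (g ∘ suc))) ⟩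
    K ℕ.* (ℤ.∣ g 0 ∣ ℕ.+ ℤ.∣ sum< m (g ∘ suc) ∣) ≡⟨ ℕₚ.*-distribˡ-+ K ℤ.∣ g 0 ∣ _ ⟩
    K ℕ.* ℤ.∣ g 0 ∣ ℕ.+ K ℕ.* ℤ.∣ sum< m (g ∘ suc) ∣ ≤⟨ ℕₚ.+-mono-≤ (le 0 (s≤s z≤n)) (sum<-bound K b m (g ∘ suc) (h ∘ suc) (λ t t<m → le (suc t) (s≤s t<m))) ⟩
    b ℕ.* h 0 ℕ.+ b ℕ.* sumℕ< m (h ∘ suc) ≡⟨ sym (ℕₚ.*-distribˡ-+ b (h 0) _) ⟩
    b ℕ.* sumℕ< (suc m) h ∎
    where open ℕₚ.≤-Reasoning

  sumℕ<-+ : ∀ m g h → sumℕ< m (λ t → g t ℕ.+ h t) ≡ sumℕ< m g ℕ.+ sumℕ< m h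
  sumℕ<-+ zero    g h = refl
  sumℕ<-+ (suc m) g h = trans (cong (g 0 ℕ.+ h 0 ℕ.+_) (sumℕ<-+ m (g ∘ suc) (h ∘ suc))) (lem (g 0) (h 0) _ _)
    where
    lem : ∀ a b c d → (a ℕ.+ b) ℕ.+ (c ℕ.+ d) ≡ (a ℕ.+ c) ℕ.+ (b ℕ.+ d)
    lem = solveℕ

  sumℕ<-choose : ∀ n m → sumℕ< m (choose n) ≤ 2 ℕ.^ n
  sumℕ<-choose n       zero    = z≤n
  sumℕ<-choose zero    (suc m) = s≤s (ℕₚ.≤-reflexive (zeros m))
    where
    zeros : ∀ m → sumℕ< m (λ t → choose 0 (suc t)) ≡ 0
    zeros zero    = refl
    zeros (suc m) = zeros m
  sumℕ<-choose (suc n) (suc m) = begin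
    1 ℕ.+ sumℕ< m (λ t → choose n t ℕ.+ choose n (suc t)) ≡⟨ cong (1 ℕ.+_) (sumℕ<-+ m (choose n) (choose n ∘ suc)) ⟩
    1 ℕ.+ (sumℕ< m (choose n) ℕ.+ sumℕ< m (choose n ∘ suc)) ≡⟨ sym (ℕₚ.+-suc (sumℕ< m (choose n)) _) ⟩
    sumℕ< m (choose n) ℕ.+ sumℕ< (suc m) (choose n) ≤⟨ ℕₚ.+-mono-≤ (sumℕ<-choose n m) (sumℕ<-choose n (suc m)) ⟩
    2 ℕ.^ n ℕ.+ 2 ℕ.^ n ≡⟨ cong (2 ℕ.^ n ℕ.+_) (sym (ℕₚ.+-identityʳ (2 ℕ.^ n))) ⟩
    2 ℕ.^ suc n ∎
    where open ℕₚ.≤-Reasoning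

  module _ (n : ℕ) (small : (32 ℕ.* suc n) ℕ.^ 4 < q) where

    open ErrorTerm F c 1≤c q≡1+2c (suc n) (s≤s z≤n) small using (Z-weighted)

    N : ℕ
    N = suc n

    error : ℤ → ℤ
    error ε = sum< n (λ t → κ ε (suc t) ℤ.* Z N (suc t))

    κ-unit : ∀ {ε} → IsUnit ε → ∀ t → IsUnit (κ ε t)
    κ-unit h t = unit-* (unit-^ h t) (unit-^ σ-unit (tri t))

    -- The two extreme terms are both `choose q N`, the last one with the sign `κ ε N`. The
    -- congruences on `q` and `n` serve to make this sign 1; with the sign -1 the two would cancel.
    weightSum-main : ∀ ε → κ ε N ≡ ℤ.+ 1 → weightSum ε N ≡ ℤ.+ (2 ℕ.* choose q N) ℤ.+ error ε
    weightSum-main ε κ≡1 = begin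
      weightSum ε N ≡⟨ weightSum-expand ε N ⟩
      ℤ.+ 1 ℤ.* Z N 0 ℤ.+ sum≤ n (λ t → κ ε (suc t) ℤ.* Z N (suc t)) ≡⟨ cong (λ z → ℤ.+ 1 ℤ.* Z N 0 ℤ.+ z) (sum≤-last n _) ⟩
      ℤ.+ 1 ℤ.* Z N 0 ℤ.+ (error ε ℤ.+ κ ε N ℤ.* Z N N)
        ≡⟨ cong₂ (λ x y → ℤ.+ 1 ℤ.* x ℤ.+ (error ε ℤ.+ y)) (Z-first N) (cong₂ ℤ._*_ κ≡1 (Z-last N)) ⟩
      ℤ.+ 1 ℤ.* b ℤ.+ (error ε ℤ.+ ℤ.+ 1 ℤ.* b) ≡⟨ lem b (error ε) ⟩
      ℤ.+ 2 ℤ.* b ℤ.+ error ε ≡⟨ cong (λ z → z ℤ.+ error ε) (sym (ℤₚ.pos-* 2 (choose q N))) ⟩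
      ℤ.+ (2 ℕ.* choose q N) ℤ.+ error ε ∎
      where
      open ≡-Reasoning
      b = ℤ.+ choose q N
      lem : ∀ a r → ℤ.+ 1 ℤ.* a ℤ.+ (r ℤ.+ ℤ.+ 1 ℤ.* a) ≡ ℤ.+ 2 ℤ.* a ℤ.+ r
      lem = solveℤ

    -- Summing the weighted bounds replaces `choose N t` by `2^N`, which cancels, and leaves a
    -- relative error of `2^(-N/2)`.
    error-bound : ∀ {ε} → IsUnit ε → 2 ℕ.^ (N ℕ./ 2) ℕ.* ℤ.∣ error ε ∣ ≤ 2 ℕ.* choose q N
    error-bound {ε} h = ℕₚ.*-cancelˡ-≤ (2 ℕ.^ N) {{ℕₚ.m^n≢0 2 N}} (begin
      2 ℕ.^ N ℕ.* (2 ℕ.^ (N ℕ./ 2) ℕ.* ℤ.∣ error ε ∣) ≡⟨ sym (ℕₚ.*-assoc (2 ℕ.^ N) _ _) ⟩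
      2 ℕ.^ N ℕ.* 2 ℕ.^ (N ℕ./ 2) ℕ.* ℤ.∣ error ε ∣ ≤⟨ sum<-bound K (2 ℕ.* choose q N) n _ (choose N ∘ suc) term ⟩
      -- The sum starts at `t = 1`; the missing `choose N 0 = 1` is added so that the bound for
      -- initial segments of the row applies.
      2 ℕ.* choose q N ℕ.* sumℕ< n (choose N ∘ suc) ≤⟨ ℕₚ.*-monoʳ-≤ (2 ℕ.* choose q N) (ℕₚ.≤-trans (ℕₚ.n≤1+n _) (sumℕ<-choose N (suc n))) ⟩
      2 ℕ.* choose q N ℕ.* 2 ℕ.^ N ≡⟨ ℕₚ.*-comm (2 ℕ.* choose q N) (2 ℕ.^ N) ⟩
      2 ℕ.^ N ℕ.* (2 ℕ.* choose q N) ∎)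
      where
      open ℕₚ.≤-Reasoning
      K : ℕ
      K = 2 ℕ.^ N ℕ.* 2 ℕ.^ (N ℕ./ 2)
      lem : ∀ a b → 2 ℕ.* (a ℕ.* b) ≡ 2 ℕ.* b ℕ.* a
      lem = solveℕ
      term : ∀ t → t < n → K ℕ.* ℤ.∣ κ ε (suc t) ℤ.* Z N (suc t) ∣ ≤ 2 ℕ.* choose q N ℕ.* choose N (suc t)
      term t t<n = begin
        K ℕ.* ℤ.∣ κ ε (suc t) ℤ.* Z N (suc t) ∣ ≡⟨ cong (K ℕ.*_) (trans (ℤₚ.abs-* (κ ε (suc t)) (Z N (suc t))) (trans (cong (ℕ._* ℤ.∣ Z N (suc t) ∣) (∣unit∣ (κ-unit h (suc t)))) (ℕₚ.*-identityˡ _))) ⟩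
        K ℕ.* ℤ.∣ Z N (suc t) ∣ ≤⟨ Z-weighted (suc t) (s≤s z≤n) (s≤s t<n) ⟩
        2 ℕ.* (choose N (suc t) ℕ.* choose q N) ≡⟨ lem (choose N (suc t)) (choose q N) ⟩
        2 ℕ.* choose q N ℕ.* choose N (suc t) ∎

    distance : ∀ {a b : ℕ} {r : ℤ} → ℤ.+ a ≡ ℤ.+ b ℤ.+ r → ∣ a - b ∣ ≡ ℤ.∣ r ∣
    distance {a} {b} {r} eq = trans (lemma (ℕₚ.≤-total a b)) (cong ℤ.∣_∣ (begin
      a ℤ.⊖ b ≡⟨ sym (ℤₚ.m-n≡m⊖n a b) ⟩
      ℤ.+ a ℤ.- ℤ.+ b ≡⟨ cong (ℤ._- ℤ.+ b) eq ⟩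
      ℤ.+ b ℤ.+ r ℤ.- ℤ.+ b ≡⟨ lem (ℤ.+ b) r ⟩
      r ∎))
      where
      open ≡-Reasoning
      lem : ∀ b r → b ℤ.+ r ℤ.+ ℤ.- b ≡ r
      lem = solveℤ
      lemma : a ≤ b ⊎ b ≤ a → ∣ a - b ∣ ≡ ℤ.∣ a ℤ.⊖ b ∣
      lemma (inj₁ a≤b) = trans (ℕₚ.m≤n⇒∣m-n∣≡n∸m a≤b) (sym (ℤₚ.∣⊖∣-≤ a≤b))
      lemma (inj₂ b≤a) = trans (ℕₚ.m≤n⇒∣n-m∣≡n∸m b≤a) (cong ℤ.∣_∣ (sym (ℤₚ.⊖-≥ b≤a)))

    Ω̃-estimate : κ σ N ≡ ℤ.+ 1 → 2 ℕ.^ (N ℕ./ 2) ℕ.* ∣ length (Ω̃ F N) ℕ.* 2 ℕ.^ N - 2 ℕ.* (q C N) ∣ ≤ 2 ℕ.* (q C N)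
    Ω̃-estimate κ≡1 = subst (λ z → 2 ℕ.^ (N ℕ./ 2) ℕ.* ∣ length (Ω̃ F N) ℕ.* 2 ℕ.^ N - 2 ℕ.* z ∣ ≤ 2 ℕ.* z) (choose≡C q N)
      (subst (λ z → 2 ℕ.^ (N ℕ./ 2) ℕ.* z ≤ 2 ℕ.* choose q N) (sym (distance {r = error σ} (trans (Ω̃-count N) (weightSum-main σ κ≡1)))) (error-bound σ-unit))

    -- The common value may be 1 or -1. These are two disjoint counts, each with main term
    -- `2 choose q N`, so both the main term and the error double.
    Ω-estimate : (∀ {ε} → IsUnit ε → κ ε N ≡ ℤ.+ 1) → 2 ℕ.^ (N ℕ./ 2) ℕ.* ∣ length (Ω F N) ℕ.* 2 ℕ.^ N - 4 ℕ.* (q C N) ∣ ≤ 4 ℕ.* (q C N)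
    Ω-estimate κ≡1 = subst (λ z → H ℕ.* ∣ length (Ω F N) ℕ.* 2 ℕ.^ N - 4 ℕ.* z ∣ ≤ 4 ℕ.* z) (choose≡C q N) (begin
      H ℕ.* ∣ length (Ω F N) ℕ.* 2 ℕ.^ N - 4 ℕ.* choose q N ∣ ≡⟨ cong (H ℕ.*_) (distance {r = e₁ ℤ.+ e₂} total) ⟩
      H ℕ.* ℤ.∣ e₁ ℤ.+ e₂ ∣ ≤⟨ ℕₚ.*-monoʳ-≤ H (ℤₚ.∣i+j∣≤∣i∣+∣j∣ e₁ e₂) ⟩
      H ℕ.* (ℤ.∣ e₁ ∣ ℕ.+ ℤ.∣ e₂ ∣) ≡⟨ ℕₚ.*-distribˡ-+ H ℤ.∣ e₁ ∣ ℤ.∣ e₂ ∣ ⟩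
      H ℕ.* ℤ.∣ e₁ ∣ ℕ.+ H ℕ.* ℤ.∣ e₂ ∣ ≤⟨ ℕₚ.+-mono-≤ (error-bound plus) (error-bound minus) ⟩
      2 ℕ.* choose q N ℕ.+ 2 ℕ.* choose q N ≡⟨ lem (choose q N) ⟩
      4 ℕ.* choose q N ∎)
      where
      open ℕₚ.≤-Reasoning
      H = 2 ℕ.^ (N ℕ./ 2)
      e₁ = error (ℤ.+ 1)
      e₂ = error ℤ.-[1+ 0 ]
      lem : ∀ a → 2 ℕ.* a ℕ.+ 2 ℕ.* a ≡ 4 ℕ.* a
      lem = solveℕ
      lemℤ : ∀ a x y → a ℤ.+ x ℤ.+ (a ℤ.+ y) ≡ a ℤ.+ a ℤ.+ (x ℤ.+ y)
      lemℤ = solveℤ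
      total : ℤ.+ (length (Ω F N) ℕ.* 2 ℕ.^ N) ≡ ℤ.+ (4 ℕ.* choose q N) ℤ.+ (e₁ ℤ.+ e₂)
      total = trans (Ω-count N (s≤s z≤n)) (trans (cong₂ ℤ._+_ (weightSum-main (ℤ.+ 1) (κ≡1 plus)) (weightSum-main ℤ.-[1+ 0 ] (κ≡1 minus)))
        (trans (lemℤ (ℤ.+ (2 ℕ.* choose q N)) e₁ e₂) (cong (λ z → ℤ.+ z ℤ.+ (e₁ ℤ.+ e₂)) (lem (choose q N)))))

-- The value η(-1) from q mod 4, and passage to the limit.

record HalfOrder (q : ℕ) : Set where
  field
    half : ℕ
    1≤half : 1 ≤ half
    q≡1+2half : q ≡ suc (half ℕ.+ half)
open HalfOrder

half-3mod4 : ∀ q → q ℕ.% 4 ≡ 3 → Σ (HalfOrder q) λ h → Σ ℕ λ j → half h ≡ suc (j ℕ.* 2)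
half-3mod4 q q%4≡3 = record { half = suc (j ℕ.* 2) ; 1≤half = s≤s z≤n
  ; q≡1+2half = trans (DivMod.m≡m%n+[m/n]*n q 4) (trans (cong (ℕ._+ j ℕ.* 4) q%4≡3) (lem j)) } , j , refl
  where
  j = q ℕ./ 4
  lem : ∀ j → 3 ℕ.+ j ℕ.* 4 ≡ 1 ℕ.+ (1 ℕ.+ j ℕ.* 2 ℕ.+ (1 ℕ.+ j ℕ.* 2))
  lem = solveℕ

-- `1 < q` excludes `q = 1`, which is also 1 mod 4 but has `(q - 1)/2 = 0`.
half-1mod4 : ∀ q → 1 < q → q ℕ.% 4 ≡ 1 → Σ (HalfOrder q) λ h → Σ ℕ λ j → half h ≡ j ℕ.* 2
half-1mod4 q 1<q q%4≡1 = record { half = j ℕ.* 2 ; 1≤half = positive j q≡ ; q≡1+2half = trans q≡ (lem j) } , j , refl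
  where
  j = q ℕ./ 4
  q≡ : q ≡ 1 ℕ.+ j ℕ.* 4
  q≡ = trans (DivMod.m≡m%n+[m/n]*n q 4) (cong (ℕ._+ j ℕ.* 4) q%4≡1)
  lem : ∀ j → 1 ℕ.+ j ℕ.* 4 ≡ 1 ℕ.+ (j ℕ.* 2 ℕ.+ j ℕ.* 2)
  lem = solveℕ
  positive : ∀ j → q ≡ 1 ℕ.+ j ℕ.* 4 → 1 ≤ j ℕ.* 2
  positive zero    refl = contradiction 1<q (ℕₚ.<-irrefl refl)
  positive (suc j) _    = s≤s z≤n

module MinusOne {q : ℕ} (F : FiniteField q) (c : ℕ) (1≤c : 1 ≤ c) (q≡1+2c : q ≡ suc (c ℕ.+ c)) where

  open FiniteField F
  open Series F
  open QuadraticCharacter F c 1≤c q≡1+2c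
  open CharacterExpansion F c 1≤c q≡1+2c using (σ; -1≢0)

  -1^even : ∀ j → (- 1#) ^ (j ℕ.* 2) ≡ 1#
  -1^even zero    = refl
  -1^even (suc j) = trans (sym (*-assoc (- 1#) (- 1#) _)) (trans (cong₂ _*_ -1*-1 (-1^even j)) (*-identityˡ 1#))

  σ-even : ∀ j → c ≡ j ℕ.* 2 → σ ≡ ℤ.+ 1
  σ-even j eq = χ≡1⇒η≡1 -1≢0 (trans (cong ((- 1#) ^_) eq) (-1^even j))

  σ-odd : ∀ j → c ≡ suc (j ℕ.* 2) → σ ≡ ℤ.-[1+ 0 ]
  σ-odd j eq = χ≡-1⇒η≡-1 -1≢0 (trans (cong ((- 1#) ^_) eq) (trans (cong (- 1# *_) (-1^even j)) (*-identityʳ (- 1#))))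

k≤2^k : ∀ k → k ≤ 2 ℕ.^ k
k≤2^k zero    = z≤n
k≤2^k (suc k) = ℕₚ.≤-trans (ℕₚ.+-mono-≤ (ℕₚ.m^n>0 2 k) (k≤2^k k)) (ℕₚ.≤-reflexive (cong (2 ℕ.^ k ℕ.+_) (sym (ℕₚ.+-identityʳ (2 ℕ.^ k)))))

-- As soon as `n ≥ 2k`, the relative error is at most `2^(-k)`, which is below `1/k`. The quartic
-- hypothesis is used at the single constant 32, the one required by the estimates.
ratio-tends-to-one : ∀ (P R : ℕ → Set) (n : ℕ → ℕ) (A : ∀ {q} → FiniteField q → ℕ) (B : ℕ → ℕ) → TendsToInfinity P n → QuarticSmall P n →
  (∀ q → P q → R q → 1 ≤ n q → (32 ℕ.* n q) ℕ.^ 4 < q → (F : FiniteField q) → 2 ℕ.^ (n q ℕ./ 2) ℕ.* ∣ A F - B q ∣ ≤ B q) →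
  RatioTendsToOne (λ q → P q × R q) A B
ratio-tends-to-one P R n A B infinite small estimate k 1≤k =
  let Q₁ , large   = infinite (k ℕ.* 2)
      Q₂ , quartic = small 32 (s≤s z≤n)
  in  Q₁ ⊔ Q₂ , λ q Q≤q (p , r) F →
      let 2k≤n = large q (ℕₚ.≤-trans (ℕₚ.m≤m⊔n Q₁ Q₂) Q≤q) p
          1≤n  = ℕₚ.≤-trans 1≤k (ℕₚ.≤-trans (ℕₚ.m≤m*n k 2) 2k≤n)
          k≤n/2 = subst (_≤ n q ℕ./ 2) (DivMod.m*n/n≡m k 2) (DivMod./-monoˡ-≤ 2 2k≤n)
      in  ℕₚ.≤-trans (ℕₚ.*-monoˡ-≤ ∣ A F - B q ∣ (ℕₚ.≤-trans (k≤2^k k) (ℕₚ.^-monoʳ-≤ 2 k≤n/2)))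
            (estimate q p r 1≤n (quartic q (ℕₚ.≤-trans (ℕₚ.m≤n⊔m Q₁ Q₂) Q≤q) p) F)

1<q-if-small : ∀ n q → 1 ≤ n → (32 ℕ.* n) ℕ.^ 4 < q → 1 < q
1<q-if-small n q 1≤n small = ℕₚ.≤-<-trans 1≤n (ℕₚ.≤-<-trans (ℕₚ.m≤n*m n 1048576) (Estimates.Small.linear-small n q 1≤n small))

module _ {q : ℕ} (F : FiniteField q) (h : HalfOrder q) where

  open CharacterExpansion F (half h) (1≤half h) (q≡1+2half h) using (IsUnit; κ; σ)
  module M = MainEstimate F (half h) (1≤half h) (q≡1+2half h)

  Ω-asymptotic : ∀ n → 1 ≤ n → (32 ℕ.* n) ℕ.^ 4 < q → (∀ {ε} → IsUnit ε → κ ε n ≡ ℤ.+ 1) →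
    2 ℕ.^ (n ℕ./ 2) ℕ.* ∣ length (Ω F n) ℕ.* 2 ℕ.^ n - 4 ℕ.* (q C n) ∣ ≤ 4 ℕ.* (q C n)
  Ω-asymptotic (suc n) _ small = M.Ω-estimate n small

  Ω̃-asymptotic : ∀ n → 1 ≤ n → (32 ℕ.* n) ℕ.^ 4 < q → κ σ n ≡ ℤ.+ 1 →
    2 ℕ.^ (n ℕ./ 2) ℕ.* ∣ length (Ω̃ F n) ℕ.* 2 ℕ.^ n - 2 ℕ.* (q C n) ∣ ≤ 2 ℕ.* (q C n)
  Ω̃-asymptotic (suc n) _ small = M.Ω̃-estimate n small

open Data.Nat using (_*_; _^_; _%_)

theorem6p3 :
  -- (a) q ≡ 3 (mod 4)
  ( ∀ q → IsOddPrimePower q → q % 4 ≡ 3 → (F : FiniteField q) →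
      (∀ n → n % 4 ≡ 2 → Ω F n ≡ [])
    × (∀ n → n % 4 ≡ 1 → Ω̃ F n ≡ []) )
  ×
  -- (b) q ≡ 3 (mod 4), n = n(q) → ∞, n / q^{1/4} → 0
  ( (n : ℕ → ℕ) →
    TendsToInfinity (λ q → IsOddPrimePower q × q % 4 ≡ 3) n →
    QuarticSmall (λ q → IsOddPrimePower q × q % 4 ≡ 3) n →
      RatioTendsToOne (λ q → (IsOddPrimePower q × q % 4 ≡ 3) × n q % 4 ≡ 0)
        (λ {q} F → length (Ω F (n q)) * 2 ^ n q)
        (λ q → 4 * (q C n q))
    × RatioTendsToOne (λ q → (IsOddPrimePower q × q % 4 ≡ 3) × n q % 4 ≡ 3)
        (λ {q} F → length (Ω̃ F (n q)) * 2 ^ n q)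
        (λ q → 2 * (q C n q)) )
  ×
  -- (c) q ≡ 1 (mod 4), n = n(q) → ∞, n / q^{1/4} → 0
  ( (n : ℕ → ℕ) →
    TendsToInfinity (λ q → IsOddPrimePower q × q % 4 ≡ 1) n →
    QuarticSmall (λ q → IsOddPrimePower q × q % 4 ≡ 1) n →
      RatioTendsToOne (λ q → (IsOddPrimePower q × q % 4 ≡ 1) × n q % 2 ≡ 0)
        (λ {q} F → length (Ω F (n q)) * 2 ^ n q)
        (λ q → 4 * (q C n q))
    × RatioTendsToOne (λ q → (IsOddPrimePower q × q % 4 ≡ 1) × n q % 2 ≡ 1)
        (λ {q} F → length (Ω̃ F (n q)) * 2 ^ n q)
        (λ q → 2 * (q C n q)) )
theorem6p3 = part-a , part-b , part-c
  where
  part-a : ∀ q → IsOddPrimePower q → q % 4 ≡ 3 → (F : FiniteField q) →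
           (∀ n → n % 4 ≡ 2 → Ω F n ≡ []) × (∀ n → n % 4 ≡ 1 → Ω̃ F n ≡ [])
  part-a q _ q%4≡3 F = let h , j , half≡ = half-3mod4 q q%4≡3
                           σ≡-1 = MinusOne.σ-odd F (half h) (1≤half h) (q≡1+2half h) j half≡
                       in  Counting.Ω-empty F (half h) (1≤half h) (q≡1+2half h) σ≡-1 ,
                           Counting.Ω̃-empty F (half h) (1≤half h) (q≡1+2half h) σ≡-1

  part-b : (n : ℕ → ℕ) → TendsToInfinity (λ q → IsOddPrimePower q × q % 4 ≡ 3) n → QuarticSmall (λ q → IsOddPrimePower q × q % 4 ≡ 3) n →
    RatioTendsToOne (λ q → (IsOddPrimePower q × q % 4 ≡ 3) × n q % 4 ≡ 0) (λ {q} F → length (Ω F (n q)) * 2 ^ n q) (λ q → 4 * (q C n q)) ×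
    RatioTendsToOne (λ q → (IsOddPrimePower q × q % 4 ≡ 3) × n q % 4 ≡ 3) (λ {q} F → length (Ω̃ F (n q)) * 2 ^ n q) (λ q → 2 * (q C n q))
  part-b n infinite quartic =
    ratio-tends-to-one _ (λ q → n q % 4 ≡ 0) n (λ {q} F → length (Ω F (n q)) * 2 ^ n q) (λ q → 4 * (q C n q)) infinite quartic
      (λ { q (_ , q%4≡3) n%4≡0 1≤n small F → let h = proj₁ (half-3mod4 q q%4≡3) in
           Ω-asymptotic F h (n q) 1≤n small (λ ε-unit → Counting.κ-0mod4 F (half h) (1≤half h) (q≡1+2half h) (n q) ε-unit n%4≡0) }) ,
    ratio-tends-to-one _ (λ q → n q % 4 ≡ 3) n (λ {q} F → length (Ω̃ F (n q)) * 2 ^ n q) (λ q → 2 * (q C n q)) infinite quartic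
      (λ { q (_ , q%4≡3) n%4≡3 1≤n small F → let h = proj₁ (half-3mod4 q q%4≡3) in
           Ω̃-asymptotic F h (n q) 1≤n small (Counting.κσ-3mod4 F (half h) (1≤half h) (q≡1+2half h) (n q) n%4≡3) })

  part-c : (n : ℕ → ℕ) → TendsToInfinity (λ q → IsOddPrimePower q × q % 4 ≡ 1) n → QuarticSmall (λ q → IsOddPrimePower q × q % 4 ≡ 1) n →
    RatioTendsToOne (λ q → (IsOddPrimePower q × q % 4 ≡ 1) × n q % 2 ≡ 0) (λ {q} F → length (Ω F (n q)) * 2 ^ n q) (λ q → 4 * (q C n q)) ×
    RatioTendsToOne (λ q → (IsOddPrimePower q × q % 4 ≡ 1) × n q % 2 ≡ 1) (λ {q} F → length (Ω̃ F (n q)) * 2 ^ n q) (λ q → 2 * (q C n q))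
  part-c n infinite quartic =
    ratio-tends-to-one _ (λ q → n q % 2 ≡ 0) n (λ {q} F → length (Ω F (n q)) * 2 ^ n q) (λ q → 4 * (q C n q)) infinite quartic
      (λ { q (_ , q%4≡1) n%2≡0 1≤n small F →
           let h , j , half≡ = half-1mod4 q (1<q-if-small (n q) q 1≤n small) q%4≡1
               σ≡1 = MinusOne.σ-even F (half h) (1≤half h) (q≡1+2half h) j half≡
           in  Ω-asymptotic F h (n q) 1≤n small (λ ε-unit → Counting.κ-even F (half h) (1≤half h) (q≡1+2half h) σ≡1 (n q) ε-unit n%2≡0) }) ,
    ratio-tends-to-one _ (λ q → n q % 2 ≡ 1) n (λ {q} F → length (Ω̃ F (n q)) * 2 ^ n q) (λ q → 2 * (q C n q)) infinite quartic
      (λ { q (_ , q%4≡1) n%2≡1 1≤n small F →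
           let h , j , half≡ = half-1mod4 q (1<q-if-small (n q) q 1≤n small) q%4≡1
               σ≡1 = MinusOne.σ-even F (half h) (1≤half h) (q≡1+2half h) j half≡
           in  Ω̃-asymptotic F h (n q) 1≤n small (Counting.κσ-1 F (half h) (1≤half h) (q≡1+2half h) σ≡1 (n q)) })
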